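{- Let $S = \langle a, ah+d, ah+2d, \ldots, ah+kd\rangle$ be an extra-generalized arithmetical numerical semigroup, and suppose $1<k<a-2$. The extremal rays of the face $F\subset\mathcal{C}(\mathbb{Z}_a)$ containing $S$ are spanned by the following: (i) the vector $\vec r$ that, when added to the Kunz coordinates of $S$ in $P_a$, yields (the Kunz coordinates of) $$\langle a, ah+(d+a), \ldots, ah+k(d+a)\rangle;$$ and (ii) the vector $\vec t$ that, when added to the Kunz coordinates of $S$ in $P_a$, yields (the Kunz coordinates of) $$\langle a, a(h+a)+(d-a\lfloor a/k\rfloor),\ldots, a(h+a)+k(d-a\lfloor a/k\rfloor)\rangle.$$ The ray $\vec r$ contains all of the numerical semigroups $\langle a,b\rangle$ for positive $b\equiv d \bmod a$, and the ray $\vec t$ contains numerical semigroups if $k\mid(a-1)$, in which case those semigroups have the form $\langle a,b\rangle$ for some positive $b\equiv kd\bmod a$.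
   Context: A numerical semigroup is a subset $S \subseteq \mathbb{Z}_{\ge 0}$ containing $0$, closed under addition, with finite complement; $\langle n_1,\ldots,n_k\rangle$ denotes the set of all non-negative integer combinations of $n_1,\ldots,n_k$. For $m \in S$, $m>0$, the Apéry set $\operatorname{Ap}(S;m) = \{n \in S : n-m\notin S\}$ has exactly one element in each residue class modulo $m$; write $\operatorname{Ap}(S;m) = \{0,a_1,\ldots,a_{m-1}\}$ with $a_i = mz_i+i$ for $1\le i\le m-1$. The tuple $(a_1,\ldots,a_{m-1})$ is the Apéry tuple of $S$ and $(z_1,\ldots,z_{m-1})$ is the tuple of Kunz coordinates of $S$ (with respect to $m$). For $m\ge 2$, the group cone $\mathcal{C}(\mathbb{Z}_m)\subset\mathbb{R}^{m-1}$ (coordinates indexed by $\mathbb{Z}_m\setminus\{0\}$) is the cone defined by the inequalities $x_i+x_j\ge x_{i+j}$ for $i,j\in\mathbb{Z}_m\setminus\{0\}$ with $i+j\ne 0$. The Kunz polyhedron $P_m$ is the translate of $\mathcal{C}(\mathbb{Z}_m)$ with vertex $(-\tfrac1m,\ldots,-\tfrac{m-1}{m})$; its integer points are exactly the Kunz coordinate tuples of numerical semigroups containing $m$. A face (in particular a ray) $F$ of $\mathcal{C}(\mathbb{Z}_m)$ contains a numerical semigroup $S$ (with $m\in S$) if the Apéry tuple of $S$ lies in the relative interior of $F$. An extra-generalized arithmetical numerical semigroup is a numerical semigroup of the form $S = \langle a, ah+d, ah+2d,\ldots, ah+kd\rangle$ with $a,h,k \in \mathbb{Z}_{\ge 1}$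 and $d\in\mathbb{Z}$ such that $k<a$, $\gcd(a,d)=1$, and $ah+kd>a$.
   Formalization: The listed generators a, ah+d, …, ah+kd are assumed to minimally generate S; without this the claim fails, e.g. (a,h,k,d)=(5,6,2,−12), where S=⟨5,18,6⟩=⟨5,6⟩ lies on a ray. ℝ is replaced by any ordered field with decidable order (ℝ classically). -}

module Defs where

open import Level using (Level; 0ℓ) renaming (suc to lsuc)
open import Algebra.Bundles using (CommutativeRing)
import Algebra.Definitions.RawMonoid as RawMonoidOps
import Algebra.Properties.Semiring.Sum as SemiringSum
open import Data.Fin.Base using (Fin; zero; suc; toℕ)
open import Data.Integer.Base as ℤ using (ℤ; +_; -[1+_]; 0ℤ; 1ℤ)
open import Data.Integer.Divisibility.Signed using (_∣_)
open import Data.Integer.GCD using (gcd)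
open import Data.Integer.Properties using (+-*-semiring)
open import Data.List.Base using (List)
import Data.List.Membership.Propositional as List
open import Data.Nat.Base as ℕ using (ℕ; suc; pred)
open import Data.Product using (∃; ∃₂; _×_)
open import Data.Sum using (_⊎_)
open import Data.Vec.Functional using (Vector; removeAt)
open import Relation.Binary.Core using (Rel)
open import Relation.Binary.PropositionalEquality using (_≡_)
open import Relation.Binary.Structures using (IsDecTotalOrder)
open import Relation.Nullary using (¬_)
open import Relation.Unary using (Pred; _∈_; _∉_; _⊆_; _≐_)

open SemiringSum +-*-semiring using () renaming (sum to ℤ-sum)

infix 4 _≡_[mod_]

_≡_[mod_] : ℤ → ℤ → ℕ → Set
x ≡ y [mod m ] = + m ∣ (x ℤ.- y)

------------------------------------------------------------------------
-- Numerical semigroups, as subsets of ℤ so that n - m makes sense in the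
-- definition of the Apéry set.

record IsNumericalSemigroup (S : Pred ℤ 0ℓ) : Set where
  field
    nonNegative      : ∀ {n} → n ∈ S → 0ℤ ℤ.≤ n
    zero-closed      : 0ℤ ∈ S
    +-closed         : ∀ {m n} → m ∈ S → n ∈ S → m ℤ.+ n ∈ S
    finiteComplement : ∃ λ (gaps : List ℤ) →
                       ∀ n → 0ℤ ℤ.≤ n → n ∈ S ⊎ n List.∈ gaps

⟨_⟩ : ∀ {n} → Vector ℤ n → Pred ℤ 0ℓ
⟨_⟩ {n} g x = ∃ λ (c : Vector ℕ n) → x ≡ ℤ-sum (λ i → + c i ℤ.* g i)

IsMinimallyGenerating : ∀ {n} → Vector ℤ (suc n) → Set
IsMinimallyGenerating g = ∀ i → g i ∉ ⟨ removeAt g i ⟩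

Ap : Pred ℤ 0ℓ → ℕ → Pred ℤ 0ℓ
Ap S m n = n ∈ S × (n ℤ.- + m) ∉ S

-- ℤ_m ∖ {0} is indexed by Fin (pred m), with i standing for the class of
-- i + 1, so that the representatives are 1, …, m - 1.

residue : ∀ {n} → Fin n → ℤ
residue i = + suc (toℕ i)

record IsApéryTuple (S : Pred ℤ 0ℓ) (m : ℕ) (x : Vector ℤ (pred m)) : Set where
  field
    isNumericalSemigroup : IsNumericalSemigroup S
    modulus∈S            : + m ∈ S
    inApérySet           : ∀ i → x i ∈ Ap S m
    inClass              : ∀ i → x i ≡ residue i [mod m ]

IsKunzTuple : Pred ℤ 0ℓ → (m : ℕ) → Vector ℤ (pred m) → Set
IsKunzTuple S m z = IsApéryTuple S m (λ i → + m ℤ.* z i ℤ.+ residue i)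

-- Kunz tuples are unique, so at most one v displaces S to T.

Displaces : (m : ℕ) → Vector ℤ (pred m) → Pred ℤ 0ℓ → Pred ℤ 0ℓ → Set
Displaces m v S T =
  ∃ λ z → IsKunzTuple S m z × IsKunzTuple T m (λ i → z i ℤ.+ v i)

egaGenerators : (a h k : ℕ) (d : ℤ) → Vector ℤ (suc k)
egaGenerators a h k d zero    = + a
egaGenerators a h k d (suc j) = + (a ℕ.* h) ℤ.+ + suc (toℕ j) ℤ.* d

-- The listed generators are understood to be the minimal ones.  This is
-- automatic for d > 0 but not for d < 0: (a, h, k, d) = (5, 6, 2, -12)
-- satisfies the numerical conditions and gives ⟨5, 18, 6⟩ = ⟨5, 6⟩.

record IsExtraGeneralizedArithmetical (a h k : ℕ) (d : ℤ) : Set where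
  field
    isNumericalSemigroup : IsNumericalSemigroup ⟨ egaGenerators a h k d ⟩
    isMinimal            : IsMinimallyGenerating (egaGenerators a h k d)
    k<a                  : k ℕ.< a
    coprime              : gcd (+ a) d ≡ 1ℤ
    a<ah+kd              : + a ℤ.< + (a ℕ.* h) ℤ.+ + k ℤ.* d

------------------------------------------------------------------------
-- The scalars.  An arbitrary ordered field stands in for ℝ.  The order is
-- decidable, as it is classically for ℝ.

record OrderedField (ℓ : Level) : Set (lsuc ℓ) where
  field
    commutativeRing : CommutativeRing ℓ ℓ
  open CommutativeRing commutativeRing public
  infix 4 _≤_ _<_
  field
    _≤_             : Rel Carrier ℓ
    isDecTotalOrder : IsDecTotalOrder _≈_ _≤_
    +-monoʳ-≤       : ∀ x {y z} → y ≤ z → x + y ≤ x + z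
    *-nonNegative   : ∀ {x y} → 0# ≤ x → 0# ≤ y → 0# ≤ x * y
    0≉1             : ¬ 0# ≈ 1#
    inverse         : ∀ x → ¬ x ≈ 0# → ∃ λ y → x * y ≈ 1#

  _<_ : Rel Carrier ℓ
  x < y = x ≤ y × ¬ x ≈ y

  open SemiringSum semiring public using (sum)
  open RawMonoidOps +-rawMonoid using () renaming (_×_ to _·_)

  fromℤ : ℤ → Carrier
  fromℤ (+ n)    = n · 1#
  fromℤ -[1+ n ] = - (suc n · 1#)

------------------------------------------------------------------------
-- Convex geometry in K^n

module _ {ℓ : Level} (K : OrderedField ℓ) where
  open OrderedField K

  Point : ℕ → Set ℓ
  Point n = Vector Carrier n

  Region : ℕ → Set (lsuc ℓ)
  Region n = Pred (Point n) ℓ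

  embed : ∀ {n} → Vector ℤ n → Point n
  embed v i = fromℤ (v i)

  -- A face of C is a convex subset F such that any segment in C with a
  -- relatively interior point in F lies in F.

  record IsFace {n} (C F : Region n) : Set ℓ where
    field
      subset  : F ⊆ C
      convex  : ∀ {x y z s t} → x ∈ F → y ∈ F →
                0# ≤ s → 0# ≤ t → s + t ≈ 1# →
                (∀ i → z i ≈ s * x i + t * y i) → z ∈ F
      extreme : ∀ {x y z s t} → x ∈ C → y ∈ C →
                0# < s → 0# < t → s + t ≈ 1# →
                (∀ i → z i ≈ s * x i + t * y i) → z ∈ F → x ∈ F × y ∈ F

  Ray : ∀ {n} → Point n → Region n
  Ray v x = ∃ λ c → 0# ≤ c × (∀ i → x i ≈ c * v i)

  IsExtremalRay : ∀ {n} → Region n → Region n → Set ℓ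
  IsExtremalRay C G =
    IsFace C G × (∃ λ v → ¬ (∀ i → v i ≈ 0#) × G ≐ Ray v)

  AffineHull : ∀ {n} → Region n → Region n
  AffineHull {n} G y =
    ∃ λ p → ∃₂ λ (c : Vector Carrier p) (x : Vector (Point n) p) →
      (∀ j → x j ∈ G) × sum c ≈ 1# × (∀ i → y i ≈ sum (λ j → c j * x j i))

  -- Interior relative to the affine hull, with sup-norm balls.

  RelativeInterior : ∀ {n} → Region n → Region n
  RelativeInterior G x = x ∈ G × (∃ λ ε → 0# < ε ×
    (∀ y → y ∈ AffineHull G → (∀ i → x i - ε < y i × y i < x i + ε) → y ∈ G))

  -- The hypothesis on l says that i + j = l in ℤ_m; in particular i + j ≠ 0.

  GroupCone : (m : ℕ) → Region (pred m)
  GroupCone m x =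
    ∀ i j l → residue i ℤ.+ residue j ≡ residue l [mod m ] → x l ≤ x i + x j

  Contains : (m : ℕ) → Region (pred m) → Pred ℤ 0ℓ → Set ℓ
  Contains m F S =
    ∃ λ x → IsApéryTuple S m x × embed x ∈ RelativeInterior F

{-# OPTIONS --safe #-}
module Submission where

-- Write q = ⌊a/k⌋ and let j d, with 0 < j < a, represent the nonzero classes modulo a.  The Apéry element of S in the
-- class of j d is ah ⌈j/k⌉ + jd: replacing j by j + na costs at least naN, where N = hq + d, and N > 0 because the
-- generators are minimal.  Hence the Apéry tuple of S is h t + N r with r(j) = j and t(j) = a ⌈j/k⌉ - qj.
--
-- For an integer point w of the group cone, the face having w in its relative interior consists of the points of the
-- cone at which every inequality tight at w is tight.  For w = h t + N r these equalities make x(i) + x(j), for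
-- i, j ≤ k < i + j < a, depend on i + j only; comparing the sums k + 1 and k + 2 shows that x is an arithmetic
-- progression on 1, …, k, and x(j + k) = x(j) + x(k) then determines x.  So the face is spanned by r and t, and
-- 2 x(1) ≥ x(2) and x(k) + x(a + 1 - k) ≥ x(1) say that the two coefficients are nonnegative.

open import Defs
open import Level using (Level; 0ℓ)
import Algebra.Properties.CommutativeMonoid.Sum as CommutativeMonoidSum
import Algebra.Properties.Ring as RingProperties
import Algebra.Properties.Semiring.Mult as Mult
import Algebra.Properties.Semiring.Sum as SemiringSum
import Algebra.Solver.Ring as RingSolver
open import Algebra.Solver.Ring.AlmostCommutativeRing using (fromCommutativeRing; _-Raw-AlmostCommutative⟶_)
open import Data.Fin.Base using (Fin; zero; suc; toℕ; fromℕ<; punchOut)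
open import Data.Fin.Properties using (toℕ-fromℕ<; toℕ-injective; toℕ<n; punchIn-punchOut)
open import Data.Integer.Base as ℤ using (ℤ; +_; -[1+_]; 0ℤ; 1ℤ)
import Data.Integer.DivMod as ℤ
open import Data.Integer.Divisibility.Signed using (divides; ∣⇒∣ᵤ; ∣m∣n⇒∣m+n; ∣m⇒∣-m; ∣n⇒∣m*n) renaming (_∣_ to _∣ℤ_)
open import Data.Integer.GCD using (gcd)
import Data.Integer.Properties as ℤ
open import Data.Integer.Tactic.RingSolver using (solve-∀)
open import Data.List.Base using (map; upTo)
import Data.List.Membership.Propositional as List
open import Data.List.Membership.Propositional.Properties using (∈-map⁺; ∈-upTo⁺)
open import Data.Maybe.Base using (Maybe; just; nothing)
open import Data.Nat.Base as ℕ using (ℕ; zero; suc; pred; NonZero; z≤n; s≤s)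
import Data.Nat.DivMod as ℕ
import Data.Nat.Divisibility as ℕ
import Data.Nat.GCD as ℕ
import Data.Nat.Properties as ℕ
open import Data.Nat.Tactic.RingSolver using () renaming (solve-∀ to ℕ-solve-∀)
open import Data.Product using (∃; ∃₂; _×_; _,_; proj₁; proj₂)
open import Data.Sum as ⊎ using (_⊎_; inj₁; inj₂)
open import Data.Vec.Functional using (Vector; tail; removeAt; _∷_; [])
open import Function.Base using (_∘_; case_of_)
open import Function.Bundles using (_⇔_; mk⇔)
open import Relation.Binary.PropositionalEquality using (_≡_; _≢_; _≗_; refl; sym; trans; cong; cong₂; subst; subst₂; module ≡-Reasoning)
open import Relation.Binary.Structures using (IsDecTotalOrder)
open import Relation.Nullary using (¬_; Dec; yes; no; contradiction)
open import Relation.Nullary.Decidable using (_×-dec_)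
open import Relation.Unary using (Pred; _∈_; _∉_; _⊆_; _≐_)

-- The pair (h, N) serves as coordinates on the face. Raising d by a raises N by a and keeps h;
-- passing to (h + a, d - aq) raises h by a and keeps N, since (h + a)q + (d - aq) = hq + d. A Kunz
-- coordinate counts multiples of a, so these two moves add exactly r and t to the Kunz tuple; this
-- is where ⌊a/k⌋ in the second semigroup comes from. The condition k < a - 2 keeps both sums k + 1
-- and k + 2 below a, so that neither wraps around, and 1 < k provides the two values that fix a
-- progression. A face is given only by convexity and extremeness, and its relative interior only by
-- a ball in its affine hull, so the inequalities defining it are not known beforehand. The
-- comparison stays elementary because w is an integer vector: each slack of w is 0 or at least 1,
-- so one radius and one multiple of w serve for all inequalities at once. The formula for the Apéry
-- set also holds at h = 0 and k = 1, where it describes ⟨a, b⟩; this is how these semigroups are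
-- placed on the rays.

module ℤΣ = CommutativeMonoidSum ℤ.+-0-commutativeMonoid
open SemiringSum ℤ.+-*-semiring using () renaming (sum to ℤ-sum)

-- Congruences

module _ {m : ℕ} where

  ≡⇒≡mod : ∀ {x y} → x ≡ y → x ≡ y [mod m ]
  ≡⇒≡mod x≡y = divides 0ℤ (ℤ.i≡j⇒i-j≡0 x≡y)

  mod-sym : ∀ x y → x ≡ y [mod m ] → y ≡ x [mod m ]
  mod-sym x y p = subst (+ m ∣ℤ_) (lemma x y) (∣m⇒∣-m p)
    where
    lemma : ∀ x y → ℤ.- (x ℤ.- y) ≡ y ℤ.- x
    lemma = solve-∀

  mod-trans : ∀ x y z → x ≡ y [mod m ] → y ≡ z [mod m ] → x ≡ z [mod m ]
  mod-trans x y z p q = subst (+ m ∣ℤ_) (lemma x y z) (∣m∣n⇒∣m+n p q)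
    where
    lemma : ∀ x y z → (x ℤ.- y) ℤ.+ (y ℤ.- z) ≡ x ℤ.- z
    lemma = solve-∀

  mod-+ : ∀ x x′ y y′ → x ≡ x′ [mod m ] → y ≡ y′ [mod m ] → x ℤ.+ y ≡ x′ ℤ.+ y′ [mod m ]
  mod-+ x x′ y y′ p q = subst (+ m ∣ℤ_) (lemma x x′ y y′) (∣m∣n⇒∣m+n p q)
    where
    lemma : ∀ x x′ y y′ → (x ℤ.- x′) ℤ.+ (y ℤ.- y′) ≡ (x ℤ.+ y) ℤ.- (x′ ℤ.+ y′)
    lemma = solve-∀

  mod-*ˡ : ∀ c x y → x ≡ y [mod m ] → c ℤ.* x ≡ c ℤ.* y [mod m ]
  mod-*ˡ c x y p = subst (+ m ∣ℤ_) (lemma c x y) (∣n⇒∣m*n c p)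
    where
    lemma : ∀ c x y → c ℤ.* (x ℤ.- y) ≡ c ℤ.* x ℤ.- c ℤ.* y
    lemma = solve-∀

  mod-+multiple : ∀ x q → x ℤ.+ q ℤ.* + m ≡ x [mod m ]
  mod-+multiple x q = divides q (lemma x (q ℤ.* + m))
    where
    lemma : ∀ x y → x ℤ.+ y ℤ.- x ≡ y
    lemma = solve-∀

  mod⇒≡ : ∀ x y → x ≡ y [mod m ] → ∃ λ q → x ≡ y ℤ.+ q ℤ.* + m
  mod⇒≡ x y (divides q eq) = q , trans (lemma x y) (cong (λ z → y ℤ.+ z) eq)
    where
    lemma : ∀ x y → x ≡ y ℤ.+ (x ℤ.- y)
    lemma = solve-∀

  mod-small : ∀ {x y} → x ℕ.< m → y ℕ.< m → + x ≡ + y [mod m ] → x ≡ y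
  mod-small {x} {y} x<m y<m p with ℤ.∣ + x ℤ.- + y ∣ in eq
  ... | zero  = ℤ.+-injective (ℤ.i-j≡0⇒i≡j (+ x) (+ y) (ℤ.∣i∣≡0⇒i≡0 eq))
  ... | suc n = contradiction (subst (m ℕ.∣_) eq (∣⇒∣ᵤ p)) (ℕ.>⇒∤ n<m)
    where
    n<m : suc n ℕ.< m
    n<m = ℕ.≤-<-trans
      (subst (ℕ._≤ x ℕ.⊔ y) (trans (cong ℤ.∣_∣ (sym (ℤ.[+m]-[+n]≡m⊖n x y))) eq) (ℤ.∣m⊝n∣≤m⊔n x y))
      (ℕ.⊔-lub x<m y<m)

mod⇒≡+ : ∀ {m x y} → x ≡ y [mod m ] → y ℤ.≤ x → ∃ λ p → x ≡ y ℤ.+ + p ℤ.* + m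
mod⇒≡+ {m} {x} {y} x≡y y≤x with mod⇒≡ x y x≡y
... | + p      , eq = p , eq
-- The modulus may be 0; then x = y and the negative quotient can be replaced by 0.
mod⇒≡+ {zero}  {x} {y} x≡y y≤x | -[1+ p ] , eq = 0 , trans eq (cong (λ z → y ℤ.+ z) (ℤ.*-zeroʳ -[1+ p ]))
mod⇒≡+ {suc m} {x} {y} x≡y y≤x | -[1+ p ] , eq = contradiction
  (subst (0ℤ ℤ.≤_) (trans (cong (ℤ._- y) eq) (lemma y (-[1+ p ] ℤ.* + suc m))) (ℤ.i≤j⇒0≤j-i y≤x)) λ ()
  where
  lemma : ∀ y z → y ℤ.+ z ℤ.- y ≡ z
  lemma = solve-∀

classify : ∀ m .{{_ : NonZero m}} x → x ≡ 0ℤ [mod m ] ⊎ ∃ λ (i : Fin (pred m)) → x ≡ residue i [mod m ]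
classify m@(suc n) x with x ℤ.%ℕ m | ℤ.n%ℕd<d x m | ℤ.a≡a%ℕn+[a/ℕn]*n x m
... | zero  | _       | eq = inj₁ (subst (_≡ 0ℤ [mod m ]) (sym eq) (mod-+multiple 0ℤ (x ℤ./ℕ m)))
... | suc r | s≤s r<n | eq = inj₂ (fromℕ< r<n ,
  subst (λ y → x ≡ + suc y [mod m ]) (sym (toℕ-fromℕ< r<n))
    (subst (_≡ + suc r [mod m ]) (sym eq) (mod-+multiple (+ suc r) (x ℤ./ℕ m))))

residue<m : ∀ {m} (i : Fin (pred m)) → suc (toℕ i) ℕ.< m
residue<m {suc m} i = s≤s (toℕ<n i)

-- Numerical semigroups and Apéry tuples

module _ {P : Pred ℤ 0ℓ} (0∈P : 0ℤ ∈ P) (+∈P : ∀ {x y} → x ∈ P → y ∈ P → x ℤ.+ y ∈ P) where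

  multiple∈ : ∀ {x} → x ∈ P → ∀ n → + n ℤ.* x ∈ P
  multiple∈     x∈P zero    = 0∈P
  multiple∈ {x} x∈P (suc n) = subst P (sym (ℤ.suc-* (+ n) x)) (+∈P x∈P (multiple∈ x∈P n))

  +multiple∈ : ∀ {x y} → x ∈ P → y ∈ P → ∀ n → x ℤ.+ + n ℤ.* y ∈ P
  +multiple∈ x∈P y∈P n = +∈P x∈P (multiple∈ y∈P n)

  -- The induction principle for spans. Besides semigroups, P will be `EgaForm` and nonnegativity.
  span⊆ : ∀ {n} (g : Vector ℤ n) → (∀ i → g i ∈ P) → ⟨ g ⟩ ⊆ P
  span⊆ {n} g g∈P (c , eq) = subst P (sym eq) (sum∈ g g∈P c)
    where
    sum∈ : ∀ {n} (g : Vector ℤ n) → (∀ i → g i ∈ P) → (c : Vector ℕ n) →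
           ℤ-sum (λ i → + c i ℤ.* g i) ∈ P
    sum∈ {zero}  g g∈P c = 0∈P
    sum∈ {suc n} g g∈P c =
      +∈P (multiple∈ (g∈P zero) (c zero)) (sum∈ (tail g) (λ i → g∈P (suc i)) (tail c))

module _ {n} (g : Vector ℤ n) where

  0∈span : 0ℤ ∈ ⟨ g ⟩
  0∈span = (λ _ → 0) , sym (ℤΣ.sum-replicate-zero n)

  +∈span : ∀ {x y} → x ∈ ⟨ g ⟩ → y ∈ ⟨ g ⟩ → x ℤ.+ y ∈ ⟨ g ⟩
  +∈span {x} {y} (b , refl) (c , refl) = (λ i → b i ℕ.+ c i) , (begin
    ℤ-sum (λ i → + b i ℤ.* g i) ℤ.+ ℤ-sum (λ i → + c i ℤ.* g i)
      ≡⟨ ℤΣ.∑-distrib-+ {n} _ _ ⟨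
    ℤ-sum (λ i → + b i ℤ.* g i ℤ.+ + c i ℤ.* g i)
      ≡⟨ ℤΣ.sum-cong-≗ (λ i → ℤ.*-distribʳ-+ (g i) (+ b i) (+ c i)) ⟨
    ℤ-sum (λ i → + (b i ℕ.+ c i) ℤ.* g i) ∎)
    where open ≡-Reasoning

generator∈span : ∀ {n} (g : Vector ℤ n) i → g i ∈ ⟨ g ⟩
generator∈span {suc n} g zero = (λ { zero → 1 ; (suc _) → 0 }) , (begin
  g zero                                ≡⟨ ℤ.*-identityˡ (g zero) ⟨
  1ℤ ℤ.* g zero                         ≡⟨ ℤ.+-identityʳ _ ⟨
  1ℤ ℤ.* g zero ℤ.+ 0ℤ                  ≡⟨ cong (λ x → 1ℤ ℤ.* g zero ℤ.+ x) (ℤΣ.sum-replicate-zero n) ⟨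
  1ℤ ℤ.* g zero ℤ.+ ℤ-sum {n} (λ _ → 0ℤ) ∎)
  where open ≡-Reasoning
generator∈span {suc n} g (suc i) with c , eq ← generator∈span (tail g) i =
  (λ { zero → 0 ; (suc j) → c j }) , trans eq (sym (ℤ.+-identityˡ _))

span-resp-≗ : ∀ {n} {f g : Vector ℤ n} → f ≗ g → ⟨ f ⟩ ⊆ ⟨ g ⟩
span-resp-≗ {f = f} {g} f≗g = span⊆ (0∈span g) (+∈span g) f
  (λ i → subst ⟨ g ⟩ (sym (f≗g i)) (generator∈span g i))

module _ {S : Pred ℤ 0ℓ} {m : ℕ} {x : Vector ℤ (pred m)} (tuple : IsApéryTuple S m x) where
  open IsApéryTuple tuple
  open IsNumericalSemigroup isNumericalSemigroup

  -- If the quotient were -(p + 1), then adding p copies of m to n would put `x i` - m into S,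
  -- against the definition of the Apéry set.
  apéry-least : ∀ i {n} → n ∈ S → n ≡ residue i [mod m ] → ∃ λ p → n ≡ x i ℤ.+ + p ℤ.* + m
  apéry-least i {n} n∈S n≡i with mod⇒≡ n (x i) (mod-trans n (residue i) (x i) n≡i (mod-sym (x i) (residue i) (inClass i)))
  ... | + p      , n≡ = p , n≡
  ... | -[1+ p ] , n≡ = contradiction
    (subst S lemma (+multiple∈ {S} zero-closed +-closed n∈S modulus∈S p))
    (proj₂ (inApérySet i))
    where
    identity : ∀ x m p → x ℤ.+ ℤ.- (1ℤ ℤ.+ p) ℤ.* m ℤ.+ p ℤ.* m ≡ x ℤ.- m
    identity = solve-∀
    lemma : n ℤ.+ + p ℤ.* + m ≡ x i ℤ.- + m
    lemma = trans (cong (λ n → n ℤ.+ + p ℤ.* + m) n≡) (identity (x i) (+ m) (+ p))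

  apéry-resp-≗ : ∀ {y} → x ≗ y → IsApéryTuple S m y
  apéry-resp-≗ x≗y = record
    { isNumericalSemigroup = isNumericalSemigroup
    ; modulus∈S            = modulus∈S
    ; inApérySet           = λ i → subst (Ap S m) (x≗y i) (inApérySet i)
    ; inClass              = λ i → subst (_≡ residue i [mod m ]) (x≗y i) (inClass i)
    }

  apéry-resp-≐ : ∀ {T} → S ≐ T → IsApéryTuple T m x
  apéry-resp-≐ (S⊆T , T⊆S) = record
    { isNumericalSemigroup = record
      { nonNegative      = λ n∈T → nonNegative (T⊆S n∈T)
      ; zero-closed      = S⊆T zero-closed
      ; +-closed         = λ m∈T n∈T → S⊆T (+-closed (T⊆S m∈T) (T⊆S n∈T))
      ; finiteComplement = proj₁ finiteComplement , λ n 0≤n → ⊎.map₁ S⊆T (proj₂ finiteComplement n 0≤n)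
      }
    ; modulus∈S  = S⊆T modulus∈S
    ; inApérySet = λ i → S⊆T (proj₁ (inApérySet i)) , λ x-m∈T → proj₂ (inApérySet i) (T⊆S x-m∈T)
    ; inClass    = inClass
    }

-- `Contains` hides its tuple behind an existential; uniqueness identifies that tuple with the
-- explicit one.
apéry-unique : ∀ {S m x y} → IsApéryTuple S m x → IsApéryTuple S m y → x ≗ y
apéry-unique {S} {m} {x} {y} X Y i = ℤ.≤-antisym (least X Y) (least Y X)
  where
  least : ∀ {x y} → IsApéryTuple S m x → IsApéryTuple S m y → x i ℤ.≤ y i
  least {x} {y} X Y with p , y≡ ← apéry-least X i (proj₁ (IsApéryTuple.inApérySet Y i)) (IsApéryTuple.inClass Y i) =
    subst (x i ℤ.≤_) (sym (trans y≡ (cong (λ z → x i ℤ.+ z) (sym (ℤ.pos-* p m))))) (ℤ.i≤i+j (x i) (+ (p ℕ.* m)))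

-- Ceilings

⌈_/_⌉ : (n k : ℕ) .{{_ : NonZero k}} → ℕ
⌈ n / k ⌉ = (n ℕ.+ pred k) ℕ./ k

module _ {k : ℕ} .{{_ : NonZero k}} where

  -- Together with `n≤⌈n/k⌉*k` this characterizes the ceiling as the least m with n ≤ mk. The other
  -- facts of this module follow from the pair, without looking at remainders.
  n≤m*k⇒⌈n/k⌉≤m : ∀ {n m} → n ℕ.≤ m ℕ.* k → ⌈ n / k ⌉ ℕ.≤ m
  n≤m*k⇒⌈n/k⌉≤m {n} {m} n≤mk = ℕ.s≤s⁻¹ (ℕ.m<n*o⇒m/o<n (begin
    suc (n ℕ.+ pred k) ≡⟨ ℕ.+-suc n (pred k) ⟨
    n ℕ.+ suc (pred k) ≡⟨ cong (n ℕ.+_) (ℕ.suc-pred k) ⟩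
    n ℕ.+ k            ≤⟨ ℕ.+-monoˡ-≤ k n≤mk ⟩
    m ℕ.* k ℕ.+ k      ≡⟨ ℕ.+-comm (m ℕ.* k) k ⟩
    suc m ℕ.* k        ∎))
    where open ℕ.≤-Reasoning

  n≤⌈n/k⌉*k : ∀ n → n ℕ.≤ ⌈ n / k ⌉ ℕ.* k
  n≤⌈n/k⌉*k n = ℕ.+-cancelʳ-≤ (pred k) n (⌈ n / k ⌉ ℕ.* k) (begin
    n ℕ.+ pred k                                        ≡⟨ ℕ.m≡m%n+[m/n]*n (n ℕ.+ pred k) k ⟩
    (n ℕ.+ pred k) ℕ.% k ℕ.+ ⌈ n / k ⌉ ℕ.* k            ≤⟨ ℕ.+-monoˡ-≤ _ (ℕ.<⇒≤pred (ℕ.m%n<n (n ℕ.+ pred k) k)) ⟩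
    pred k ℕ.+ ⌈ n / k ⌉ ℕ.* k                          ≡⟨ ℕ.+-comm (pred k) _ ⟩
    ⌈ n / k ⌉ ℕ.* k ℕ.+ pred k                          ∎)
    where open ℕ.≤-Reasoning

  ⌈n/k⌉≤n : ∀ n → ⌈ n / k ⌉ ℕ.≤ n
  ⌈n/k⌉≤n n = n≤m*k⇒⌈n/k⌉≤m (ℕ.m≤m*n n k)

  ⌈[m+n]/k⌉≤⌈m/k⌉+⌈n/k⌉ : ∀ m n → ⌈ m ℕ.+ n / k ⌉ ℕ.≤ ⌈ m / k ⌉ ℕ.+ ⌈ n / k ⌉
  ⌈[m+n]/k⌉≤⌈m/k⌉+⌈n/k⌉ m n = n≤m*k⇒⌈n/k⌉≤m (subst (m ℕ.+ n ℕ.≤_)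
    (sym (ℕ.*-distribʳ-+ k ⌈ m / k ⌉ ⌈ n / k ⌉)) (ℕ.+-mono-≤ (n≤⌈n/k⌉*k m) (n≤⌈n/k⌉*k n)))

  -- The cost of wrapping around: with y = ta and x = tq, raising an index by ta requires at least
  -- tq further generators.
  ⌈n/k⌉+x≤⌈[n+y]/k⌉ : ∀ n {x y} → x ℕ.* k ℕ.≤ y → ⌈ n / k ⌉ ℕ.+ x ℕ.≤ ⌈ n ℕ.+ y / k ⌉
  ⌈n/k⌉+x≤⌈[n+y]/k⌉ n {x} {y} xk≤y = begin
    ⌈ n / k ⌉ ℕ.+ x                    ≤⟨ ℕ.+-monoˡ-≤ x (n≤m*k⇒⌈n/k⌉≤m n≤) ⟩
    (⌈ n ℕ.+ y / k ⌉ ℕ.∸ x) ℕ.+ x      ≡⟨ ℕ.m∸n+n≡m x≤ ⟩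
    ⌈ n ℕ.+ y / k ⌉                    ∎
    where
    open ℕ.≤-Reasoning
    n+xk≤ : n ℕ.+ x ℕ.* k ℕ.≤ ⌈ n ℕ.+ y / k ⌉ ℕ.* k
    n+xk≤ = ℕ.≤-trans (ℕ.+-monoʳ-≤ n xk≤y) (n≤⌈n/k⌉*k (n ℕ.+ y))
    x≤ : x ℕ.≤ ⌈ n ℕ.+ y / k ⌉
    x≤ = ℕ.*-cancelʳ-≤ x _ k (ℕ.≤-trans (ℕ.m≤n+m _ n) n+xk≤)
    n≤ : n ℕ.≤ (⌈ n ℕ.+ y / k ⌉ ℕ.∸ x) ℕ.* k
    n≤ = subst (n ℕ.≤_) (sym (ℕ.*-distribʳ-∸ k _ x)) (ℕ.m+n≤o⇒m≤o∸n n n+xk≤)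

  ⌈n/k⌉≡1 : ∀ {n} → 1 ℕ.≤ n → n ℕ.≤ k → ⌈ n / k ⌉ ≡ 1
  ⌈n/k⌉≡1 {n} 1≤n n≤k = ℕ.≤-antisym
    (n≤m*k⇒⌈n/k⌉≤m (subst (n ℕ.≤_) (sym (ℕ.*-identityˡ k)) n≤k))
    (ℕ.*-cancelʳ-< k 0 _ (ℕ.≤-trans 1≤n (n≤⌈n/k⌉*k n)))

  ⌈[n+k]/k⌉≡⌈n/k⌉+1 : ∀ n → ⌈ n ℕ.+ k / k ⌉ ≡ ⌈ n / k ⌉ ℕ.+ 1
  ⌈[n+k]/k⌉≡⌈n/k⌉+1 n = ℕ.≤-antisym
    (n≤m*k⇒⌈n/k⌉≤m (subst (n ℕ.+ k ℕ.≤_)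
      (sym (trans (ℕ.*-distribʳ-+ k ⌈ n / k ⌉ 1) (cong (λ z → ⌈ n / k ⌉ ℕ.* k ℕ.+ z) (ℕ.*-identityˡ k))))
      (ℕ.+-monoˡ-≤ k (n≤⌈n/k⌉*k n))))
    (⌈n/k⌉+x≤⌈[n+y]/k⌉ n (ℕ.≤-reflexive (ℕ.*-identityˡ k)))

-- Apéry sets of extra-generalized arithmetical semigroups

-- Coordinates of the cone are listed by residues, whereas the argument runs along multiples of d.
-- The map u translates: `u i` is the quotient of the residue by d modulo m, taken between 1 and m -
-- 1.
record IsIndex (m : ℕ) (d : ℤ) (u : Fin (pred m) → ℕ) : Set where
  field
    positive : ∀ i → 0 ℕ.< u i
    bounded  : ∀ i → u i ℕ.< m
    hits     : ∀ i → + u i ℤ.* d ≡ residue i [mod m ]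

module _ {m : ℕ} {d e : ℤ} (de≡1 : d ℤ.* e ≡ 1ℤ [mod m ]) where

  mod-cancel : ∀ x y → x ℤ.* d ≡ y ℤ.* d [mod m ] → x ≡ y [mod m ]
  mod-cancel x y xd≡yd = mod-trans x (x ℤ.* d ℤ.* e) y (mod-sym _ x (reduce x))
    (mod-trans (x ℤ.* d ℤ.* e) (y ℤ.* d ℤ.* e) y
      (subst₂ (_≡_[mod m ]) (ℤ.*-comm e _) (ℤ.*-comm e _) (mod-*ˡ e (x ℤ.* d) (y ℤ.* d) xd≡yd))
      (reduce y))
    where
    reduce : ∀ z → z ℤ.* d ℤ.* e ≡ z [mod m ]
    reduce z = subst₂ (_≡_[mod m ]) (sym (ℤ.*-assoc z d e)) (ℤ.*-identityʳ z) (mod-*ˡ z (d ℤ.* e) 1ℤ de≡1)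

  residue≢0 : ∀ (i : Fin (pred m)) → ¬ residue i ≡ 0ℤ [mod m ]
  residue≢0 i p = contradiction (mod-small {x = suc (toℕ i)} {0} (residue<m i) 0<m p) ℕ.1+n≢0
    where
    0<m : 0 ℕ.< m
    0<m = ℕ.≤-<-trans z≤n (residue<m i)

  multiple≢0 : ∀ {j} → 0 ℕ.< j → j ℕ.< m → ¬ + j ℤ.* d ≡ 0ℤ [mod m ]
  multiple≢0 {j} 0<j j<m jd≡0 = contradiction
    (mod-small {x = j} {0} j<m (ℕ.<-trans 0<j j<m) (mod-cancel (+ j) 0ℤ jd≡0)) (ℕ.>⇒≢ 0<j)

  index : .{{_ : NonZero m}} → ∃ (IsIndex m d)
  index = u , record
    { positive = λ i → ℕ.n≢0⇒n>0 (λ ui≡0 → residue≢0 i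
        (mod-sym 0ℤ (residue i) (subst (λ n → + n ℤ.* d ≡ residue i [mod m ]) ui≡0 (hits i))))
    ; bounded  = λ i → ℤ.n%ℕd<d (residue i ℤ.* e) m
    ; hits     = hits
    }
    where
    u : Fin (pred m) → ℕ
    u i = (residue i ℤ.* e) ℤ.%ℕ m
    hits : ∀ i → + u i ℤ.* d ≡ residue i [mod m ]
    hits i = mod-trans (+ u i ℤ.* d) (residue i ℤ.* (d ℤ.* e)) (residue i)
      (mod-sym (residue i ℤ.* (d ℤ.* e)) (+ u i ℤ.* d)
        (subst (_≡ + u i ℤ.* d [mod m ])
          (sym (trans (lemma₁ (residue i) d e)
            (trans (cong (d ℤ.*_) (ℤ.a≡a%ℕn+[a/ℕn]*n (residue i ℤ.* e) m))
              (lemma₂ d (+ u i) ((residue i ℤ.* e) ℤ./ℕ m) (+ m)))))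
          (mod-+multiple (+ u i ℤ.* d) (d ℤ.* ((residue i ℤ.* e) ℤ./ℕ m)))))
      (subst (residue i ℤ.* (d ℤ.* e) ≡_[mod m ]) (ℤ.*-identityʳ (residue i)) (mod-*ˡ (residue i) (d ℤ.* e) 1ℤ de≡1))
      where
      lemma₁ : ∀ r d e → r ℤ.* (d ℤ.* e) ≡ d ℤ.* (r ℤ.* e)
      lemma₁ = solve-∀
      lemma₂ : ∀ d u q m → d ℤ.* (u ℤ.+ q ℤ.* m) ≡ u ℤ.* d ℤ.+ d ℤ.* q ℤ.* m
      lemma₂ = solve-∀

  module _ .{{_ : NonZero m}} {u : Fin (pred m) → ℕ} (isIndex : IsIndex m d u) where
    open IsIndex isIndex

    index-unique : ∀ i {j} → j ℕ.< m → + j ℤ.* d ≡ residue i [mod m ] → u i ≡ j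
    index-unique i {j} j<m jd≡i = mod-small (bounded i) j<m
      (mod-cancel (+ u i) (+ j) (mod-trans (+ u i ℤ.* d) (residue i) (+ j ℤ.* d) (hits i) (mod-sym (+ j ℤ.* d) (residue i) jd≡i)))

    index-surjective : ∀ {j} → 0 ℕ.< j → j ℕ.< m → ∃ λ i → u i ≡ j
    index-surjective {j} 0<j j<m with classify m (+ j ℤ.* d)
    ... | inj₁ jd≡0       = contradiction jd≡0 (multiple≢0 0<j j<m)
    ... | inj₂ (i , jd≡i) = i , index-unique i j<m jd≡i

    -- Two representatives below m add up to less than 2m, so a sum wraps around at most once. All
    -- slacks are computed along this dichotomy.
    index-+ : ∀ i j l → residue i ℤ.+ residue j ≡ residue l [mod m ] →
              u i ℕ.+ u j ≡ u l ⊎ u i ℕ.+ u j ≡ u l ℕ.+ m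
    index-+ i j l i+j≡l with u i ℕ.+ u j ℕ.<? m
    ... | yes <m = inj₁ (sym (index-unique l <m sum≡))
      where
      sum≡ : + (u i ℕ.+ u j) ℤ.* d ≡ residue l [mod m ]
      sum≡ = mod-trans (+ (u i ℕ.+ u j) ℤ.* d) (residue i ℤ.+ residue j) (residue l)
        (subst (_≡ residue i ℤ.+ residue j [mod m ]) (sym (ℤ.*-distribʳ-+ d (+ u i) (+ u j)))
          (mod-+ (+ u i ℤ.* d) (residue i) (+ u j ℤ.* d) (residue j) (hits i) (hits j))) i+j≡l
    ... | no ≮m = inj₂ (trans (sym (ℕ.m∸n+n≡m m≤)) (cong (ℕ._+ m) (sym (index-unique l <m diff≡))))
      where
      m≤ : m ℕ.≤ u i ℕ.+ u j
      m≤ = ℕ.≮⇒≥ ≮m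
      <m : u i ℕ.+ u j ℕ.∸ m ℕ.< m
      <m = ℕ.+-cancelʳ-< m _ _ (subst (ℕ._< m ℕ.+ m) (sym (ℕ.m∸n+n≡m m≤)) (ℕ.+-mono-< (bounded i) (bounded j)))
      diff : ℤ
      diff = + (u i ℕ.+ u j ℕ.∸ m)
      diff≡ : diff ℤ.* d ≡ residue l [mod m ]
      diff≡ = mod-trans (diff ℤ.* d) (diff ℤ.* d ℤ.+ d ℤ.* + m) (residue l)
        (mod-sym (diff ℤ.* d ℤ.+ d ℤ.* + m) (diff ℤ.* d) (mod-+multiple (diff ℤ.* d) d))
        (subst (_≡ residue l [mod m ]) (trans (cong (λ n → + n ℤ.* d) (sym (ℕ.m∸n+n≡m m≤))) (lemma diff (+ m) d))
          (mod-trans (+ (u i ℕ.+ u j) ℤ.* d) (residue i ℤ.+ residue j) (residue l)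
            (subst (_≡ residue i ℤ.+ residue j [mod m ]) (sym (ℤ.*-distribʳ-+ d (+ u i) (+ u j)))
              (mod-+ (+ u i ℤ.* d) (residue i) (+ u j ℤ.* d) (residue j) (hits i) (hits j))) i+j≡l))
        where
        lemma : ∀ x m d → (x ℤ.+ m) ℤ.* d ≡ x ℤ.* d ℤ.+ d ℤ.* m
        lemma = solve-∀

coprime⇒invertible : ∀ {m d} → gcd (+ m) d ≡ 1ℤ → ∃ λ e → d ℤ.* e ≡ 1ℤ [mod m ]
coprime⇒invertible {m} {d} gcd≡1 = invert d (subst (λ g → ℕ.Bézout.Identity g m ℤ.∣ d ∣) (ℤ.+-injective gcd≡1)
    (ℕ.Bézout.identity (ℕ.gcd-GCD m ℤ.∣ d ∣)))
  where
  solve₁ : ∀ x y n → 1 ℕ.+ y ℕ.* n ≡ x ℕ.* m → + n ℤ.* ℤ.- (+ y) ≡ 1ℤ [mod m ]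
  solve₁ x y n eq = divides (ℤ.- (+ x)) (trans (lemma (+ n) (+ y)) (trans (cong ℤ.-_ lifted) (ℤ.neg-distribˡ-* (+ x) (+ m))))
    where
    lemma : ∀ n y → n ℤ.* ℤ.- y ℤ.- 1ℤ ≡ ℤ.- (1ℤ ℤ.+ y ℤ.* n)
    lemma = solve-∀
    lifted : 1ℤ ℤ.+ + y ℤ.* + n ≡ + x ℤ.* + m
    lifted = trans (cong (ℤ._+_ 1ℤ) (sym (ℤ.pos-* y n))) (trans (cong +_ eq) (ℤ.pos-* x m))
  solve₂ : ∀ x y n → 1 ℕ.+ x ℕ.* m ≡ y ℕ.* n → + n ℤ.* + y ≡ 1ℤ [mod m ]
  solve₂ x y n eq = divides (+ x) (trans (cong (ℤ._- 1ℤ) (trans (ℤ.*-comm (+ n) (+ y)) (sym lifted))) (lemma (+ x ℤ.* + m)))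
    where
    lemma : ∀ z → 1ℤ ℤ.+ z ℤ.- 1ℤ ≡ z
    lemma = solve-∀
    lifted : 1ℤ ℤ.+ + x ℤ.* + m ≡ + y ℤ.* + n
    lifted = trans (cong (ℤ._+_ 1ℤ) (sym (ℤ.pos-* x m))) (trans (cong +_ eq) (ℤ.pos-* y n))
  natural : ∀ n → ℕ.Bézout.Identity 1 m n → ∃ λ e → + n ℤ.* e ≡ 1ℤ [mod m ]
  natural n (ℕ.Bézout.+- x y eq) = ℤ.- (+ y) , solve₁ x y n eq
  natural n (ℕ.Bézout.-+ x y eq) = + y , solve₂ x y n eq
  invert : ∀ d → ℕ.Bézout.Identity 1 m ℤ.∣ d ∣ → ∃ λ e → d ℤ.* e ≡ 1ℤ [mod m ]
  invert (+ n) b = natural n b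
  invert -[1+ n ] b with e , p ← natural (suc n) b = ℤ.- e , subst (_≡ 1ℤ [mod m ]) (lemma (+ suc n) e) p
    where
    lemma : ∀ n e → n ℤ.* e ≡ ℤ.- n ℤ.* ℤ.- e
    lemma = solve-∀

i≤+∣i∣ : ∀ i → i ℤ.≤ + ℤ.∣ i ∣
i≤+∣i∣ (+ n)    = ℤ.≤-refl
i≤+∣i∣ -[1+ n ] = ℤ.-≤+

vector-bound : ∀ {n} (v : Vector ℤ n) → ∃ λ B → ∀ i → v i ℤ.≤ + B
vector-bound {zero}  v = 0 , λ ()
vector-bound {suc n} v with B , v≤B ← vector-bound (tail v) = ℤ.∣ v zero ∣ ℕ.⊔ B , λ where
  zero    → ℤ.≤-trans (i≤+∣i∣ (v zero)) (ℤ.+≤+ (ℕ.m≤m⊔n ℤ.∣ v zero ∣ B))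
  (suc i) → ℤ.≤-trans (v≤B i) (ℤ.+≤+ (ℕ.m≤n⊔m ℤ.∣ v zero ∣ B))

module _ (a h k : ℕ) (d : ℤ) where

  private
    g : Vector ℤ (suc k)
    g = egaGenerators a h k d

  -- A sum of n generators other than a contributes n ah + i d with n ≤ i ≤ nk.
  EgaForm : Pred ℤ 0ℓ
  EgaForm x = ∃ λ p → ∃₂ λ n i → n ℕ.≤ i × i ℕ.≤ n ℕ.* k ×
    x ≡ + p ℤ.* + a ℤ.+ (+ n ℤ.* + (a ℕ.* h) ℤ.+ + i ℤ.* d)

  ega⊆form : ⟨ g ⟩ ⊆ EgaForm
  ega⊆form = span⊆ 0∈form +∈form g g∈form
    where
    0∈form : 0ℤ ∈ EgaForm
    0∈form = 0 , 0 , 0 , z≤n , z≤n , refl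
    +∈form : ∀ {x y} → x ∈ EgaForm → y ∈ EgaForm → x ℤ.+ y ∈ EgaForm
    +∈form (p , n , i , n≤i , i≤nk , refl) (p′ , n′ , i′ , n≤i′ , i≤nk′ , refl) =
      p ℕ.+ p′ , n ℕ.+ n′ , i ℕ.+ i′ , ℕ.+-mono-≤ n≤i n≤i′ ,
      subst (i ℕ.+ i′ ℕ.≤_) (sym (ℕ.*-distribʳ-+ k n n′)) (ℕ.+-mono-≤ i≤nk i≤nk′) ,
      identity (+ p) (+ p′) (+ n) (+ n′) (+ i) (+ i′) (+ a) (+ (a ℕ.* h)) d
      where
      identity : ∀ p p′ n n′ i i′ a b d →
        p ℤ.* a ℤ.+ (n ℤ.* b ℤ.+ i ℤ.* d) ℤ.+ (p′ ℤ.* a ℤ.+ (n′ ℤ.* b ℤ.+ i′ ℤ.* d)) ≡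
        (p ℤ.+ p′) ℤ.* a ℤ.+ ((n ℤ.+ n′) ℤ.* b ℤ.+ (i ℤ.+ i′) ℤ.* d)
      identity = solve-∀
    g∈form : ∀ i → g i ∈ EgaForm
    g∈form zero = 1 , 0 , 0 , z≤n , z≤n , identity (+ a) (+ (a ℕ.* h)) d
      where
      identity : ∀ a b d → a ≡ 1ℤ ℤ.* a ℤ.+ (0ℤ ℤ.* b ℤ.+ 0ℤ ℤ.* d)
      identity = solve-∀
    g∈form (suc j) = 0 , 1 , suc (toℕ j) , s≤s z≤n , subst (suc (toℕ j) ℕ.≤_) (sym (ℕ.*-identityˡ k)) (toℕ<n j) ,
      identity (+ a) (+ (a ℕ.* h)) (+ suc (toℕ j)) d
      where
      identity : ∀ a b j d → b ℤ.+ j ℤ.* d ≡ 0ℤ ℤ.* a ℤ.+ (1ℤ ℤ.* b ℤ.+ j ℤ.* d)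
      identity = solve-∀

  step∈ega : ∀ {s} → 1 ℕ.≤ s → s ℕ.≤ k → + (a ℕ.* h) ℤ.+ + s ℤ.* d ∈ ⟨ g ⟩
  step∈ega {suc s} _ s<k = subst (λ s → + (a ℕ.* h) ℤ.+ + suc s ℤ.* d ∈ ⟨ g ⟩)
    (toℕ-fromℕ< s<k) (generator∈span g (suc (fromℕ< s<k)))

  -- Greedy splitting of i among n + 1 generators. If i ≤ nk + 1, take off ah + d; then i - 1 still
  -- lies between n and nk. Otherwise n copies of ah + kd leave a remainder i - nk between 1 and k,
  -- which is a single generator.
  ega∋ : 1 ℕ.≤ k → ∀ n {i} → n ℕ.≤ i → i ℕ.≤ n ℕ.* k → + n ℤ.* + (a ℕ.* h) ℤ.+ + i ℤ.* d ∈ ⟨ g ⟩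
  ega∋ 1≤k zero    {zero} _   _    = 0∈span g
  ega∋ 1≤k (suc n) {i}    n<i i≤nk with i ℕ.≤? suc (n ℕ.* k)
  ... | yes i≤ with suc i′ ← i = subst ⟨ g ⟩ (identity (+ n) (+ (a ℕ.* h)) (+ i′) d)
    (+∈span g (step∈ega ℕ.≤-refl 1≤k) (ega∋ 1≤k n (ℕ.s≤s⁻¹ n<i) (ℕ.s≤s⁻¹ i≤)))
    where
    identity : ∀ n b i d → b ℤ.+ 1ℤ ℤ.* d ℤ.+ (n ℤ.* b ℤ.+ i ℤ.* d) ≡ (1ℤ ℤ.+ n) ℤ.* b ℤ.+ (1ℤ ℤ.+ i) ℤ.* d
    identity = solve-∀
  ... | no i≰ = subst ⟨ g ⟩
    (trans (identity (+ n) (+ (a ℕ.* h)) (+ s) (+ (n ℕ.* k)) d)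
      (cong (λ i → + suc n ℤ.* + (a ℕ.* h) ℤ.+ + i ℤ.* d) (ℕ.m∸n+n≡m nk≤i)))
    (+∈span g (step∈ega (ℕ.m<n⇒0<n∸m nk<i) s≤k) (ega∋ 1≤k n (ℕ.m≤m*n n k {{ℕ.>-nonZero 1≤k}}) ℕ.≤-refl))
    where
    s : ℕ
    s = i ℕ.∸ n ℕ.* k
    nk<i : n ℕ.* k ℕ.< i
    nk<i = ℕ.<-trans (ℕ.n<1+n _) (ℕ.≰⇒> i≰)
    nk≤i : n ℕ.* k ℕ.≤ i
    nk≤i = ℕ.<⇒≤ nk<i
    s≤k : s ℕ.≤ k
    s≤k = ℕ.m≤n+o⇒m∸n≤o i (n ℕ.* k) (subst (i ℕ.≤_) (ℕ.+-comm k (n ℕ.* k)) i≤nk)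
    identity : ∀ n b s t d → b ℤ.+ s ℤ.* d ℤ.+ (n ℤ.* b ℤ.+ t ℤ.* d) ≡ (1ℤ ℤ.+ n) ℤ.* b ℤ.+ (s ℤ.+ t) ℤ.* d
    identity = solve-∀

  module _ .{{_ : NonZero a}} .{{_ : NonZero k}} where

    egaApéry : (Fin (pred a) → ℕ) → Vector ℤ (pred a)
    egaApéry u i = + (a ℕ.* h) ℤ.* + ⌈ u i / k ⌉ ℤ.+ + u i ℤ.* d

    module _ {e : ℤ} (de≡1 : d ℤ.* e ≡ 1ℤ [mod a ]) (nonneg : ∀ j → 0ℤ ℤ.≤ g j)
             {N : ℕ} (N≡ : + (h ℕ.* (a ℕ./ k)) ℤ.+ d ≡ + N)
             {u : Fin (pred a) → ℕ} (isIndex : IsIndex a d u) where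
      open IsIndex isIndex

      private
        1≤k : 1 ℕ.≤ k
        1≤k = ℕ.>-nonZero⁻¹ k

        w : Vector ℤ (pred a)
        w = egaApéry u

        w∈ : ∀ i → w i ∈ ⟨ g ⟩
        w∈ i = subst (λ x → x ℤ.+ + u i ℤ.* d ∈ ⟨ g ⟩) (ℤ.*-comm (+ ⌈ u i / k ⌉) (+ (a ℕ.* h)))
          (ega∋ 1≤k ⌈ u i / k ⌉ (⌈n/k⌉≤n (u i)) (n≤⌈n/k⌉*k (u i)))

        multiple-mod : ∀ n → + n ℤ.* + (a ℕ.* h) ≡ + n ℤ.* + h ℤ.* + a
        multiple-mod n = trans (cong (λ z → + n ℤ.* z) (ℤ.pos-* a h)) (lemma (+ n) (+ a) (+ h))
          where
          lemma : ∀ n a h → n ℤ.* (a ℤ.* h) ≡ n ℤ.* h ℤ.* a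
          lemma = solve-∀

        form-mod : ∀ p n i → + p ℤ.* + a ℤ.+ (+ n ℤ.* + (a ℕ.* h) ℤ.+ + i ℤ.* d) ≡ + i ℤ.* d [mod a ]
        form-mod p n i = subst (_≡ + i ℤ.* d [mod a ])
          (sym (trans (cong (λ z → + p ℤ.* + a ℤ.+ (z ℤ.+ + i ℤ.* d)) (multiple-mod n))
            (lemma (+ p) (+ a) (+ n ℤ.* + h) (+ i ℤ.* d))))
          (mod-+multiple (+ i ℤ.* d) (+ p ℤ.+ + n ℤ.* + h))
          where
          lemma : ∀ p a n x → p ℤ.* a ℤ.+ (n ℤ.* a ℤ.+ x) ≡ x ℤ.+ (p ℤ.+ n) ℤ.* a
          lemma = solve-∀

        w-mod : ∀ i → w i ≡ + u i ℤ.* d [mod a ]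
        w-mod i = subst (_≡ + u i ℤ.* d [mod a ]) (lemma (+ a) (+ ⌈ u i / k ⌉) (+ (a ℕ.* h)) (+ u i ℤ.* d))
          (form-mod 0 ⌈ u i / k ⌉ (u i))
          where
          lemma : ∀ a c b x → 0ℤ ℤ.* a ℤ.+ (c ℤ.* b ℤ.+ x) ≡ b ℤ.* c ℤ.+ x
          lemma = solve-∀

        class : ∀ i → w i ≡ residue i [mod a ]
        class i = mod-trans (w i) (+ u i ℤ.* d) (residue i) (w-mod i) (hits i)

        -- Both sides are congruent to a multiple of d, and d can be cancelled modulo a; hence j and
        -- `u i` agree modulo a, and `u i` is the remainder.
        form-index : ∀ i {p n j} → w i ℤ.- + a ≡ + p ℤ.* + a ℤ.+ (+ n ℤ.* + (a ℕ.* h) ℤ.+ + j ℤ.* d) →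
                     j ≡ u i ℕ.+ (j ℕ./ a) ℕ.* a
        form-index i {p} {n} {j} eq = trans (ℕ.m≡m%n+[m/n]*n j a)
          (cong (ℕ._+ (j ℕ./ a) ℕ.* a) (mod-small (ℕ.m%n<n j a) (bounded i) (mod-cancel de≡1 (+ (j ℕ.% a)) (+ u i)
            (mod-trans (+ (j ℕ.% a) ℤ.* d) (+ j ℤ.* d) (+ u i ℤ.* d) j%a≡j j≡u))))
          where
          lemma₁ : ∀ r q a d → r ℤ.* d ℤ.+ q ℤ.* d ℤ.* a ≡ (r ℤ.+ q ℤ.* a) ℤ.* d
          lemma₁ = solve-∀
          lemma₂ : ∀ w a → w ℤ.+ ℤ.- 1ℤ ℤ.* a ≡ w ℤ.- a
          lemma₂ = solve-∀
          j%a≡j : + (j ℕ.% a) ℤ.* d ≡ + j ℤ.* d [mod a ]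
          j%a≡j = mod-sym (+ j ℤ.* d) (+ (j ℕ.% a) ℤ.* d) (subst (_≡ + (j ℕ.% a) ℤ.* d [mod a ])
            (trans (lemma₁ (+ (j ℕ.% a)) (+ (j ℕ./ a)) (+ a) d) (cong (ℤ._* d)
              (trans (cong (λ z → + (j ℕ.% a) ℤ.+ z) (sym (ℤ.pos-* (j ℕ./ a) a))) (cong +_ (sym (ℕ.m≡m%n+[m/n]*n j a))))))
            (mod-+multiple (+ (j ℕ.% a) ℤ.* d) (+ (j ℕ./ a) ℤ.* d)))
          j≡w-a : + j ℤ.* d ≡ w i ℤ.- + a [mod a ]
          j≡w-a = mod-sym (w i ℤ.- + a) (+ j ℤ.* d) (subst (_≡ + j ℤ.* d [mod a ]) (sym eq) (form-mod p n j))
          j≡u : + j ℤ.* d ≡ + u i ℤ.* d [mod a ]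
          j≡u = mod-trans (+ j ℤ.* d) (w i ℤ.- + a) (+ u i ℤ.* d) j≡w-a
            (mod-trans (w i ℤ.- + a) (w i) (+ u i ℤ.* d)
              (subst (_≡ w i [mod a ]) (lemma₂ (w i) (+ a)) (mod-+multiple (w i) (ℤ.- 1ℤ))) (w-mod i))

        -- Suppose `w i` - a = pa + n·ah + jd with j ≤ nk. Then j = `u i` + ta, and the cost of t
        -- wrap-arounds gives n = s + c + tq with s ≥ 0. Comparing with `w i` = ahc + `u i` d yields
        -- (1 + p + hs + tN)a = 0, which is impossible for natural numbers.
        w-a∉ : ∀ i → w i ℤ.- + a ∉ ⟨ g ⟩
        w-a∉ i w-a∈ with p , n , j , _ , j≤nk , eq ← ega⊆form w-a∈ =
          contradiction (ℕ.m*n≡0⇒m≡0 (suc (p ℕ.+ h ℕ.* s ℕ.+ t ℕ.* N)) a (ℤ.+-injective zero-sum)) ℕ.1+n≢0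
          where
          q = a ℕ./ k
          c = ⌈ u i / k ⌉
          t = j ℕ./ a
          j≡ : j ≡ u i ℕ.+ t ℕ.* a
          j≡ = form-index i {p} {n} eq
          c+tq≤n : c ℕ.+ t ℕ.* q ℕ.≤ n
          c+tq≤n = ℕ.≤-trans
            (⌈n/k⌉+x≤⌈[n+y]/k⌉ (u i) (subst (ℕ._≤ t ℕ.* a) (sym (ℕ.*-assoc t q k)) (ℕ.*-monoʳ-≤ t (ℕ.m/n*n≤m a k))))
            (n≤m*k⇒⌈n/k⌉≤m (subst (ℕ._≤ n ℕ.* k) j≡ j≤nk))
          s = n ℕ.∸ (c ℕ.+ t ℕ.* q)
          n≡ : n ≡ s ℕ.+ (c ℕ.+ t ℕ.* q)
          n≡ = sym (ℕ.m∸n+n≡m c+tq≤n)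
          identity : ∀ a h d p s c t q u →
            (1ℤ ℤ.+ (p ℤ.+ h ℤ.* s ℤ.+ t ℤ.* (h ℤ.* q ℤ.+ d))) ℤ.* a ≡
            a ℤ.+ (p ℤ.* a ℤ.+ ((s ℤ.+ (c ℤ.+ t ℤ.* q)) ℤ.* (a ℤ.* h) ℤ.+ (u ℤ.+ t ℤ.* a) ℤ.* d)) ℤ.- (a ℤ.* h ℤ.* c ℤ.+ u ℤ.* d)
          identity = solve-∀
          cancel : ∀ a w → a ℤ.+ (w ℤ.- a) ℤ.- w ≡ 0ℤ
          cancel = solve-∀
          open ≡-Reasoning
          zero-sum : + (suc (p ℕ.+ h ℕ.* s ℕ.+ t ℕ.* N) ℕ.* a) ≡ 0ℤ
          zero-sum = begin
            + (suc (p ℕ.+ h ℕ.* s ℕ.+ t ℕ.* N) ℕ.* a)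
              ≡⟨ ℤ.pos-* (suc (p ℕ.+ h ℕ.* s ℕ.+ t ℕ.* N)) a ⟩
            (1ℤ ℤ.+ (+ p ℤ.+ + (h ℕ.* s) ℤ.+ + (t ℕ.* N))) ℤ.* + a
              ≡⟨ cong₂ (λ x y → (1ℤ ℤ.+ (+ p ℤ.+ x ℤ.+ y)) ℤ.* + a) (ℤ.pos-* h s)
                   (trans (ℤ.pos-* t N) (cong (λ z → + t ℤ.* z) (trans (sym N≡) (cong (ℤ._+ d) (ℤ.pos-* h q))))) ⟩
            (1ℤ ℤ.+ (+ p ℤ.+ + h ℤ.* + s ℤ.+ + t ℤ.* (+ h ℤ.* + q ℤ.+ d))) ℤ.* + a
              ≡⟨ identity (+ a) (+ h) d (+ p) (+ s) (+ c) (+ t) (+ q) (+ u i) ⟩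
            + a ℤ.+ (+ p ℤ.* + a ℤ.+ ((+ s ℤ.+ (+ c ℤ.+ + t ℤ.* + q)) ℤ.* (+ a ℤ.* + h) ℤ.+ (+ u i ℤ.+ + t ℤ.* + a) ℤ.* d))
              ℤ.- (+ a ℤ.* + h ℤ.* + c ℤ.+ + u i ℤ.* d)
              ≡⟨ cong₂ (λ x y → + a ℤ.+ (+ p ℤ.* + a ℤ.+ ((+ s ℤ.+ (+ c ℤ.+ x)) ℤ.* (+ a ℤ.* + h) ℤ.+ (+ u i ℤ.+ y) ℤ.* d))
                   ℤ.- (+ a ℤ.* + h ℤ.* + c ℤ.+ + u i ℤ.* d)) (ℤ.pos-* t q) (ℤ.pos-* t a) ⟨
            + a ℤ.+ (+ p ℤ.* + a ℤ.+ (+ (s ℕ.+ (c ℕ.+ t ℕ.* q)) ℤ.* (+ a ℤ.* + h) ℤ.+ + (u i ℕ.+ t ℕ.* a) ℤ.* d))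
              ℤ.- (+ a ℤ.* + h ℤ.* + c ℤ.+ + u i ℤ.* d)
              ≡⟨ cong₂ (λ x y → + a ℤ.+ (+ p ℤ.* + a ℤ.+ (+ x ℤ.* (+ a ℤ.* + h) ℤ.+ + y ℤ.* d))
                   ℤ.- (+ a ℤ.* + h ℤ.* + c ℤ.+ + u i ℤ.* d)) n≡ j≡ ⟨
            + a ℤ.+ (+ p ℤ.* + a ℤ.+ (+ n ℤ.* (+ a ℤ.* + h) ℤ.+ + j ℤ.* d)) ℤ.- (+ a ℤ.* + h ℤ.* + c ℤ.+ + u i ℤ.* d)
              ≡⟨ cong (λ b → + a ℤ.+ (+ p ℤ.* + a ℤ.+ (+ n ℤ.* b ℤ.+ + j ℤ.* d)) ℤ.- (b ℤ.* + c ℤ.+ + u i ℤ.* d)) (ℤ.pos-* a h) ⟨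
            + a ℤ.+ (+ p ℤ.* + a ℤ.+ (+ n ℤ.* + (a ℕ.* h) ℤ.+ + j ℤ.* d)) ℤ.- w i
              ≡⟨ cong (λ x → + a ℤ.+ x ℤ.- w i) eq ⟨
            + a ℤ.+ (w i ℤ.- + a) ℤ.- w i
              ≡⟨ cancel (+ a) (w i) ⟩
            0ℤ ∎

        -- Above all the `w i`, every number is reached from the element of its class by adding
        -- copies of a.
        large∈ : ∀ {B} → (∀ i → w i ℤ.≤ + B) → ∀ n → B ℕ.≤ n → + n ∈ ⟨ g ⟩
        large∈ {B} w≤B n B≤n = member (classify a (+ n))
          where
          zeroClass : (∃ λ p → + n ≡ 0ℤ ℤ.+ + p ℤ.* + a) → + n ∈ ⟨ g ⟩
          zeroClass (p , eq) = subst ⟨ g ⟩ (sym eq)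
            (+multiple∈ {⟨ g ⟩} (0∈span g) (+∈span g) (0∈span g) (generator∈span g zero) p)
          otherClass : ∀ i → (∃ λ p → + n ≡ w i ℤ.+ + p ℤ.* + a) → + n ∈ ⟨ g ⟩
          otherClass i (p , eq) = subst ⟨ g ⟩ (sym eq)
            (+multiple∈ {⟨ g ⟩} (0∈span g) (+∈span g) (w∈ i) (generator∈span g zero) p)
          member : + n ≡ 0ℤ [mod a ] ⊎ (∃ λ i → + n ≡ residue i [mod a ]) → + n ∈ ⟨ g ⟩
          member (inj₁ n≡0)       = zeroClass (mod⇒≡+ {x = + n} {0ℤ} n≡0 (ℤ.+≤+ z≤n))
          member (inj₂ (i , n≡i)) = otherClass i (mod⇒≡+ {x = + n} {w i}
            (mod-trans (+ n) (residue i) (w i) n≡i (mod-sym (w i) (residue i) (class i)))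
            (ℤ.≤-trans (w≤B i) (ℤ.+≤+ B≤n)))

        finiteComplement : ∃ λ gaps → ∀ n → 0ℤ ℤ.≤ n → n ∈ ⟨ g ⟩ ⊎ n List.∈ gaps
        finiteComplement with B , w≤B ← vector-bound w = map +_ (upTo B) , λ where
          (+ n) _ → case n ℕ.<? B of λ where
            (yes n<B) → inj₂ (∈-map⁺ +_ (∈-upTo⁺ n<B))
            (no n≮B)  → inj₁ (large∈ w≤B n (ℕ.≮⇒≥ n≮B))

      -- One statement for S, for the two displaced semigroups and, at h = 0 and k = 1, for ⟨a, b⟩.
      ega-isApéryTuple : IsApéryTuple ⟨ g ⟩ a (egaApéry u)
      ega-isApéryTuple = record
        { isNumericalSemigroup = record
          { nonNegative      = span⊆ {0ℤ ℤ.≤_} ℤ.≤-refl ℤ.+-mono-≤ g nonneg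
          ; zero-closed      = 0∈span g
          ; +-closed         = +∈span g
          ; finiteComplement = finiteComplement
          }
        ; modulus∈S  = generator∈span g zero
        ; inApérySet = λ i → w∈ i , w-a∉ i
        ; inClass    = class
        }

-- Positivity of hq + d

other∈span : ∀ {n} (g : Vector ℤ (suc n)) {i j} → i ≢ j → g j ∈ ⟨ removeAt g i ⟩
other∈span g {i} i≢j = subst ⟨ removeAt g i ⟩ (cong g (punchIn-punchOut i≢j))
  (generator∈span (removeAt g i) (punchOut i≢j))

egaMinimal⇒0<hq+d : ∀ {a h k d} .{{_ : NonZero k}} → 1 ℕ.< k →
  IsExtraGeneralizedArithmetical a h k d → 0ℤ ℤ.< + (h ℕ.* (a ℕ./ k)) ℤ.+ d
egaMinimal⇒0<hq+d {a} {h} {k} {d} 1<k ega with a ℕ.% k in r≡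
-- If k divides a, then k(hq + d) is the generator ah + kd, which exceeds a.
... | zero = ℤ.*-cancelˡ-<-nonNeg (+ k) (ℤ.≤-<-trans (ℤ.≤-reflexive (ℤ.*-zeroʳ (+ k)))
  (ℤ.≤-<-trans (ℤ.+≤+ z≤n) (subst (+ a ℤ.<_) identity a<ah+kd)))
  where
  open IsExtraGeneralizedArithmetical ega
  identity : + (a ℕ.* h) ℤ.+ + k ℤ.* d ≡ + k ℤ.* (+ (h ℕ.* (a ℕ./ k)) ℤ.+ d)
  identity = begin
    + (a ℕ.* h) ℤ.+ + k ℤ.* d
      ≡⟨ cong (λ x → + (x ℕ.* h) ℤ.+ + k ℤ.* d) (trans (ℕ.m≡m%n+[m/n]*n a k) (cong (ℕ._+ (a ℕ./ k) ℕ.* k) r≡)) ⟩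
    + ((a ℕ./ k) ℕ.* k ℕ.* h) ℤ.+ + k ℤ.* d
      ≡⟨ cong (λ x → + x ℤ.+ + k ℤ.* d) (natural (a ℕ./ k) k h) ⟩
    + (k ℕ.* (h ℕ.* (a ℕ./ k))) ℤ.+ + k ℤ.* d
      ≡⟨ cong (ℤ._+ + k ℤ.* d) (ℤ.pos-* k (h ℕ.* (a ℕ./ k))) ⟩
    + k ℤ.* + (h ℕ.* (a ℕ./ k)) ℤ.+ + k ℤ.* d
      ≡⟨ ℤ.*-distribˡ-+ (+ k) (+ (h ℕ.* (a ℕ./ k))) d ⟨
    + k ℤ.* (+ (h ℕ.* (a ℕ./ k)) ℤ.+ d) ∎
    where
    open ≡-Reasoning
    natural : ∀ q k h → q ℕ.* k ℕ.* h ≡ k ℕ.* (h ℕ.* q)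
    natural = ℕ-solve-∀
-- If hq + d ≤ 0 and a = qk + r with r > 0, then q copies of ah + kd, one of ah + (r + 1)d and
-- -(hq + d) copies of a add up to the generator ah + d.
... | suc r with 0ℤ ℤ.<? + (h ℕ.* (a ℕ./ k)) ℤ.+ d
...   | yes 0<N = 0<N
...   | no 0≮N = contradiction redundant (isMinimal first)
  where
  open IsExtraGeneralizedArithmetical ega
  q = a ℕ./ k
  N = + (h ℕ.* q) ℤ.+ d
  P = ℤ.∣ N ∣
  0<k : 0 ℕ.< k
  0<k = ℕ.<-trans (s≤s z≤n) 1<k
  first : Fin (suc k)
  first = suc (fromℕ< 0<k)
  g = removeAt (egaGenerators a h k d) first
  r<k : suc r ℕ.< k
  r<k = subst (ℕ._< k) r≡ (ℕ.m%n<n a k)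
  -P≡N : ℤ.- + P ≡ N
  -P≡N = nonPositive (ℤ.≮⇒≥ 0≮N)
    where
    nonPositive : ∀ {i} → i ℤ.≤ 0ℤ → ℤ.- + ℤ.∣ i ∣ ≡ i
    nonPositive {+ zero}   _ = refl
    nonPositive { -[1+ n ]} _ = refl
    nonPositive {+ suc n} (ℤ.+≤+ ())
  a∈g : + a ∈ ⟨ g ⟩
  a∈g = other∈span (egaGenerators a h k d) {first} {zero} λ ()
  step∈g : ∀ {s} → 0 ℕ.< s → s ℕ.< k → + (a ℕ.* h) ℤ.+ + suc s ℤ.* d ∈ ⟨ g ⟩
  step∈g {s} 0<s s<k = subst (λ s → + (a ℕ.* h) ℤ.+ + suc s ℤ.* d ∈ ⟨ g ⟩) (toℕ-fromℕ< s<k)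
    (other∈span (egaGenerators a h k d) {first} {suc (fromℕ< s<k)} λ eq → ℕ.<⇒≢ 0<s (begin
      0                  ≡⟨ toℕ-fromℕ< 0<k ⟨
      toℕ (fromℕ< 0<k)   ≡⟨ cong (pred ∘ toℕ) eq ⟩
      toℕ (fromℕ< s<k)   ≡⟨ toℕ-fromℕ< s<k ⟩
      s                  ∎))
    where open ≡-Reasoning
  last∈g : + (a ℕ.* h) ℤ.+ + k ℤ.* d ∈ ⟨ g ⟩
  last∈g = subst (λ k → + (a ℕ.* h) ℤ.+ + k ℤ.* d ∈ ⟨ g ⟩) (ℕ.suc-pred k)
    (step∈g (ℕ.<⇒≤pred 1<k) (ℕ.≤-reflexive (ℕ.suc-pred k)))
  -- The remainder is written `suc r` here, so the coefficient `suc (suc r)` lies between 2 and k: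
  -- it belongs to a listed generator other than the removed ah + d. The same holds for ah + kd
  -- because 1 < k.
  combination : + (a ℕ.* h) ℤ.+ + suc (suc r) ℤ.* d ℤ.+ + q ℤ.* (+ (a ℕ.* h) ℤ.+ + k ℤ.* d) ℤ.+ + P ℤ.* + a ∈ ⟨ g ⟩
  combination = +multiple∈ {⟨ g ⟩} (0∈span g) (+∈span g)
    (+multiple∈ {⟨ g ⟩} (0∈span g) (+∈span g) (step∈g (s≤s z≤n) r<k) last∈g q)
    a∈g P
  a≡ : + a ≡ + suc r ℤ.+ + q ℤ.* + k
  a≡ = trans (cong +_ (trans (ℕ.m≡m%n+[m/n]*n a k) (cong (ℕ._+ q ℕ.* k) r≡)))
    (cong (λ z → + suc r ℤ.+ z) (ℤ.pos-* q k))
  redundant : + (a ℕ.* h) ℤ.+ + suc (toℕ (fromℕ< 0<k)) ℤ.* d ∈ ⟨ g ⟩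
  redundant = subst ⟨ g ⟩ (begin
    + (a ℕ.* h) ℤ.+ + suc (suc r) ℤ.* d ℤ.+ + q ℤ.* (+ (a ℕ.* h) ℤ.+ + k ℤ.* d) ℤ.+ + P ℤ.* + a
      ≡⟨ identity₁ (+ (a ℕ.* h)) (+ suc r) d (+ q) (+ k) (+ P) (+ a) ⟩
    + (a ℕ.* h) ℤ.+ 1ℤ ℤ.* d ℤ.+ + q ℤ.* + (a ℕ.* h) ℤ.+ (+ suc r ℤ.+ + q ℤ.* + k) ℤ.* d ℤ.- ℤ.- + P ℤ.* + a
      ≡⟨ cong₂ (λ x y → + (a ℕ.* h) ℤ.+ 1ℤ ℤ.* d ℤ.+ + q ℤ.* + (a ℕ.* h) ℤ.+ x ℤ.* d ℤ.- y ℤ.* + a) (sym a≡) -P≡N ⟩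
    + (a ℕ.* h) ℤ.+ 1ℤ ℤ.* d ℤ.+ + q ℤ.* + (a ℕ.* h) ℤ.+ + a ℤ.* d ℤ.- (+ (h ℕ.* q) ℤ.+ d) ℤ.* + a
      ≡⟨ cong₂ (λ x y → + (a ℕ.* h) ℤ.+ 1ℤ ℤ.* d ℤ.+ + q ℤ.* x ℤ.+ + a ℤ.* d ℤ.- (y ℤ.+ d) ℤ.* + a) (ℤ.pos-* a h) (ℤ.pos-* h q) ⟩
    + (a ℕ.* h) ℤ.+ 1ℤ ℤ.* d ℤ.+ + q ℤ.* (+ a ℤ.* + h) ℤ.+ + a ℤ.* d ℤ.- (+ h ℤ.* + q ℤ.+ d) ℤ.* + a
      ≡⟨ identity₂ (+ (a ℕ.* h) ℤ.+ 1ℤ ℤ.* d) (+ q) (+ a) (+ h) d ⟩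
    + (a ℕ.* h) ℤ.+ 1ℤ ℤ.* d
      ≡⟨ cong (λ j → + (a ℕ.* h) ℤ.+ + suc j ℤ.* d) (toℕ-fromℕ< 0<k) ⟨
    + (a ℕ.* h) ℤ.+ + suc (toℕ (fromℕ< 0<k)) ℤ.* d ∎) combination
    where
    open ≡-Reasoning
    identity₁ : ∀ b r d q k P a → b ℤ.+ (1ℤ ℤ.+ r) ℤ.* d ℤ.+ q ℤ.* (b ℤ.+ k ℤ.* d) ℤ.+ P ℤ.* a ≡
      b ℤ.+ 1ℤ ℤ.* d ℤ.+ q ℤ.* b ℤ.+ (r ℤ.+ q ℤ.* k) ℤ.* d ℤ.- ℤ.- P ℤ.* a
    identity₁ = solve-∀
    identity₂ : ∀ g q a h d → g ℤ.+ q ℤ.* (a ℤ.* h) ℤ.+ a ℤ.* d ℤ.- (h ℤ.* q ℤ.+ d) ℤ.* a ≡ g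
    identity₂ = solve-∀

-- Integer points of the group cone and the slacks of its inequalities

ResidueSum : (m : ℕ) (i j l : Fin (pred m)) → Set
ResidueSum m i j l = residue i ℤ.+ residue j ≡ residue l [mod m ]

intSlack : ∀ {n} → Vector ℤ n → (i j l : Fin n) → ℤ
intSlack w i j l = w i ℤ.+ w j ℤ.- w l

IntCone : (m : ℕ) → Pred (Vector ℤ (pred m)) 0ℓ
IntCone m w = ∀ {i j l} → ResidueSum m i j l → 0ℤ ℤ.≤ intSlack w i j l

-- The two ray generators of the face of an extra-generalized arithmetical semigroup

module _ {a : ℕ} .{{_ : NonZero a}} {d e : ℤ} (de≡1 : d ℤ.* e ≡ 1ℤ [mod a ])
         {u : Fin (pred a) → ℕ} (isIndex : IsIndex a d u) where
  open IsIndex isIndex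

  index-injective : ∀ {i j} → u i ≡ u j → i ≡ j
  index-injective {i} {j} ui≡uj = toℕ-injective (ℕ.suc-injective (mod-small (residue<m i) (residue<m j)
    (mod-trans (residue i) (+ u i ℤ.* d) (residue j) (mod-sym (+ u i ℤ.* d) (residue i) (hits i))
      (subst (λ n → + n ℤ.* d ≡ residue j [mod a ]) (sym ui≡uj) (hits j)))))

  index-residueSum : ∀ {i j l} → + u i ℤ.+ + u j ≡ + u l [mod a ] → ResidueSum a i j l
  index-residueSum {i} {j} {l} ui+uj≡ul = mod-trans (residue i ℤ.+ residue j) (+ u i ℤ.* d ℤ.+ + u j ℤ.* d) (residue l)
    (mod-sym (+ u i ℤ.* d ℤ.+ + u j ℤ.* d) (residue i ℤ.+ residue j)
      (mod-+ (+ u i ℤ.* d) (residue i) (+ u j ℤ.* d) (residue j) (hits i) (hits j)))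
    (mod-trans (+ u i ℤ.* d ℤ.+ + u j ℤ.* d) (+ u l ℤ.* d) (residue l)
      (subst₂ (_≡_[mod a ]) (trans (ℤ.*-comm d _) (ℤ.*-distribʳ-+ d (+ u i) (+ u j))) (ℤ.*-comm d (+ u l))
        (mod-*ˡ d (+ u i ℤ.+ + u j) (+ u l) ui+uj≡ul))
      (hits l))

  -- Total in j, with the position of 1 as default outside 1, ..., a - 1. A point of the cone can
  -- thus be read as a sequence indexed by natural numbers, and the bounds are supplied only where
  -- values are compared.
  locate : 1 ℕ.< a → ∀ j → ∃ λ i → 0 ℕ.< j → j ℕ.< a → u i ≡ j
  locate 1<a j = case ((0 ℕ.<? j) ×-dec (j ℕ.<? a)) of λ where
    (yes (0<j , j<a)) → let i , ui≡j = index-surjective de≡1 isIndex 0<j j<a in i , λ _ _ → ui≡j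
    (no outside)      → proj₁ (index-surjective de≡1 isIndex (s≤s z≤n) 1<a) , λ 0<j j<a → contradiction (0<j , j<a) outside

rayʳ : ∀ {n} → (Fin n → ℕ) → Vector ℤ n
rayʳ u i = + u i

rayᵗ : (a k : ℕ) .{{_ : NonZero k}} → (Fin (pred a) → ℕ) → Vector ℤ (pred a)
rayᵗ a k u i = + a ℤ.* + ⌈ u i / k ⌉ ℤ.- + (a ℕ./ k) ℤ.* + u i

module _ {a k : ℕ} .{{_ : NonZero a}} .{{_ : NonZero k}} {d e : ℤ} (de≡1 : d ℤ.* e ≡ 1ℤ [mod a ])
         {u : Fin (pred a) → ℕ} (isIndex : IsIndex a d u) where

  private
    r t : Vector ℤ (pred a)
    r = rayʳ u
    t = rayᵗ a k u

    c : Fin (pred a) → ℕ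
    c i = ⌈ u i / k ⌉

    q : ℕ
    q = a ℕ./ k

  slackʳ : ∀ {i j l} n → u i ℕ.+ u j ≡ u l ℕ.+ n → intSlack r i j l ≡ + n
  slackʳ {i} {j} {l} n eq = trans (cong (λ x → + x ℤ.- + u l) eq) (lemma (+ u l) (+ n))
    where
    lemma : ∀ x n → x ℤ.+ n ℤ.- x ≡ n
    lemma = solve-∀

  -- Here n counts wrap-arounds and s is what the ceilings lose beyond nq. The coefficient q in t
  -- makes each wrap-around free: a(nq + s) - q·na = as.
  slackᵗ : ∀ {i j l} n s → u i ℕ.+ u j ≡ u l ℕ.+ n ℕ.* a → c i ℕ.+ c j ≡ c l ℕ.+ n ℕ.* q ℕ.+ s →
           intSlack t i j l ≡ + (a ℕ.* s)
  slackᵗ {i} {j} {l} n s u≡ c≡ = begin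
    intSlack t i j l
      ≡⟨ collect (+ a) (+ q) (+ c i) (+ c j) (+ c l) (+ u i) (+ u j) (+ u l) ⟩
    + a ℤ.* (+ (c i ℕ.+ c j) ℤ.- + c l) ℤ.- + q ℤ.* (+ (u i ℕ.+ u j) ℤ.- + u l)
      ≡⟨ cong₂ (λ x y → + a ℤ.* (+ x ℤ.- + c l) ℤ.- + q ℤ.* (+ y ℤ.- + u l)) c≡ u≡ ⟩
    + a ℤ.* (+ c l ℤ.+ + (n ℕ.* q) ℤ.+ + s ℤ.- + c l) ℤ.- + q ℤ.* (+ u l ℤ.+ + (n ℕ.* a) ℤ.- + u l)
      ≡⟨ cong₂ (λ x y → + a ℤ.* (+ c l ℤ.+ x ℤ.+ + s ℤ.- + c l) ℤ.- + q ℤ.* (+ u l ℤ.+ y ℤ.- + u l))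
           (ℤ.pos-* n q) (ℤ.pos-* n a) ⟩
    + a ℤ.* (+ c l ℤ.+ + n ℤ.* + q ℤ.+ + s ℤ.- + c l) ℤ.- + q ℤ.* (+ u l ℤ.+ + n ℤ.* + a ℤ.- + u l)
      ≡⟨ simplify (+ a) (+ q) (+ c l) (+ u l) (+ n) (+ s) ⟩
    + a ℤ.* + s
      ≡⟨ ℤ.pos-* a s ⟨
    + (a ℕ.* s) ∎
    where
    open ≡-Reasoning
    collect : ∀ a q c c′ c″ u u′ u″ →
      (a ℤ.* c ℤ.- q ℤ.* u) ℤ.+ (a ℤ.* c′ ℤ.- q ℤ.* u′) ℤ.- (a ℤ.* c″ ℤ.- q ℤ.* u″) ≡
      a ℤ.* (c ℤ.+ c′ ℤ.- c″) ℤ.- q ℤ.* (u ℤ.+ u′ ℤ.- u″)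
    collect = solve-∀
    simplify : ∀ a q c u n s →
      a ℤ.* (c ℤ.+ n ℤ.* q ℤ.+ s ℤ.- c) ℤ.- q ℤ.* (u ℤ.+ n ℤ.* a ℤ.- u) ≡ a ℤ.* s
    simplify = solve-∀

  -- Without wrap-around this is subadditivity of the ceiling. With one wrap-around, subadditivity
  -- is combined with the fact that adding a to an index raises the ceiling by at least q. Natural
  -- numbers are returned so that both cone membership and tightness can be read off.
  slacks : ∀ {i j l} → ResidueSum a i j l →
           ∃₂ λ x y → intSlack r i j l ≡ + x × intSlack t i j l ≡ + y
  slacks {i} {j} {l} i+j≡l = case index-+ de≡1 isIndex i j l i+j≡l of λ where
    (inj₁ eq) →
      let c≤ : c l ℕ.≤ c i ℕ.+ c j
          c≤ = subst (λ n → ⌈ n / k ⌉ ℕ.≤ c i ℕ.+ c j) eq (⌈[m+n]/k⌉≤⌈m/k⌉+⌈n/k⌉ (u i) (u j))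
          c≡ = trans (sym (ℕ.m+[n∸m]≡n c≤)) (cong (ℕ._+ (c i ℕ.+ c j ℕ.∸ c l)) (sym (ℕ.+-identityʳ (c l))))
      in _ , _ , slackʳ {i} {j} {l} 0 (trans eq (sym (ℕ.+-identityʳ (u l)))) ,
         slackᵗ {i} {j} {l} 0 _ (trans eq (sym (ℕ.+-identityʳ (u l)))) c≡
    (inj₂ eq) →
      let c≤ : c l ℕ.+ q ℕ.≤ c i ℕ.+ c j
          c≤ = ℕ.≤-trans (⌈n/k⌉+x≤⌈[n+y]/k⌉ (u l) (ℕ.m/n*n≤m a k))
            (subst (λ n → ⌈ n / k ⌉ ℕ.≤ c i ℕ.+ c j) eq (⌈[m+n]/k⌉≤⌈m/k⌉+⌈n/k⌉ (u i) (u j)))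
          c≡ = trans (sym (ℕ.m+[n∸m]≡n c≤))
            (cong (λ n → c l ℕ.+ n ℕ.+ (c i ℕ.+ c j ℕ.∸ (c l ℕ.+ q))) (sym (ℕ.*-identityˡ q)))
      in _ , _ , slackʳ {i} {j} {l} a eq ,
         slackᵗ {i} {j} {l} 1 _ (trans eq (cong (u l ℕ.+_) (sym (ℕ.*-identityˡ a)))) c≡

  slackᵗ≡0 : ∀ {i j l} → u i ℕ.+ u j ≡ u l → c i ℕ.+ c j ≡ c l → intSlack t i j l ≡ 0ℤ
  slackᵗ≡0 {i} {j} {l} u≡ c≡ = trans
    (slackᵗ {i} {j} {l} 0 0 (trans u≡ (sym (ℕ.+-identityʳ (u l))))
      (trans c≡ (sym (trans (ℕ.+-identityʳ _) (ℕ.+-identityʳ (c l))))))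
    (cong +_ (ℕ.*-zeroʳ a))

  rayʳ-cone : IntCone a r
  rayʳ-cone {i} {j} {l} i+j≡l = let _ , _ , r≡ , _ = slacks {i} {j} {l} i+j≡l in subst (0ℤ ℤ.≤_) (sym r≡) (ℤ.+≤+ z≤n)

  rayᵗ-cone : IntCone a t
  rayᵗ-cone {i} {j} {l} i+j≡l = let _ , _ , _ , t≡ = slacks {i} {j} {l} i+j≡l in subst (0ℤ ℤ.≤_) (sym t≡) (ℤ.+≤+ z≤n)

  module _ (h N : ℕ) where

    facePoint : Vector ℤ (pred a)
    facePoint i = + h ℤ.* t i ℤ.+ + N ℤ.* r i

    slack-facePoint : ∀ i j l → intSlack facePoint i j l ≡ + h ℤ.* intSlack t i j l ℤ.+ + N ℤ.* intSlack r i j l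
    slack-facePoint i j l = identity (+ h) (+ N) (t i) (t j) (t l) (r i) (r j) (r l)
      where
      identity : ∀ h N t t′ t″ r r′ r″ →
        (h ℤ.* t ℤ.+ N ℤ.* r) ℤ.+ (h ℤ.* t′ ℤ.+ N ℤ.* r′) ℤ.- (h ℤ.* t″ ℤ.+ N ℤ.* r″) ≡
        h ℤ.* (t ℤ.+ t′ ℤ.- t″) ℤ.+ N ℤ.* (r ℤ.+ r′ ℤ.- r″)
      identity = solve-∀

    slack-facePoint-pos : ∀ i j l {x y} → intSlack r i j l ≡ + x → intSlack t i j l ≡ + y →
                          intSlack facePoint i j l ≡ + (h ℕ.* y ℕ.+ N ℕ.* x)
    slack-facePoint-pos i j l {x} {y} r≡ t≡ = trans (slack-facePoint i j l)
      (cong₂ ℤ._+_ (trans (cong (+ h ℤ.*_) t≡) (sym (ℤ.pos-* h y))) (trans (cong (+ N ℤ.*_) r≡) (sym (ℤ.pos-* N x))))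

    facePoint-cone : IntCone a facePoint
    facePoint-cone {i} {j} {l} i+j≡l = let _ , _ , r≡ , t≡ = slacks {i} {j} {l} i+j≡l in
      subst (0ℤ ℤ.≤_) (sym (slack-facePoint-pos i j l r≡ t≡)) (ℤ.+≤+ z≤n)

    -- Both slacks are natural numbers with positive coefficients, so neither term can compensate
    -- the other. This places w in the interior of the cone spanned by r and t and not on one of its
    -- two rays.
    facePoint-tight : 0 ℕ.< h → 0 ℕ.< N → ∀ {i j l} → ResidueSum a i j l → intSlack facePoint i j l ≡ 0ℤ →
                      intSlack r i j l ≡ 0ℤ × intSlack t i j l ≡ 0ℤ
    facePoint-tight 0<h 0<N {i} {j} {l} i+j≡l tight =
      let x , y , r≡ , t≡ = slacks {i} {j} {l} i+j≡l
          hy+Nx≡0 = ℤ.+-injective (trans (sym (slack-facePoint-pos i j l r≡ t≡)) tight)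
      in trans r≡ (cong +_ (cancel N 0<N (ℕ.m+n≡0⇒n≡0 (h ℕ.* y) hy+Nx≡0))) ,
         trans t≡ (cong +_ (cancel h 0<h (ℕ.m+n≡0⇒m≡0 (h ℕ.* y) hy+Nx≡0)))
      where
      cancel : ∀ m → 0 ℕ.< m → ∀ {n} → m ℕ.* n ≡ 0 → n ≡ 0
      cancel (suc m) _ {zero} _ = refl

-- Reparametrizations

module _ {m : ℕ} (d d′ : ℤ) (d≡d′ : d ≡ d′ [mod m ]) where

  invertible-resp-mod : ∀ {e} → d ℤ.* e ≡ 1ℤ [mod m ] → d′ ℤ.* e ≡ 1ℤ [mod m ]
  invertible-resp-mod {e} de≡1 = mod-trans (d′ ℤ.* e) (d ℤ.* e) 1ℤ
    (mod-sym (d ℤ.* e) (d′ ℤ.* e) (subst₂ (_≡_[mod m ]) (ℤ.*-comm e d) (ℤ.*-comm e d′) (mod-*ˡ e d d′ d≡d′))) de≡1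

  index-resp-mod : ∀ {u} → IsIndex m d u → IsIndex m d′ u
  index-resp-mod {u} isIndex = record
    { positive = positive
    ; bounded  = bounded
    ; hits     = λ i → mod-trans (+ u i ℤ.* d′) (+ u i ℤ.* d) (residue i)
        (mod-sym (+ u i ℤ.* d) (+ u i ℤ.* d′) (mod-*ˡ (+ u i) d d′ d≡d′)) (hits i)
    }
    where open IsIndex isIndex

-- Kunz coordinates are the quotients of Apéry elements by m, so adding v to them means adding mv to
-- the Apéry tuple.
displaces : ∀ {S T m x y} {v : Vector ℤ (pred m)} → IsApéryTuple S m x → IsApéryTuple T m y →
            (∀ i → y i ≡ x i ℤ.+ + m ℤ.* v i) → Displaces m v S T
displaces {m = m} {x} {y} {v} X Y y≡x+mv = z , apéry-resp-≗ X x≡ , apéry-resp-≗ Y y≡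
  where
  quotient : ∀ i → ∃ λ q → x i ≡ residue i ℤ.+ q ℤ.* + m
  quotient i = mod⇒≡ (x i) (residue i) (IsApéryTuple.inClass X i)
  z : Vector ℤ (pred m)
  z i = proj₁ (quotient i)
  identity₁ : ∀ r z m → r ℤ.+ z ℤ.* m ≡ m ℤ.* z ℤ.+ r
  identity₁ = solve-∀
  x≡ : ∀ i → x i ≡ + m ℤ.* z i ℤ.+ residue i
  x≡ i = trans (proj₂ (quotient i)) (identity₁ (residue i) (z i) (+ m))
  identity₂ : ∀ r z v m → m ℤ.* z ℤ.+ r ℤ.+ m ℤ.* v ≡ m ℤ.* (z ℤ.+ v) ℤ.+ r
  identity₂ = solve-∀
  y≡ : ∀ i → y i ≡ + m ℤ.* (z i ℤ.+ v i) ℤ.+ residue i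
  y≡ i = trans (y≡x+mv i) (trans (cong (λ x → x ℤ.+ + m ℤ.* v i) (x≡ i)) (identity₂ (residue i) (z i) (v i) (+ m)))

egaGenerators-shift : ∀ a h h′ k d s → (∀ {j} → j ℕ.≤ k → 0ℤ ℤ.≤ + h′ ℤ.+ + j ℤ.* s) →
  (∀ j → 0ℤ ℤ.≤ egaGenerators a h k d j) → ∀ j → 0ℤ ℤ.≤ egaGenerators a (h ℕ.+ h′) k (d ℤ.+ + a ℤ.* s) j
egaGenerators-shift a h h′ k d s 0≤shift 0≤g zero    = ℤ.+≤+ z≤n
egaGenerators-shift a h h′ k d s 0≤shift 0≤g (suc j) = subst (0ℤ ℤ.≤_) (begin
  + (a ℕ.* h) ℤ.+ + n ℤ.* d ℤ.+ + a ℤ.* (+ h′ ℤ.+ + n ℤ.* s)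
    ≡⟨ cong (λ x → x ℤ.+ + n ℤ.* d ℤ.+ + a ℤ.* (+ h′ ℤ.+ + n ℤ.* s)) (ℤ.pos-* a h) ⟩
  + a ℤ.* + h ℤ.+ + n ℤ.* d ℤ.+ + a ℤ.* (+ h′ ℤ.+ + n ℤ.* s)
    ≡⟨ identity (+ a) (+ h) (+ h′) (+ n) d s ⟩
  + a ℤ.* + (h ℕ.+ h′) ℤ.+ + n ℤ.* (d ℤ.+ + a ℤ.* s)
    ≡⟨ cong (ℤ._+ + n ℤ.* (d ℤ.+ + a ℤ.* s)) (ℤ.pos-* a (h ℕ.+ h′)) ⟨
  + (a ℕ.* (h ℕ.+ h′)) ℤ.+ + n ℤ.* (d ℤ.+ + a ℤ.* s) ∎)
  (ℤ.+-mono-≤ (0≤g (suc j)) (subst (ℤ._≤ + a ℤ.* (+ h′ ℤ.+ + n ℤ.* s)) (ℤ.*-zeroʳ (+ a))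
    (ℤ.*-monoˡ-≤-nonNeg (+ a) (0≤shift (toℕ<n j)))))
  where
  open ≡-Reasoning
  n = suc (toℕ j)
  identity : ∀ a h h′ n d s → a ℤ.* h ℤ.+ n ℤ.* d ℤ.+ a ℤ.* (h′ ℤ.+ n ℤ.* s) ≡
    a ℤ.* (h ℤ.+ h′) ℤ.+ n ℤ.* (d ℤ.+ a ℤ.* s)
  identity = solve-∀

egaApéry-shift : ∀ a h h′ k d s .{{_ : NonZero a}} .{{_ : NonZero k}} u i →
  egaApéry a (h ℕ.+ h′) k (d ℤ.+ + a ℤ.* s) u i ≡
  egaApéry a h k d u i ℤ.+ + a ℤ.* (+ h′ ℤ.* + ⌈ u i / k ⌉ ℤ.+ + u i ℤ.* s)
egaApéry-shift a h h′ k d s u i = trans (cong (λ x → x ℤ.* + ⌈ u i / k ⌉ ℤ.+ + u i ℤ.* (d ℤ.+ + a ℤ.* s)) (ℤ.pos-* a (h ℕ.+ h′)))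
  (trans (identity (+ a) (+ h) (+ h′) (+ ⌈ u i / k ⌉) (+ u i) d s)
    (cong (λ x → x ℤ.* + ⌈ u i / k ⌉ ℤ.+ + u i ℤ.* d ℤ.+ + a ℤ.* (+ h′ ℤ.* + ⌈ u i / k ⌉ ℤ.+ + u i ℤ.* s)) (sym (ℤ.pos-* a h))))
  where
  identity : ∀ a h h′ c u d s → a ℤ.* (h ℤ.+ h′) ℤ.* c ℤ.+ u ℤ.* (d ℤ.+ a ℤ.* s) ≡
    a ℤ.* h ℤ.* c ℤ.+ u ℤ.* d ℤ.+ a ℤ.* (h′ ℤ.* c ℤ.+ u ℤ.* s)
  identity = solve-∀

-- Both displacements at once: (h′, s) is (0, 1) for r and (a, -q) for t. The shift changes N by h′q
-- + as, which is a in the first case and 0 in the second. The equations for `h″` and `d″` let the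
-- target be written as in the theorem.
displaces-shift : ∀ {a h h′ h″ k d d″ e s N N′ u v} .{{_ : NonZero a}} .{{_ : NonZero k}} →
  d ℤ.* e ≡ 1ℤ [mod a ] → IsIndex a d u → (∀ j → 0ℤ ℤ.≤ egaGenerators a h k d j) →
  + (h ℕ.* (a ℕ./ k)) ℤ.+ d ≡ + N → (∀ {j} → j ℕ.≤ k → 0ℤ ℤ.≤ + h′ ℤ.+ + j ℤ.* s) →
  + h′ ℤ.* + (a ℕ./ k) ℤ.+ + a ℤ.* s ≡ + N′ →
  h ℕ.+ h′ ≡ h″ → d ℤ.+ + a ℤ.* s ≡ d″ → (∀ i → + h′ ℤ.* + ⌈ u i / k ⌉ ℤ.+ + u i ℤ.* s ≡ v i) →
  Displaces a v ⟨ egaGenerators a h k d ⟩ ⟨ egaGenerators a h″ k d″ ⟩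
displaces-shift {a} {h} {h′} {_} {k} {d} {_} {e} {s} {N} {N′} {u} de≡1 isIndex 0≤g N≡ 0≤shift N′≡ refl refl ≡v = displaces
  (ega-isApéryTuple a h k d {e} de≡1 0≤g N≡ isIndex)
  (ega-isApéryTuple a (h ℕ.+ h′) k (d ℤ.+ + a ℤ.* s) {e} (invertible-resp-mod d (d ℤ.+ + a ℤ.* s) d≡d+as {e} de≡1)
    (egaGenerators-shift a h h′ k d s 0≤shift 0≤g) {N ℕ.+ N′} shifted-N (index-resp-mod d (d ℤ.+ + a ℤ.* s) d≡d+as isIndex))
  (λ i → trans (egaApéry-shift a h h′ k d s u i) (cong (λ x → egaApéry a h k d u i ℤ.+ + a ℤ.* x) (≡v i)))
  where
  d≡d+as : d ≡ d ℤ.+ + a ℤ.* s [mod a ]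
  d≡d+as = mod-sym (d ℤ.+ + a ℤ.* s) d (subst (λ x → d ℤ.+ x ≡ d [mod a ]) (ℤ.*-comm s (+ a)) (mod-+multiple d s))
  q = a ℕ./ k
  identity : ∀ h h′ q d x → (h ℤ.+ h′) ℤ.* q ℤ.+ (d ℤ.+ x) ≡ h ℤ.* q ℤ.+ d ℤ.+ (h′ ℤ.* q ℤ.+ x)
  identity = solve-∀
  open ≡-Reasoning
  shifted-N : + ((h ℕ.+ h′) ℕ.* q) ℤ.+ (d ℤ.+ + a ℤ.* s) ≡ + (N ℕ.+ N′)
  shifted-N = begin
    + ((h ℕ.+ h′) ℕ.* q) ℤ.+ (d ℤ.+ + a ℤ.* s)              ≡⟨ cong (ℤ._+ (d ℤ.+ + a ℤ.* s)) (ℤ.pos-* (h ℕ.+ h′) q) ⟩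
    + (h ℕ.+ h′) ℤ.* + q ℤ.+ (d ℤ.+ + a ℤ.* s)              ≡⟨ identity (+ h) (+ h′) (+ q) d (+ a ℤ.* s) ⟩
    + h ℤ.* + q ℤ.+ d ℤ.+ (+ h′ ℤ.* + q ℤ.+ + a ℤ.* s)      ≡⟨ cong (λ x → x ℤ.+ d ℤ.+ (+ h′ ℤ.* + q ℤ.+ + a ℤ.* s)) (ℤ.pos-* h q) ⟨
    + (h ℕ.* q) ℤ.+ d ℤ.+ (+ h′ ℤ.* + q ℤ.+ + a ℤ.* s)      ≡⟨ cong₂ ℤ._+_ N≡ N′≡ ⟩
    + (N ℕ.+ N′) ∎

-- Semigroups with two generators

module _ {a : ℕ} .{{_ : NonZero a}} where

  -- The case h = 0, k = 1 with b in the role of d: the ceilings are multiplied by ah = 0, and hq +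
  -- d becomes b.
  twoGenerated-isApéryTuple : ∀ {d e b u} → d ℤ.* e ≡ 1ℤ [mod a ] → IsIndex a d u → 0ℤ ℤ.≤ b → b ≡ d [mod a ] →
    IsApéryTuple ⟨ + a ∷ b ∷ [] ⟩ a (λ i → b ℤ.* + u i)
  twoGenerated-isApéryTuple {d} {e} {b} {u} de≡1 isIndex 0≤b b≡d = apéry-resp-≐
    (apéry-resp-≗ (ega-isApéryTuple a 0 1 b {e} (invertible-resp-mod d b d≡b {e} de≡1) 0≤g (sym (trans (ℤ.0≤i⇒+∣i∣≡i 0≤b) (sym (ℤ.+-identityˡ b))))
      (index-resp-mod d b d≡b isIndex)) apéry≡)
    (span-resp-≗ g≗ , span-resp-≗ (λ i → sym (g≗ i)))
    where
    d≡b : d ≡ b [mod a ]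
    d≡b = mod-sym b d b≡d
    g≗ : egaGenerators a 0 1 b ≗ + a ∷ b ∷ []
    g≗ zero       = refl
    g≗ (suc zero) = trans (cong (λ n → + n ℤ.+ 1ℤ ℤ.* b) (ℕ.*-zeroʳ a)) (trans (ℤ.+-identityˡ _) (ℤ.*-identityˡ b))
    0≤g : ∀ j → 0ℤ ℤ.≤ egaGenerators a 0 1 b j
    0≤g j = subst (0ℤ ℤ.≤_) (sym (g≗ j)) (0≤ j)
      where
      0≤ : ∀ j → 0ℤ ℤ.≤ (+ a ∷ b ∷ []) j
      0≤ zero       = ℤ.+≤+ z≤n
      0≤ (suc zero) = 0≤b
    apéry≡ : egaApéry a 0 1 b u ≗ λ i → b ℤ.* + u i
    apéry≡ i = trans (cong (λ n → + n ℤ.* + ⌈ u i / 1 ⌉ ℤ.+ + u i ℤ.* b) (ℕ.*-zeroʳ a))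
      (trans (ℤ.+-identityˡ _) (ℤ.*-comm (+ u i) b))

  -- A semigroup is generated by a and its Apéry elements; here these are multiples of b, and b is
  -- one of them.
  proportional⇒twoGenerated : ∀ {T x} (u : Fin (pred a) → ℕ) {b} i₀ → IsApéryTuple T a x → (∀ i → x i ≡ + u i ℤ.* b) → x i₀ ≡ b →
                              T ≐ ⟨ + a ∷ b ∷ [] ⟩
  proportional⇒twoGenerated {T} {x} u {b} i₀ tuple x≡ub xi₀≡b = T⊆ , span⊆ {T} zero-closed +-closed (+ a ∷ b ∷ []) g∈T
    where
    open IsApéryTuple tuple
    open IsNumericalSemigroup isNumericalSemigroup
    g : Vector ℤ 2
    g = + a ∷ b ∷ []
    g∈T : ∀ i → g i ∈ T
    g∈T zero       = modulus∈S
    g∈T (suc zero) = subst T xi₀≡b (proj₁ (inApérySet i₀))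
    combination∈ : ∀ m p → + m ℤ.* b ℤ.+ + p ℤ.* + a ∈ ⟨ g ⟩
    combination∈ m p = +multiple∈ {⟨ g ⟩} (0∈span g) (+∈span g) {+ m ℤ.* b} {+ a}
      (multiple∈ {⟨ g ⟩} (0∈span g) (+∈span g) {b} (generator∈span g (suc zero)) m) (generator∈span g zero) p
    T⊆ : T ⊆ ⟨ g ⟩
    T⊆ {n} n∈T = case classify a n of λ where
      (inj₁ n≡0) → let p , n≡pa = mod⇒≡+ {x = n} {0ℤ} n≡0 (nonNegative n∈T) in
        subst ⟨ g ⟩ (sym n≡pa) (combination∈ 0 p)
      (inj₂ (i , n≡i)) → let p , n≡x+pa = apéry-least tuple i n∈T n≡i in
        subst ⟨ g ⟩ (sym (trans n≡x+pa (cong (λ x → x ℤ.+ + p ℤ.* + a) (x≡ub i)))) (combination∈ (u i) p)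

-- If a = qk + 1, then t enumerates the multiples of kd just as r enumerates those of d.

module _ {a k : ℕ} .{{_ : NonZero a}} .{{_ : NonZero k}} (a≡qk+1 : a ≡ a ℕ./ k ℕ.* k ℕ.+ 1) {d e : ℤ} where

  private
    q : ℕ
    q = a ℕ./ k

    lifted : + a ≡ + q ℤ.* + k ℤ.+ 1ℤ
    lifted = trans (cong +_ a≡qk+1) (cong (ℤ._+ 1ℤ) (ℤ.pos-* q k))

    -a≡ : ∀ x y → x ℤ.- (+ a ℤ.- 1ℤ) ℤ.* y ≡ x ℤ.- + q ℤ.* + k ℤ.* y
    -a≡ x y = trans (cong (λ a → x ℤ.- (a ℤ.- 1ℤ) ℤ.* y) lifted) (identity (+ q) (+ k) x y)
      where
      identity : ∀ q k x y → x ℤ.- (q ℤ.* k ℤ.+ 1ℤ ℤ.- 1ℤ) ℤ.* y ≡ x ℤ.- q ℤ.* k ℤ.* y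
      identity = solve-∀

  -- From a = qk + 1 follows qk ≡ -1 modulo a, so -q inverts k.
  multiple-invertible : d ℤ.* e ≡ 1ℤ [mod a ] → + k ℤ.* d ℤ.* (ℤ.- + q ℤ.* e) ≡ 1ℤ [mod a ]
  multiple-invertible de≡1 = mod-trans (+ k ℤ.* d ℤ.* (ℤ.- + q ℤ.* e)) (d ℤ.* e) 1ℤ
    (subst (_≡ d ℤ.* e [mod a ]) (begin
      d ℤ.* e ℤ.+ ℤ.- (d ℤ.* e) ℤ.* + a              ≡⟨ identity₁ (+ a) (d ℤ.* e) ⟩
      0ℤ ℤ.- (+ a ℤ.- 1ℤ) ℤ.* (d ℤ.* e)              ≡⟨ -a≡ 0ℤ (d ℤ.* e) ⟩
      0ℤ ℤ.- + q ℤ.* + k ℤ.* (d ℤ.* e)               ≡⟨ identity₂ (+ q) (+ k) d e ⟩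
      + k ℤ.* d ℤ.* (ℤ.- + q ℤ.* e)                  ∎)
      (mod-+multiple (d ℤ.* e) (ℤ.- (d ℤ.* e)))) de≡1
    where
    open ≡-Reasoning
    identity₁ : ∀ a x → x ℤ.+ ℤ.- x ℤ.* a ≡ 0ℤ ℤ.- (a ℤ.- 1ℤ) ℤ.* x
    identity₁ = solve-∀
    identity₂ : ∀ q k d e → 0ℤ ℤ.- q ℤ.* k ℤ.* (d ℤ.* e) ≡ k ℤ.* d ℤ.* (ℤ.- q ℤ.* e)
    identity₂ = solve-∀

  -- The vector t in natural numbers: for a = qk + 1 and c the ceiling of u/k, ac - qu = c + q(ck -
  -- u). The truncated subtraction is exact because u ≤ ck.
  multipleIndex : (Fin (pred a) → ℕ) → Fin (pred a) → ℕ
  multipleIndex u i = ⌈ u i / k ⌉ ℕ.+ q ℕ.* (⌈ u i / k ⌉ ℕ.* k ℕ.∸ u i)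

  rayᵗ≡multipleIndex : ∀ u i → rayᵗ a k u i ≡ + multipleIndex u i
  rayᵗ≡multipleIndex u i = begin
    + a ℤ.* + c ℤ.- + q ℤ.* + u i
      ≡⟨ cong₂ (λ a u → a ℤ.* + c ℤ.- + q ℤ.* u) lifted u≡ ⟩
    (+ q ℤ.* + k ℤ.+ 1ℤ) ℤ.* + c ℤ.- + q ℤ.* (+ c ℤ.* + k ℤ.- + v)
      ≡⟨ identity (+ q) (+ k) (+ c) (+ v) ⟩
    + c ℤ.+ + q ℤ.* + v
      ≡⟨ cong (λ x → + c ℤ.+ x) (ℤ.pos-* q v) ⟨
    + multipleIndex u i ∎
    where
    open ≡-Reasoning
    c = ⌈ u i / k ⌉
    v = c ℕ.* k ℕ.∸ u i
    cancel : ∀ x y → x ≡ x ℤ.+ y ℤ.- y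
    cancel = solve-∀
    u≡ : + u i ≡ + c ℤ.* + k ℤ.- + v
    u≡ = trans (cancel (+ u i) (+ v)) (cong (ℤ._- + v)
      (trans (cong +_ (ℕ.m+[n∸m]≡n (n≤⌈n/k⌉*k (u i)))) (ℤ.pos-* c k)))
    identity : ∀ q k c v → (q ℤ.* k ℤ.+ 1ℤ) ℤ.* c ℤ.- q ℤ.* (c ℤ.* k ℤ.- v) ≡ c ℤ.+ q ℤ.* v
    identity = solve-∀

  -- The bound: u ≤ qk gives c ≤ q, and ck - u is at most k - 1, so the value is at most q + q(k -
  -- 1) = qk < a. The class: (ac - qu)kd ≡ -qk·ud ≡ ud modulo a.
  multipleIndex-isIndex : ∀ {u} → IsIndex a d u → IsIndex a (+ k ℤ.* d) (multipleIndex u)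
  multipleIndex-isIndex {u} isIndex = record
    { positive = λ i → ℕ.<-≤-trans
        (ℕ.*-cancelʳ-< k 0 _ (ℕ.<-≤-trans (positive i) (n≤⌈n/k⌉*k (u i)))) (ℕ.m≤m+n ⌈ u i / k ⌉ _)
    ; bounded  = λ i → ℕ.≤-<-trans (τ≤qk i) (subst (q ℕ.* k ℕ.<_) (sym a≡qk+1) (ℕ.m<m+n (q ℕ.* k) (s≤s z≤n)))
    ; hits     = λ i → mod-trans (+ multipleIndex u i ℤ.* (+ k ℤ.* d)) (+ u i ℤ.* d) (residue i) (τkd≡ud i) (hits i)
    }
    where
    open IsIndex isIndex
    τ≤qk : ∀ i → multipleIndex u i ℕ.≤ q ℕ.* k
    τ≤qk i = begin
      ⌈ u i / k ⌉ ℕ.+ q ℕ.* (⌈ u i / k ⌉ ℕ.* k ℕ.∸ u i)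
        ≤⟨ ℕ.+-mono-≤ (n≤m*k⇒⌈n/k⌉≤m u≤qk) (ℕ.*-monoʳ-≤ q (ℕ.m≤n+o⇒m∸n≤o _ (u i) (ℕ.m/n*n≤m (u i ℕ.+ pred k) k))) ⟩
      q ℕ.+ q ℕ.* pred k       ≡⟨ ℕ.*-suc q (pred k) ⟨
      q ℕ.* suc (pred k)       ≡⟨ cong (q ℕ.*_) (ℕ.suc-pred k) ⟩
      q ℕ.* k                  ∎
      where
      open ℕ.≤-Reasoning
      u≤qk : u i ℕ.≤ q ℕ.* k
      u≤qk = ℕ.s≤s⁻¹ (subst (u i ℕ.<_) (trans a≡qk+1 (ℕ.+-comm _ 1)) (bounded i))
    τkd≡ud : ∀ i → + multipleIndex u i ℤ.* (+ k ℤ.* d) ≡ + u i ℤ.* d [mod a ]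
    τkd≡ud i = subst (_≡ + u i ℤ.* d [mod a ]) (begin
      + u i ℤ.* d ℤ.+ (+ k ℤ.* d ℤ.* + c ℤ.- + u i ℤ.* d) ℤ.* + a
        ≡⟨ identity₁ (+ u i) d (+ k ℤ.* d) (+ c) (+ a) ⟩
      + k ℤ.* d ℤ.* (+ a ℤ.* + c) ℤ.- (+ a ℤ.- 1ℤ) ℤ.* (+ u i ℤ.* d)
        ≡⟨ -a≡ (+ k ℤ.* d ℤ.* (+ a ℤ.* + c)) (+ u i ℤ.* d) ⟩
      + k ℤ.* d ℤ.* (+ a ℤ.* + c) ℤ.- + q ℤ.* + k ℤ.* (+ u i ℤ.* d)
        ≡⟨ identity₂ (+ k) d (+ a ℤ.* + c) (+ q) (+ u i) ⟩
      (+ a ℤ.* + c ℤ.- + q ℤ.* + u i) ℤ.* (+ k ℤ.* d)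
        ≡⟨ cong (ℤ._* (+ k ℤ.* d)) (rayᵗ≡multipleIndex u i) ⟩
      + multipleIndex u i ℤ.* (+ k ℤ.* d) ∎)
      (mod-+multiple (+ u i ℤ.* d) (+ k ℤ.* d ℤ.* + c ℤ.- + u i ℤ.* d))
      where
      open ≡-Reasoning
      c = ⌈ u i / k ⌉
      identity₁ : ∀ u d x c a → u ℤ.* d ℤ.+ (x ℤ.* c ℤ.- u ℤ.* d) ℤ.* a ≡ x ℤ.* (a ℤ.* c) ℤ.- (a ℤ.- 1ℤ) ℤ.* (u ℤ.* d)
      identity₁ = solve-∀
      identity₂ : ∀ k d x q u → k ℤ.* d ℤ.* x ℤ.- q ℤ.* k ℤ.* (u ℤ.* d) ≡ (x ℤ.- q ℤ.* u) ℤ.* (k ℤ.* d)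
      identity₂ = solve-∀

k∣a∸1⇒a≡qk+1 : ∀ {a k} .{{_ : NonZero a}} .{{_ : NonZero k}} → 1 ℕ.< k → k ℕ.∣ a ℕ.∸ 1 → a ≡ a ℕ./ k ℕ.* k ℕ.+ 1
k∣a∸1⇒a≡qk+1 {a} {k} 1<k (ℕ.divides q a∸1≡qk) = trans a≡ (cong (λ q → q ℕ.* k ℕ.+ 1) (sym a/k≡q))
  where
  a≡ : a ≡ q ℕ.* k ℕ.+ 1
  a≡ = trans (sym (ℕ.m∸n+n≡m (ℕ.>-nonZero⁻¹ a))) (cong (ℕ._+ 1) a∸1≡qk)
  a/k≡q : a ℕ./ k ≡ q
  a/k≡q = trans (cong (ℕ._/ k) a≡) (trans (ℕ.+-distrib-/-∣ˡ 1 (ℕ.n∣m*n q))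
    (trans (cong₂ ℕ._+_ (ℕ.m*n/n≡m q k) (ℕ.m<n⇒m/n≡0 1<k)) (ℕ.+-identityʳ q)))

-- Ordered fields: signs, division and the image of the integers

module OrderedFieldProperties {ℓ : Level} (K : OrderedField ℓ) where
  open OrderedField K hiding (refl; sym; trans; reflexive; zero)
  module K where
    open OrderedField K public
    open IsDecTotalOrder (OrderedField.isDecTotalOrder K) public
      using (antisym; total; _≟_)
      renaming (refl to ≤-refl; reflexive to ≤-reflexive; trans to ≤-trans)
  open RingProperties ring using (-0#≈0#; -‿+-comm; -‿involutive; -‿distribˡ-*; -‿distribʳ-*)
  open Mult semiring using (×-homo-+; ×1-homo-*; ×-homo-1) renaming (_×_ to _·_)
  open import Relation.Binary.Reasoning.Setoid setoid

  fromℤ-⊖ : ∀ m n → fromℤ (m ℤ.⊖ n) ≈ m · 1# - n · 1#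
  fromℤ-⊖ m       zero    = K.sym (K.trans (+-congˡ -0#≈0#) (+-identityʳ _))
  fromℤ-⊖ zero    (suc n) = K.sym (+-identityˡ _)
  fromℤ-⊖ (suc m) (suc n) = begin
    fromℤ (suc m ℤ.⊖ suc n)                  ≡⟨ cong fromℤ (ℤ.[1+m]⊖[1+n]≡m⊖n m n) ⟩
    fromℤ (m ℤ.⊖ n)                          ≈⟨ fromℤ-⊖ m n ⟩
    m · 1# - n · 1#                          ≈⟨ +-congʳ (+-identityˡ _) ⟨
    0# + m · 1# - n · 1#                     ≈⟨ +-congʳ (+-congʳ (-‿inverseʳ 1#)) ⟨
    1# - 1# + m · 1# - n · 1#                ≈⟨ +-congʳ (+-assoc 1# _ _) ⟩
    1# + (- 1# + m · 1#) - n · 1#            ≈⟨ +-congʳ (+-congˡ (+-comm _ _)) ⟩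
    1# + (m · 1# - 1#) - n · 1#              ≈⟨ +-congʳ (+-assoc 1# _ _) ⟨
    suc m · 1# - 1# - n · 1#                 ≈⟨ +-assoc _ _ _ ⟩
    suc m · 1# + (- 1# - n · 1#)             ≈⟨ +-congˡ (-‿+-comm 1# _) ⟩
    suc m · 1# - suc n · 1#                  ∎

  fromℤ-+ : ∀ i j → fromℤ (i ℤ.+ j) ≈ fromℤ i + fromℤ j
  fromℤ-+ (+ m)    (+ n)    = ×-homo-+ 1# m n
  fromℤ-+ (+ m)    -[1+ n ] = fromℤ-⊖ m (suc n)
  fromℤ-+ -[1+ m ] (+ n)    = K.trans (fromℤ-⊖ n (suc m)) (+-comm _ _)
  fromℤ-+ -[1+ m ] -[1+ n ] = begin
    - (suc (suc (m ℕ.+ n)) · 1#)       ≡⟨ cong (λ k → - (k · 1#)) (ℕ.+-suc (suc m) n) ⟨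
    - ((suc m ℕ.+ suc n) · 1#)         ≈⟨ -‿cong (×-homo-+ 1# (suc m) (suc n)) ⟩
    - (suc m · 1# + suc n · 1#)        ≈⟨ -‿+-comm _ _ ⟨
    - (suc m · 1#) - suc n · 1#        ∎

  fromℤ-neg : ∀ i → fromℤ (ℤ.- i) ≈ - fromℤ i
  fromℤ-neg (+ zero)  = K.sym -0#≈0#
  fromℤ-neg (+ suc n) = K.refl
  fromℤ-neg -[1+ n ]  = K.sym (-‿involutive _)

  fromℤ-* : ∀ i j → fromℤ (i ℤ.* j) ≈ fromℤ i * fromℤ j
  fromℤ-* (+ m) j = nonNegative m j
    where
    nonNegative : ∀ m j → fromℤ (+ m ℤ.* j) ≈ fromℤ (+ m) * fromℤ j
    nonNegative m (+ n)    = K.trans (K.reflexive (cong fromℤ (sym (ℤ.pos-* m n)))) (×1-homo-* m n)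
    nonNegative m -[1+ n ] = begin
      fromℤ (+ m ℤ.* ℤ.- + suc n)      ≡⟨ cong fromℤ (ℤ.neg-distribʳ-* (+ m) (+ suc n)) ⟨
      fromℤ (ℤ.- (+ m ℤ.* + suc n))    ≈⟨ fromℤ-neg (+ m ℤ.* + suc n) ⟩
      - fromℤ (+ m ℤ.* + suc n)        ≈⟨ -‿cong (nonNegative m (+ suc n)) ⟩
      - (m · 1# * suc n · 1#)          ≈⟨ -‿distribʳ-* _ _ ⟩
      m · 1# * - (suc n · 1#)          ∎
  fromℤ-* -[1+ m ] j = begin
    fromℤ (ℤ.- + suc m ℤ.* j)      ≡⟨ cong fromℤ (ℤ.neg-distribˡ-* (+ suc m) j) ⟨
    fromℤ (ℤ.- (+ suc m ℤ.* j))    ≈⟨ fromℤ-neg (+ suc m ℤ.* j) ⟩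
    - fromℤ (+ suc m ℤ.* j)        ≈⟨ -‿cong (fromℤ-* (+ suc m) j) ⟩
    - (suc m · 1# * fromℤ j)       ≈⟨ -‿distribˡ-* _ _ ⟩
    - (suc m · 1#) * fromℤ j       ∎

  fromℤ-1 : fromℤ 1ℤ ≈ 1#
  fromℤ-1 = ×-homo-1 1#

  fromℤ-minus : ∀ i j → fromℤ (i ℤ.- j) ≈ fromℤ i - fromℤ j
  fromℤ-minus i j = K.trans (fromℤ-+ i (ℤ.- j)) (+-congˡ (fromℤ-neg j))

  private
    fromℤ-morphism : ℤ.+-*-rawRing -Raw-AlmostCommutative⟶ fromCommutativeRing commutativeRing
    fromℤ-morphism = record
      { ⟦_⟧    = fromℤ
      ; +-homo = fromℤ-+
      ; *-homo = fromℤ-*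
      ; -‿homo = fromℤ-neg
      ; 0-homo = K.refl
      ; 1-homo = fromℤ-1
      }

    fromℤ-≟ : ∀ i j → Maybe (fromℤ i ≈ fromℤ j)
    fromℤ-≟ i j with i ℤ.≟ j
    ... | yes i≡j = just (K.reflexive (cong fromℤ i≡j))
    ... | no _    = nothing

  -- The constant `con 1ℤ` denotes `fromℤ 1ℤ`, which equals `1#` only up to `≈`. Identities that
  -- mention `1#` therefore abstract it as a variable o.
  module Solver = RingSolver ℤ.+-*-rawRing (fromCommutativeRing commutativeRing) fromℤ-morphism fromℤ-≟
  open Solver using (solve; _:=_; _:+_; _:*_; _:-_; :-_; con)

  0≤-resp-≈ : ∀ {x y} → x ≈ y → 0# ≤ x → 0# ≤ y
  0≤-resp-≈ x≈y 0≤x = K.≤-trans 0≤x (K.≤-reflexive x≈y)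

  x≤y⇒0≤y-x : ∀ {x y} → x ≤ y → 0# ≤ y - x
  x≤y⇒0≤y-x {x} {y} x≤y = K.≤-trans (K.≤-reflexive (K.sym (-‿inverseˡ x)))
    (K.≤-trans (+-monoʳ-≤ (- x) x≤y) (K.≤-reflexive (+-comm _ _)))

  0≤y-x⇒x≤y : ∀ {x y} → 0# ≤ y - x → x ≤ y
  0≤y-x⇒x≤y {x} {y} 0≤y-x = K.≤-trans (K.≤-reflexive (K.sym (+-identityʳ x)))
    (K.≤-trans (+-monoʳ-≤ x 0≤y-x) (K.≤-reflexive (solve 2 (λ x y → x :+ (y :- x) := y) K.refl x y)))

  0<y-x⇒x<y : ∀ {x y} → 0# < y - x → x < y
  0<y-x⇒x<y (0≤y-x , 0≉y-x) = 0≤y-x⇒x≤y 0≤y-x , λ x≈y → 0≉y-x (K.sym (K.trans (+-congˡ (-‿cong x≈y)) (-‿inverseʳ _)))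

  0≤x+y : ∀ {x y} → 0# ≤ x → 0# ≤ y → 0# ≤ x + y
  0≤x+y {x} 0≤x 0≤y = K.≤-trans 0≤x (K.≤-trans (K.≤-reflexive (K.sym (+-identityʳ x))) (+-monoʳ-≤ x 0≤y))

  0≤-x : ∀ {x} → x ≤ 0# → 0# ≤ - x
  0≤-x x≤0 = 0≤-resp-≈ (+-identityˡ _) (x≤y⇒0≤y-x x≤0)

  0≤x∧0≤-x⇒x≈0 : ∀ {x} → 0# ≤ x → 0# ≤ - x → x ≈ 0#
  0≤x∧0≤-x⇒x≈0 {x} 0≤x 0≤-x = K.antisym (0≤y-x⇒x≤y (0≤-resp-≈ (K.sym (+-identityˡ _)) 0≤-x)) 0≤x

  0≤1 : 0# ≤ 1#
  0≤1 = case K.total 0# 1# of λ where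
    (inj₁ 0≤1) → 0≤1
    (inj₂ 1≤0) → 0≤-resp-≈ (K.trans (solve 1 (λ x → :- x :* :- x := x :* x) K.refl 1#) (*-identityˡ 1#))
                   (*-nonNegative (0≤-x 1≤0) (0≤-x 1≤0))

  0<-resp-≈ : ∀ {x y} → x ≈ y → 0# < x → 0# < y
  0<-resp-≈ x≈y (0≤x , 0≉x) = 0≤-resp-≈ x≈y 0≤x , λ 0≈y → 0≉x (K.trans 0≈y (K.sym x≈y))

  0<1 : 0# < 1#
  0<1 = 0≤1 , 0≉1

  x+y≈0⇒x≈0 : ∀ {x y} → 0# ≤ x → 0# ≤ y → x + y ≈ 0# → x ≈ 0#
  x+y≈0⇒x≈0 {x} {y} 0≤x 0≤y x+y≈0 = 0≤x∧0≤-x⇒x≈0 0≤x (0≤-resp-≈ (begin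
    y            ≈⟨ solve 2 (λ x y → y := :- x :+ (x :+ y)) K.refl x y ⟩
    - x + (x + y) ≈⟨ +-congˡ x+y≈0 ⟩
    - x + 0#      ≈⟨ +-identityʳ _ ⟩
    - x           ∎) 0≤y)

  0<x+y : ∀ {x y} → 0# < x → 0# ≤ y → 0# < x + y
  0<x+y (0≤x , 0≉x) 0≤y = 0≤x+y 0≤x 0≤y , λ 0≈x+y → 0≉x (K.sym (x+y≈0⇒x≈0 0≤x 0≤y (K.sym 0≈x+y)))

  0<x⇒x≉0 : ∀ {x} → 0# < x → ¬ x ≈ 0#
  0<x⇒x≉0 (_ , 0≉x) x≈0 = 0≉x (K.sym x≈0)

  x*y≈0⇒y≈0 : ∀ {x y} → ¬ x ≈ 0# → x * y ≈ 0# → y ≈ 0#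
  x*y≈0⇒y≈0 {x} {y} x≉0 xy≈0 = let z , xz≈1 = inverse x x≉0 in begin
    y             ≈⟨ *-identityˡ y ⟨
    1# * y        ≈⟨ *-congʳ xz≈1 ⟨
    x * z * y     ≈⟨ solve 3 (λ x y z → x :* z :* y := z :* (x :* y)) K.refl x y z ⟩
    z * (x * y)   ≈⟨ *-congˡ xy≈0 ⟩
    z * 0#        ≈⟨ zeroʳ z ⟩
    0#            ∎

  0≤x*y⇒0≤y : ∀ {x y} → 0# < x → 0# ≤ x * y → 0# ≤ y
  0≤x*y⇒0≤y {x} {y} 0<x 0≤xy = case K.total 0# y of λ where
    (inj₁ 0≤y) → 0≤y
    (inj₂ y≤0) → K.≤-reflexive (K.sym (x*y≈0⇒y≈0 (0<x⇒x≉0 0<x) (0≤x∧0≤-x⇒x≈0 0≤xy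
      (0≤-resp-≈ (solve 2 (λ x y → x :* :- y := :- (x :* y)) K.refl x y) (*-nonNegative (proj₁ 0<x) (0≤-x y≤0))))))

  0<x*y : ∀ {x y} → 0# < x → 0# < y → 0# < x * y
  0<x*y 0<x 0<y = *-nonNegative (proj₁ 0<x) (proj₁ 0<y) , λ 0≈xy →
    0<x⇒x≉0 0<y (x*y≈0⇒y≈0 (0<x⇒x≉0 0<x) (K.sym 0≈xy))

  positive-inverse : ∀ {x} → 0# < x → ∃ λ y → 0# < y × x * y ≈ 1#
  positive-inverse {x} 0<x = let y , xy≈1 = inverse x (0<x⇒x≉0 0<x) in
    y , (0≤x*y⇒0≤y 0<x (0≤-resp-≈ (K.sym xy≈1) 0≤1) ,
         λ 0≈y → 0≉1 (K.trans (K.sym (zeroʳ x)) (K.trans (*-congˡ 0≈y) xy≈1))) , xy≈1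

  -- The solution is δ = ε / (1 + x), with 1 + x invertible because it is positive. All small
  -- constants below come from here: 1/2 from x = 1, 1/3 from x = 2, and the weights and steps used
  -- for faces.
  fraction : ∀ {x ε} → 0# ≤ x → 0# < ε → ∃ λ δ → 0# < δ × δ + x * δ ≈ ε
  fraction {x} {ε} 0≤x 0<ε = let y , 0<y , xy≈1 = positive-inverse (0<x+y 0<1 0≤x) in
    ε * y , 0<x*y 0<ε 0<y , (begin
      ε * y + x * (ε * y)        ≈⟨ +-congʳ (*-identityˡ _) ⟨
      1# * (ε * y) + x * (ε * y) ≈⟨ solve 4 (λ o x ε y → o :* (ε :* y) :+ x :* (ε :* y) := ε :* ((o :+ x) :* y)) K.refl 1# x ε y ⟩
      ε * ((1# + x) * y)         ≈⟨ *-congˡ xy≈1 ⟩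
      ε * 1#                     ≈⟨ *-identityʳ ε ⟩
      ε                          ∎)

  half : ∃ λ δ → 0# < δ × δ + δ ≈ 1#
  half = let δ , 0<δ , eq = fraction 0≤1 0<1 in δ , 0<δ , K.trans (+-congˡ (K.sym (*-identityˡ δ))) eq

  third : ∃ λ δ → 0# < δ × δ + (δ + δ) ≈ 1#
  third = let δ , 0<δ , eq = fraction (0≤x+y 0≤1 0≤1) 0<1 in δ , 0<δ , K.trans
    (+-congˡ (K.sym (K.trans (distribʳ δ 1# 1#) (+-cong (*-identityˡ δ) (*-identityˡ δ))))) eq

  fromℤ-0≤ : ∀ {i} → 0ℤ ℤ.≤ i → 0# ≤ fromℤ i
  fromℤ-0≤ {+ zero}  _ = K.≤-refl
  fromℤ-0≤ {+ suc n} _ = 0≤x+y 0≤1 (fromℤ-0≤ {+ n} (ℤ.+≤+ z≤n))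
  fromℤ-0≤ { -[1+ n ]} ()

  fromℤ-0< : ∀ {i} → 0ℤ ℤ.< i → 0# < fromℤ i
  fromℤ-0< {+ zero}  (ℤ.+<+ ())
  fromℤ-0< {+ suc n} _ = 0<x+y 0<1 (fromℤ-0≤ {+ n} (ℤ.+≤+ z≤n))

  -- Integrality replaces a minimum over finitely many positive slacks: 1 is a lower bound for all
  -- of them.
  fromℤ-0≤i-1 : ∀ {i} → 0ℤ ℤ.≤ i → i ≢ 0ℤ → 0# ≤ fromℤ i - 1#
  fromℤ-0≤i-1 {i} 0≤i i≢0 = 0≤-resp-≈ (K.trans (fromℤ-minus i 1ℤ) (+-congˡ (-‿cong fromℤ-1)))
    (fromℤ-0≤ (ℤ.i≤j⇒0≤j-i (ℤ.i<j⇒suc[i]≤j (ℤ.≤∧≢⇒< 0≤i (i≢0 ∘ sym)))))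

  fromℤ-injective : ∀ {i j} → fromℤ i ≈ fromℤ j → i ≡ j
  fromℤ-injective {i} {j} eq = ℤ.i-j≡0⇒i≡j i j (kernel (i ℤ.- j) (begin
    fromℤ (i ℤ.- j)       ≈⟨ fromℤ-minus i j ⟩
    fromℤ i - fromℤ j     ≈⟨ +-congʳ eq ⟩
    fromℤ j - fromℤ j     ≈⟨ -‿inverseʳ _ ⟩
    0#                    ∎))
    where
    kernel : ∀ i → fromℤ i ≈ 0# → i ≡ 0ℤ
    kernel (+ zero)  _   = refl
    kernel (+ suc n) i≈0 = contradiction i≈0 (0<x⇒x≉0 (fromℤ-0< {+ suc n} (ℤ.+<+ (s≤s z≤n))))
    kernel -[1+ n ]  i≈0 = contradiction
      (K.trans (K.sym (-‿involutive _)) (K.trans (-‿cong i≈0) -0#≈0#))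
      (0<x⇒x≉0 (fromℤ-0< {+ suc n} (ℤ.+<+ (s≤s z≤n))))

  absoluteValue : ∀ x → ∃ λ y → 0# ≤ y × 0# ≤ y + x × 0# ≤ y - x
  absoluteValue x = case K.total 0# x of λ where
    (inj₁ 0≤x) → x , 0≤x , 0≤x+y 0≤x 0≤x , K.≤-reflexive (K.sym (-‿inverseʳ x))
    (inj₂ x≤0) → - x , 0≤-x x≤0 , K.≤-reflexive (K.sym (-‿inverseˡ x)) , 0≤x+y (0≤-x x≤0) (0≤-x x≤0)

  -- The sum of the absolute values of the coordinates serves as the bound.
  coordinateBound : ∀ {n} (v : Vector Carrier n) → ∃ λ M → 0# ≤ M × (∀ i → 0# ≤ M + v i × 0# ≤ M - v i)
  coordinateBound {zero}  v = 0# , K.≤-refl , λ ()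
  coordinateBound {suc n} v =
    let M , 0≤M , v≤M = coordinateBound (tail v)
        y , 0≤y , 0≤y+v , 0≤y-v = absoluteValue (v zero)
    in y + M , 0≤x+y 0≤y 0≤M , λ where
    zero    → 0≤-resp-≈ (solve 3 (λ y M x → M :+ (y :+ x) := y :+ M :+ x) K.refl y M (v zero)) (0≤x+y 0≤M 0≤y+v) ,
              0≤-resp-≈ (solve 3 (λ y M x → M :+ (y :- x) := y :+ M :- x) K.refl y M (v zero)) (0≤x+y 0≤M 0≤y-v)
    (suc i) → 0≤-resp-≈ (K.sym (+-assoc y M (v (suc i)))) (0≤x+y 0≤y (proj₁ (v≤M i))) ,
              0≤-resp-≈ (K.sym (+-assoc y M (- v (suc i)))) (0≤x+y 0≤y (proj₂ (v≤M i)))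

-- Faces of the group cone

module Faces {ℓ : Level} (K : OrderedField ℓ) where
  open OrderedField K hiding (refl; sym; trans; reflexive; zero)
  open OrderedFieldProperties K
  open Solver using (solve; _:=_; _:+_; _:*_; _:-_; :-_; con)
  open import Relation.Binary.Reasoning.Setoid setoid

  infix 4 _≋_
  _≋_ : ∀ {n} → Point K n → Point K n → Set ℓ
  x ≋ y = ∀ i → x i ≈ y i

  module _ {n : ℕ} {C F : Region K n} (isFace : IsFace K C F) where
    open IsFace isFace

    -- A region is a bare predicate, but the `≈` inside `convex` makes a face invariant under `≈`:
    -- take the weights 0 and 1.
    face-resp-≋ : ∀ {x y} → x ∈ F → y ≋ x → y ∈ F
    face-resp-≋ {x} {y} x∈F y≋x = convex x∈F x∈F K.≤-refl 0≤1 (+-identityˡ 1#) λ i → begin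
      y i                   ≈⟨ y≋x i ⟩
      x i                   ≈⟨ *-identityˡ _ ⟨
      1# * x i              ≈⟨ solve 2 (λ o x → o :* x := con 0ℤ :* x :+ o :* x) K.refl 1# (x i) ⟩
      0# * x i + 1# * x i   ∎

    isFace-resp-≐ : ∀ {G} → F ≐ G → IsFace K C G
    isFace-resp-≐ (F⊆G , G⊆F) = record
      { subset  = λ x∈G → subset (G⊆F x∈G)
      ; convex  = λ x∈G y∈G 0≤s 0≤t s+t≈1 z≈ → F⊆G (convex (G⊆F x∈G) (G⊆F y∈G) 0≤s 0≤t s+t≈1 z≈)
      ; extreme = λ x∈C y∈C 0<s 0<t s+t≈1 z≈ z∈G →
          let x∈F , y∈F = extreme x∈C y∈C 0<s 0<t s+t≈1 z≈ (G⊆F z∈G) in F⊆G x∈F , F⊆G y∈F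
      }

    module _ (scaling : ∀ {c x} → 0# ≤ c → x ∈ C → (λ i → c * x i) ∈ C) where

      private
        -- The point x is the combination of (2 + c)x and 0 with weights μ = 1/(2 + c) and (1 + c)μ,
        -- so extremeness puts both ends into F. The factor 2 + c, rather than 1 + c, keeps the
        -- second weight positive at c = 0.
        stretch : ∀ {x c} → 0# ≤ c → x ∈ F → (λ i → (1# + 1# + c) * x i) ∈ F × (λ i → 0# * x i) ∈ F
        stretch {x} {c} 0≤c x∈F = let μ , 0<μ , eq = fraction (0≤x+y 0≤1 0≤c) 0<1 in
          extreme (scaling (0≤x+y (0≤x+y 0≤1 0≤1) 0≤c) (subset x∈F)) (scaling K.≤-refl (subset x∈F))
            0<μ (0<x*y (0<x+y 0<1 0≤c) 0<μ) eq (λ i → begin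
              x i                                     ≈⟨ *-identityˡ (x i) ⟨
              1# * x i                                ≈⟨ *-congʳ eq ⟨
              (μ + (1# + c) * μ) * x i                ≈⟨ *-congʳ (+-congʳ (*-identityˡ μ)) ⟨
              (1# * μ + (1# + c) * μ) * x i
                ≈⟨ solve 4 (λ o c μ x → (o :* μ :+ (o :+ c) :* μ) :* x :=
                     μ :* ((o :+ o :+ c) :* x) :+ (o :+ c) :* μ :* (con 0ℤ :* x)) K.refl 1# c μ (x i) ⟩
              μ * ((1# + 1# + c) * x i) + (1# + c) * μ * (0# * x i) ∎) x∈F

      -- The point cx lies between the two ends found by `stretch`, with weights cμ and 2μ, so
      -- convexity applies.
      face-scaling : ∀ {c x} → 0# ≤ c → x ∈ F → (λ i → c * x i) ∈ F
      face-scaling {c} {x} 0≤c x∈F =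
        let μ , 0<μ , eq       = fraction (0≤x+y 0≤1 0≤c) 0<1
            stretched , origin = stretch 0≤c x∈F
        in
        convex stretched origin (*-nonNegative 0≤c (proj₁ 0<μ)) (0≤x+y (proj₁ 0<μ) (proj₁ 0<μ)) (begin
          c * μ + (μ + μ)          ≈⟨ +-congˡ (+-congˡ (*-identityˡ μ)) ⟨
          c * μ + (μ + 1# * μ)     ≈⟨ solve 3 (λ o c μ → c :* μ :+ (μ :+ o :* μ) := μ :+ (o :+ c) :* μ) K.refl 1# c μ ⟩
          μ + (1# + c) * μ         ≈⟨ eq ⟩
          1#                       ∎) λ i → begin
            c * x i                                 ≈⟨ *-identityˡ _ ⟨
            1# * (c * x i)                          ≈⟨ *-congʳ eq ⟨
            (μ + (1# + c) * μ) * (c * x i)          ≈⟨ *-congʳ (+-congʳ (*-identityˡ μ)) ⟨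
            (1# * μ + (1# + c) * μ) * (c * x i)
              ≈⟨ solve 4 (λ o c μ x → (o :* μ :+ (o :+ c) :* μ) :* (c :* x) :=
                   c :* μ :* ((o :+ o :+ c) :* x) :+ (μ :+ μ) :* (con 0ℤ :* x)) K.refl 1# c μ (x i) ⟩
            c * μ * ((1# + 1# + c) * x i) + (μ + μ) * (0# * x i) ∎

      -- The sum x + y is the midpoint of 2x and 2y; extremeness gives 2x, and halving gives x.
      face-summand : ∀ {x y z} → x ∈ C → y ∈ C → z ∈ F → (∀ i → z i ≈ x i + y i) → x ∈ F
      face-summand {x} {y} {z} x∈C y∈C z∈F z≈x+y = let μ , 0<μ , eq = half in
        face-resp-≋ (face-scaling (proj₁ 0<μ) (proj₁ (extreme (scaling 0≤2 x∈C) (scaling 0≤2 y∈C) 0<μ 0<μ eq (λ i → begin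
          z i                                       ≈⟨ z≈x+y i ⟩
          x i + y i                                 ≈⟨ +-cong (halve eq (x i)) (halve eq (y i)) ⟩
          μ * ((1# + 1#) * x i) + μ * ((1# + 1#) * y i) ∎) z∈F))) (λ i → halve eq (x i))
        where
        0≤2 : 0# ≤ 1# + 1#
        0≤2 = 0≤x+y 0≤1 0≤1
        halve : ∀ {μ} → μ + μ ≈ 1# → ∀ x → x ≈ μ * ((1# + 1#) * x)
        halve {μ} eq x = begin
          x                        ≈⟨ *-identityˡ x ⟨
          1# * x                   ≈⟨ *-identityˡ _ ⟨
          1# * (1# * x)            ≈⟨ *-congʳ eq ⟨
          (μ + μ) * (1# * x)       ≈⟨ solve 3 (λ o μ x → (μ :+ μ) :* (o :* x) := μ :* ((o :+ o) :* x)) K.refl 1# μ x ⟩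
          μ * ((1# + 1#) * x)      ∎

  module _ {m : ℕ} where

    private
      C : Region K (pred m)
      C = GroupCone K m

      Sum : (i j l : Fin (pred m)) → Set
      Sum = ResidueSum m

    slack : Point K (pred m) → (i j l : Fin (pred m)) → Carrier
    slack x i j l = x i + x j - x l

    slack-linear : ∀ {x y z s t} → (∀ i → z i ≈ s * x i + t * y i) → ∀ i j l →
                   slack z i j l ≈ s * slack x i j l + t * slack y i j l
    slack-linear {x} {y} {z} {s} {t} z≈ i j l = begin
      z i + z j - z l
        ≈⟨ +-cong (+-cong (z≈ i) (z≈ j)) (-‿cong (z≈ l)) ⟩
      s * x i + t * y i + (s * x j + t * y j) - (s * x l + t * y l)
        ≈⟨ solve 8 (λ s t x x′ x″ y y′ y″ →
             s :* x :+ t :* y :+ (s :* x′ :+ t :* y′) :- (s :* x″ :+ t :* y″) :=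
             s :* (x :+ x′ :- x″) :+ t :* (y :+ y′ :- y″)) K.refl s t (x i) (x j) (x l) (y i) (y j) (y l) ⟩
      s * slack x i j l + t * slack y i j l ∎

    cone⇒slack : ∀ {x} → x ∈ C → ∀ {i j l} → Sum i j l → 0# ≤ slack x i j l
    cone⇒slack x∈C {i} {j} {l} i+j≡l = x≤y⇒0≤y-x (x∈C i j l i+j≡l)

    slack⇒cone : ∀ {x} → (∀ {i j l} → Sum i j l → 0# ≤ slack x i j l) → x ∈ C
    slack⇒cone 0≤slack i j l i+j≡l = 0≤y-x⇒x≤y (0≤slack i+j≡l)

    cone-scaling : ∀ {c x} → 0# ≤ c → x ∈ C → (λ i → c * x i) ∈ C
    cone-scaling {c} {x} 0≤c x∈C = slack⇒cone λ {i} {j} {l} i+j≡l →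
      0≤-resp-≈ (solve 4 (λ c x x′ x″ → c :* (x :+ x′ :- x″) := c :* x :+ c :* x′ :- c :* x″) K.refl c (x i) (x j) (x l))
        (*-nonNegative 0≤c (cone⇒slack x∈C i+j≡l))

    slack-embed : ∀ w i j l → slack (embed K w) i j l ≈ fromℤ (intSlack w i j l)
    slack-embed w i j l = K.sym (K.trans (fromℤ-minus (w i ℤ.+ w j) (w l)) (+-congʳ (fromℤ-+ (w i) (w j))))

    embed-cone : ∀ {w} → IntCone m w → embed K w ∈ C
    embed-cone {w} w∈ = slack⇒cone λ {i} {j} {l} i+j≡l →
      0≤-resp-≈ (K.sym (slack-embed w i j l)) (fromℤ-0≤ (w∈ i+j≡l))

    -- Tightness is tested on the integer slacks of w, where equality is decidable and a nonzero
    -- value is at least 1.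
    MinimalFace : Vector ℤ (pred m) → Region K (pred m)
    MinimalFace w x = x ∈ C × (∀ {i j l} → Sum i j l → intSlack w i j l ≡ 0ℤ → slack x i j l ≈ 0#)

    module _ {w : Vector ℤ (pred m)} (w∈ : IntCone m w) where

      minimalFace-isFace : IsFace K C (MinimalFace w)
      minimalFace-isFace = record
        { subset  = proj₁
        ; convex  = λ {x} {y} {z} {s} {t} (x∈C , x-tight) (y∈C , y-tight) 0≤s 0≤t s+t≈1 z≈ →
            slack⇒cone (λ {i} {j} {l} i+j≡l → 0≤-resp-≈ (K.sym (slack-linear z≈ i j l))
              (0≤x+y (*-nonNegative 0≤s (cone⇒slack x∈C i+j≡l)) (*-nonNegative 0≤t (cone⇒slack y∈C i+j≡l)))) ,
            λ {i} {j} {l} i+j≡l tight → begin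
              slack z i j l                          ≈⟨ slack-linear z≈ i j l ⟩
              s * slack x i j l + t * slack y i j l  ≈⟨ +-cong (*-congˡ (x-tight i+j≡l tight)) (*-congˡ (y-tight i+j≡l tight)) ⟩
              s * 0# + t * 0#                        ≈⟨ +-cong (zeroʳ s) (zeroʳ t) ⟩
              0# + 0#                                ≈⟨ +-identityˡ 0# ⟩
              0#                                     ∎
        ; extreme = λ {x} {y} {z} {s} {t} x∈C y∈C 0<s 0<t s+t≈1 z≈ (z∈C , z-tight) →
            let combination≈0 : ∀ {i j l} → Sum i j l → intSlack w i j l ≡ 0ℤ →
                                s * slack x i j l + t * slack y i j l ≈ 0#
                combination≈0 {i} {j} {l} i+j≡l tight = K.trans (K.sym (slack-linear z≈ i j l)) (z-tight i+j≡l tight)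
            in (x∈C , λ i+j≡l tight → x*y≈0⇒y≈0 (0<x⇒x≉0 0<s)
                 (x+y≈0⇒x≈0 (*-nonNegative (proj₁ 0<s) (cone⇒slack x∈C i+j≡l)) (*-nonNegative (proj₁ 0<t) (cone⇒slack y∈C i+j≡l))
                   (combination≈0 i+j≡l tight))) ,
               (y∈C , λ i+j≡l tight → x*y≈0⇒y≈0 (0<x⇒x≉0 0<t)
                 (x+y≈0⇒x≈0 (*-nonNegative (proj₁ 0<t) (cone⇒slack y∈C i+j≡l)) (*-nonNegative (proj₁ 0<s) (cone⇒slack x∈C i+j≡l))
                   (K.trans (+-comm _ _) (combination≈0 i+j≡l tight))))
        }

      -- The tight equalities are linear and homogeneous, so they survive every linear combination.
      affineHull-tight : ∀ {y} → y ∈ AffineHull K (MinimalFace w) →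
                         ∀ {i j l} → Sum i j l → intSlack w i j l ≡ 0ℤ → slack y i j l ≈ 0#
      affineHull-tight {y} (p , c , x , x∈ , _ , y≈) {i} {j} {l} i+j≡l tight =
        K.trans (+-cong (+-cong (y≈ i) (y≈ j)) (-‿cong (y≈ l))) (sum-slack c x (λ q → proj₂ (x∈ q) i+j≡l tight))
        where
        sum-slack : ∀ {p} (c : Vector Carrier p) (x : Vector (Point K (pred m)) p) → (∀ q → slack (x q) i j l ≈ 0#) →
                    sum (λ q → c q * x q i) + sum (λ q → c q * x q j) - sum (λ q → c q * x q l) ≈ 0#
        sum-slack {zero}  c x slack≈0 = solve 0 (con 0ℤ :+ con 0ℤ :- con 0ℤ := con 0ℤ) K.refl
        sum-slack {suc p} c x slack≈0 = begin
          c zero * x zero i + Σ i + (c zero * x zero j + Σ j) - (c zero * x zero l + Σ l)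
            ≈⟨ solve 7 (λ c x x′ x″ a b d → c :* x :+ a :+ (c :* x′ :+ b) :- (c :* x″ :+ d) :=
                 c :* (x :+ x′ :- x″) :+ (a :+ b :- d)) K.refl (c zero) (x zero i) (x zero j) (x zero l) (Σ i) (Σ j) (Σ l) ⟩
          c zero * slack (x zero) i j l + (Σ i + Σ j - Σ l)
            ≈⟨ +-cong (K.trans (*-congˡ (slack≈0 zero)) (zeroʳ _)) (sum-slack (tail c) (tail x) (slack≈0 ∘ suc)) ⟩
          0# + 0#
            ≈⟨ +-identityˡ 0# ⟩
          0# ∎
          where
          Σ : Fin (pred m) → Carrier
          Σ i = sum (λ q → c (suc q) * x (suc q) i)

      -- A nonzero slack of w is an integer, hence at least 1, so it survives a perturbation by less than 1/3
      -- in each of its three coordinates.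
      minimalFace-interior : embed K w ∈ RelativeInterior K (MinimalFace w)
      minimalFace-interior = let ε , 0<ε , 3ε≈1 = third in
        (embed-cone {w} (λ {i} {j} {l} → w∈ {i} {j} {l}) , λ {i} {j} {l} _ tight → K.trans (slack-embed w i j l) (K.reflexive (cong fromℤ tight))) ,
        ε , 0<ε , λ y y∈hull close → slack⇒cone (λ {i} {j} {l} i+j≡l → case intSlack w i j l ℤ.≟ 0ℤ of λ where
          (yes tight) → K.≤-reflexive (K.sym (affineHull-tight y∈hull i+j≡l tight))
          (no loose)  → 0≤-resp-≈ (perturb 3ε≈1 y i j l)
            (0≤x+y (fromℤ-0≤i-1 (w∈ i+j≡l) loose)
              (0≤x+y (0≤x+y (x≤y⇒0≤y-x (proj₁ (proj₁ (close i)))) (x≤y⇒0≤y-x (proj₁ (proj₁ (close j)))))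
                (x≤y⇒0≤y-x (proj₁ (proj₂ (close l))))))) ,
          affineHull-tight y∈hull
        where
        perturb : ∀ {ε} → ε + (ε + ε) ≈ 1# → ∀ y i j l →
          fromℤ (intSlack w i j l) - 1#
            + ((y i - (embed K w i - ε)) + (y j - (embed K w j - ε)) + (embed K w l + ε - y l)) ≈ slack y i j l
        perturb {ε} 3ε≈1 y i j l = begin
          fromℤ (intSlack w i j l) - 1#
            + ((y i - (embed K w i - ε)) + (y j - (embed K w j - ε)) + (embed K w l + ε - y l))
            ≈⟨ +-congʳ (+-cong (K.sym (slack-embed w i j l)) (-‿cong (K.sym 3ε≈1))) ⟩
          slack (embed K w) i j l - (ε + (ε + ε))
            + ((y i - (embed K w i - ε)) + (y j - (embed K w j - ε)) + (embed K w l + ε - y l))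
            ≈⟨ solve 7 (λ ε x x′ x″ y y′ y″ → x :+ x′ :- x″ :- (ε :+ (ε :+ ε))
                 :+ ((y :- (x :- ε)) :+ (y′ :- (x′ :- ε)) :+ (x″ :+ ε :- y″)) := y :+ y′ :- y″) K.refl
                 ε (embed K w i) (embed K w j) (embed K w l) (y i) (y j) (y l) ⟩
          slack y i j l ∎

      module _ {F : Region K (pred m)} (isFace : IsFace K C F) (interior : embed K w ∈ RelativeInterior K F) where

        -- Continue the segment from y through w slightly past w, to (1 + δ)w - δy. This point is
        -- still in F, since w is relatively interior. At an inequality tight at w its slack is -δ
        -- times the slack of y, and both slacks are nonnegative, so that of y vanishes.
        face⊆minimalFace : F ⊆ MinimalFace w
        face⊆minimalFace {y} y∈F =
          let w∈F , ε , 0<ε , ball = interior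
              M , 0≤M , bound      = coordinateBound (λ i → embed K w i - y i)
              -- The displacement δ(w - y) has coordinates of size at most δM; the extra δ makes the
              -- distance strictly less than ε.
              δ , 0<δ , δ+Mδ≈ε     = fraction 0≤M 0<ε
          in IsFace.subset isFace y∈F , tight 0<δ (ball (beyond δ) (beyond∈hull δ w∈F) (λ i →
               0<y-x⇒x<y (0<-resp-≈ (K.sym (lower δ+Mδ≈ε i)) (0<x+y 0<δ (*-nonNegative (proj₁ 0<δ) (proj₁ (bound i))))) ,
               0<y-x⇒x<y (0<-resp-≈ (K.sym (upper δ+Mδ≈ε i)) (0<x+y 0<δ (*-nonNegative (proj₁ 0<δ) (proj₂ (bound i)))))))
          where
          beyond : Carrier → Point K (pred m)
          beyond δ i = (1# + δ) * embed K w i + - δ * y i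

          beyond∈hull : ∀ δ → embed K w ∈ F → beyond δ ∈ AffineHull K F
          beyond∈hull δ w∈F = 2 , (1# + δ) ∷ (- δ) ∷ [] , embed K w ∷ y ∷ [] ,
            (λ { zero → w∈F ; (suc zero) → y∈F }) ,
            solve 2 (λ o δ → o :+ δ :+ (:- δ :+ con 0ℤ) := o) K.refl 1# δ ,
            (λ i → +-congˡ (K.sym (+-identityʳ _)))

          lower : ∀ {δ M ε} → δ + M * δ ≈ ε → ∀ i →
                  beyond δ i - (embed K w i - ε) ≈ δ + δ * (M + (embed K w i - y i))
          lower {δ} {M} {ε} eq i = begin
            beyond δ i - (embed K w i - ε)
              ≈⟨ +-congˡ (-‿cong (+-cong (K.sym (*-identityˡ _)) (-‿cong (K.sym eq)))) ⟩
            beyond δ i - (1# * embed K w i - (δ + M * δ))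
              ≈⟨ solve 5 (λ o δ M w y → (o :+ δ) :* w :+ :- δ :* y :- (o :* w :- (δ :+ M :* δ)) :=
                   δ :+ δ :* (M :+ (w :- y))) K.refl 1# δ M (embed K w i) (y i) ⟩
            δ + δ * (M + (embed K w i - y i)) ∎

          upper : ∀ {δ M ε} → δ + M * δ ≈ ε → ∀ i →
                  embed K w i + ε - beyond δ i ≈ δ + δ * (M - (embed K w i - y i))
          upper {δ} {M} {ε} eq i = begin
            embed K w i + ε - beyond δ i
              ≈⟨ +-congʳ (+-cong (K.sym (*-identityˡ _)) (K.sym eq)) ⟩
            1# * embed K w i + (δ + M * δ) - beyond δ i
              ≈⟨ solve 5 (λ o δ M w y → o :* w :+ (δ :+ M :* δ) :- ((o :+ δ) :* w :+ :- δ :* y) :=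
                   δ :+ δ :* (M :- (w :- y))) K.refl 1# δ M (embed K w i) (y i) ⟩
            δ + δ * (M - (embed K w i - y i)) ∎

          tight : ∀ {δ} → 0# < δ → beyond δ ∈ F →
                  ∀ {i j l} → Sum i j l → intSlack w i j l ≡ 0ℤ → slack y i j l ≈ 0#
          tight {δ} 0<δ beyond∈F {i} {j} {l} i+j≡l w-tight = x*y≈0⇒y≈0 (0<x⇒x≉0 0<δ) (0≤x∧0≤-x⇒x≈0
            (*-nonNegative (proj₁ 0<δ) (cone⇒slack (IsFace.subset isFace y∈F) i+j≡l))
            (0≤-resp-≈ (begin
              slack (beyond δ) i j l
                ≈⟨ slack-linear (λ _ → K.refl) i j l ⟩
              (1# + δ) * slack (embed K w) i j l + - δ * slack y i j l
                ≈⟨ +-congʳ (*-congˡ (K.trans (slack-embed w i j l) (K.reflexive (cong fromℤ w-tight)))) ⟩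
              (1# + δ) * 0# + - δ * slack y i j l
                ≈⟨ solve 3 (λ o δ s → (o :+ δ) :* con 0ℤ :+ :- δ :* s := :- (δ :* s)) K.refl 1# δ (slack y i j l) ⟩
              - (δ * slack y i j l) ∎) (cone⇒slack (IsFace.subset isFace beyond∈F) i+j≡l)))

        -- Split 3Mw = x + (3Mw - x), where M bounds the coordinates of x. Both summands are in the
        -- cone: where w is tight so is x, and elsewhere the slack of 3Mw is at least 3M while that
        -- of x, made of three coordinates, is at most 3M. As 3Mw lies in F, so does its summand x.
        minimalFace⊆face : MinimalFace w ⊆ F
        minimalFace⊆face {x} (x∈C , x-tight) =
          let w∈F , _         = interior
              M , 0≤M , bound = coordinateBound x
          in face-summand isFace cone-scaling x∈C (rest∈C 0≤M bound)
               (face-scaling isFace cone-scaling (0≤x+y (0≤x+y 0≤M 0≤M) 0≤M) w∈F)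
               (λ i → solve 2 (λ y x → y := x :+ (y :- x)) K.refl _ (x i))
          where
          rest-slack : ∀ M i j l → slack (λ i → (M + M + M) * embed K w i - x i) i j l ≈
                       (M + M + M) * slack (embed K w) i j l - slack x i j l
          rest-slack M i j l = solve 7 (λ T w w′ w″ x x′ x″ →
            (T :* w :- x) :+ (T :* w′ :- x′) :- (T :* w″ :- x″) := T :* (w :+ w′ :- w″) :- (x :+ x′ :- x″)) K.refl
            (M + M + M) (embed K w i) (embed K w j) (embed K w l) (x i) (x j) (x l)

          rest∈C : ∀ {M} → 0# ≤ M → (∀ i → 0# ≤ M + x i × 0# ≤ M - x i) →
                   (λ i → (M + M + M) * embed K w i - x i) ∈ C
          rest∈C {M} 0≤M bound = slack⇒cone λ {i} {j} {l} i+j≡l → case intSlack w i j l ℤ.≟ 0ℤ of λ where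
            (yes tight) → K.≤-reflexive (K.sym (begin
              slack (λ i → (M + M + M) * embed K w i - x i) i j l
                ≈⟨ rest-slack M i j l ⟩
              (M + M + M) * slack (embed K w) i j l - slack x i j l
                ≈⟨ +-cong (*-congˡ (K.trans (slack-embed w i j l) (K.reflexive (cong fromℤ tight)))) (-‿cong (x-tight i+j≡l tight)) ⟩
              (M + M + M) * 0# - 0#
                ≈⟨ solve 1 (λ M → M :* con 0ℤ :- con 0ℤ := con 0ℤ) K.refl (M + M + M) ⟩
              0# ∎))
            (no loose) → 0≤-resp-≈ (begin
              (M + M + M) * (fromℤ (intSlack w i j l) - 1#) + ((M - x i) + (M - x j) + (M + x l))
                ≈⟨ +-congʳ (*-congˡ (+-congʳ (slack-embed w i j l))) ⟨
              (M + M + M) * (slack (embed K w) i j l - 1#) + ((M - x i) + (M - x j) + (M + x l))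
                ≈⟨ solve 6 (λ M o s x x′ x″ →
                     (M :+ M :+ M) :* (s :- o) :+ ((M :- x) :+ (M :- x′) :+ (M :+ x″)) :=
                     (M :+ M :+ M) :* s :- (x :+ x′ :- x″) :+ (M :+ M :+ M :- (M :+ M :+ M) :* o)) K.refl
                     M 1# (slack (embed K w) i j l) (x i) (x j) (x l) ⟩
              (M + M + M) * slack (embed K w) i j l - slack x i j l + (M + M + M - (M + M + M) * 1#)
                ≈⟨ +-congˡ (K.trans (+-congˡ (-‿cong (*-identityʳ _))) (-‿inverseʳ _)) ⟩
              (M + M + M) * slack (embed K w) i j l - slack x i j l + 0#
                ≈⟨ +-identityʳ _ ⟩
              (M + M + M) * slack (embed K w) i j l - slack x i j l
                ≈⟨ rest-slack M i j l ⟨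
              slack (λ i → (M + M + M) * embed K w i - x i) i j l ∎)
              (0≤x+y (*-nonNegative (0≤x+y (0≤x+y 0≤M 0≤M) 0≤M) (fromℤ-0≤i-1 (w∈ i+j≡l) loose))
                (0≤x+y (0≤x+y (proj₂ (bound i)) (proj₂ (bound j))) (proj₁ (bound l))))

        face≐minimalFace : F ≐ MinimalFace w
        face≐minimalFace = face⊆minimalFace , minimalFace⊆face

  -- Two-dimensional cones and their extremal rays

  ≐-sym : ∀ {n} {F G : Region K n} → F ≐ G → G ≐ F
  ≐-sym (F⊆G , G⊆F) = G⊆F , F⊆G

  ≐-trans : ∀ {n} {F G H : Region K n} → F ≐ G → G ≐ H → F ≐ H
  ≐-trans (F⊆G , G⊆F) (G⊆H , H⊆G) = (λ x∈F → G⊆H (F⊆G x∈F)) , (λ x∈H → G⊆F (H⊆G x∈H))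

  Cone₂ : ∀ {n} → Point K n → Point K n → Region K n
  Cone₂ u v x = ∃₂ λ α β → 0# ≤ α × 0# ≤ β × (∀ i → x i ≈ α * u i + β * v i)

  Independent : ∀ {n} → Point K n → Point K n → Set ℓ
  Independent u v = ∀ α β → (∀ i → α * u i + β * v i ≈ 0#) → α ≈ 0# × β ≈ 0#

  module _ {n} {u v : Point K n} where

    cone₂-swap : Cone₂ u v ⊆ Cone₂ v u
    cone₂-swap (α , β , 0≤α , 0≤β , x≈) = β , α , 0≤β , 0≤α , λ i → K.trans (x≈ i) (+-comm _ _)

    independent-swap : Independent u v → Independent v u
    independent-swap indep α β eq = let β≈0 , α≈0 = indep β α (λ i → K.trans (+-comm _ _) (eq i)) in α≈0 , β≈0

    cone₂-scaling : ∀ {c x} → 0# ≤ c → x ∈ Cone₂ u v → (λ i → c * x i) ∈ Cone₂ u v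
    cone₂-scaling {c} 0≤c (α , β , 0≤α , 0≤β , x≈) =
      c * α , c * β , *-nonNegative 0≤c 0≤α , *-nonNegative 0≤c 0≤β , λ i → K.trans (*-congˡ (x≈ i))
        (solve 5 (λ c α β u v → c :* (α :* u :+ β :* v) := c :* α :* u :+ c :* β :* v) K.refl c α β (u i) (v i))

    rescaled-ray : ∀ {α} → 0# < α → (∀ i → v i ≈ α * u i) → Ray K v ≐ Ray K u
    rescaled-ray {α} 0<α v≈αu =
      (λ (c , 0≤c , x≈) → c * α , *-nonNegative 0≤c (proj₁ 0<α) , λ i →
        K.trans (x≈ i) (K.trans (*-congˡ (v≈αu i)) (K.sym (*-assoc c α (u i))))) ,
      (λ {x} (c , 0≤c , x≈) → let γ , 0<γ , αγ≈1 = positive-inverse 0<α in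
        c * γ , *-nonNegative 0≤c (proj₁ 0<γ) , λ i → begin
          x i                   ≈⟨ x≈ i ⟩
          c * u i               ≈⟨ *-identityˡ _ ⟨
          1# * (c * u i)        ≈⟨ *-congʳ αγ≈1 ⟨
          α * γ * (c * u i)     ≈⟨ solve 4 (λ α γ c u → α :* γ :* (c :* u) := c :* γ :* (α :* u)) K.refl α γ c (u i) ⟩
          c * γ * (α * u i)     ≈⟨ *-congˡ (v≈αu i) ⟨
          c * γ * v i           ∎)

    independent⇒nonzero : Independent u v → ¬ (∀ i → u i ≈ 0#)
    independent⇒nonzero indep u≈0 = 0≉1 (K.sym (proj₁ (indep 1# 0# λ i → begin
      1# * u i + 0# * v i   ≈⟨ +-congʳ (*-congˡ (u≈0 i)) ⟩
      1# * 0# + 0# * v i    ≈⟨ solve 2 (λ o v → o :* con 0ℤ :+ con 0ℤ :* v := con 0ℤ) K.refl 1# (v i) ⟩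
      0#                    ∎)))

    module _ {F : Region K n} (F≐cone : F ≐ Cone₂ u v) (indep : Independent u v) where

      private
        F⊆cone : F ⊆ Cone₂ u v
        F⊆cone = proj₁ F≐cone
        cone⊆F : Cone₂ u v ⊆ F
        cone⊆F = proj₂ F≐cone

      ray⊆face : Ray K u ⊆ F
      ray⊆face (c , 0≤c , x≈) = cone⊆F (c , 0# , 0≤c , K.≤-refl , λ i → K.trans (x≈ i)
        (solve 3 (λ c u v → c :* u := c :* u :+ con 0ℤ :* v) K.refl c (u i) (v i)))

      -- For extremeness, independence forces the v-coefficient sβ + tβ′ of a point of the ray to
      -- vanish; its terms are nonnegative and s, t positive, so β = β′ = 0.
      ray-isFace : IsFace K F (Ray K u)
      ray-isFace = record
        { subset  = ray⊆face
        ; convex  = λ {_} {_} {z} {s} {t} (c , 0≤c , x≈) (c′ , 0≤c′ , y≈) 0≤s 0≤t _ z≈ →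
            s * c + t * c′ , 0≤x+y (*-nonNegative 0≤s 0≤c) (*-nonNegative 0≤t 0≤c′) , λ i → K.trans (z≈ i)
              (K.trans (+-cong (*-congˡ (x≈ i)) (*-congˡ (y≈ i)))
                (solve 5 (λ s t c c′ u → s :* (c :* u) :+ t :* (c′ :* u) := (s :* c :+ t :* c′) :* u) K.refl s t c c′ (u i)))
        ; extreme = λ {x} {y} {z} {s} {t} x∈F y∈F 0<s 0<t _ z≈ (c , 0≤c , z≈cu) →
            let α , β , 0≤α , 0≤β , x≈     = F⊆cone x∈F
                α′ , β′ , 0≤α′ , 0≤β′ , y≈ = F⊆cone y∈F
                _ , sβ+tβ′≈0 = indep (s * α + t * α′ - c) (s * β + t * β′) λ i → begin
                  (s * α + t * α′ - c) * u i + (s * β + t * β′) * v i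
                    ≈⟨ solve 9 (λ s t α α′ β β′ c u v → (s :* α :+ t :* α′ :- c) :* u :+ (s :* β :+ t :* β′) :* v :=
                         s :* (α :* u :+ β :* v) :+ t :* (α′ :* u :+ β′ :* v) :- c :* u) K.refl s t α α′ β β′ c (u i) (v i) ⟩
                  s * (α * u i + β * v i) + t * (α′ * u i + β′ * v i) - c * u i
                    ≈⟨ +-cong (+-cong (*-congˡ (x≈ i)) (*-congˡ (y≈ i))) (-‿cong (z≈cu i)) ⟨
                  s * x i + t * y i - z i
                    ≈⟨ +-congʳ (z≈ i) ⟨
                  z i - z i
                    ≈⟨ -‿inverseʳ _ ⟩
                  0# ∎
                β≈0  = x*y≈0⇒y≈0 (0<x⇒x≉0 0<s) (x+y≈0⇒x≈0
                  (*-nonNegative (proj₁ 0<s) 0≤β) (*-nonNegative (proj₁ 0<t) 0≤β′) sβ+tβ′≈0)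
                β′≈0 = x*y≈0⇒y≈0 (0<x⇒x≉0 0<t) (x+y≈0⇒x≈0
                  (*-nonNegative (proj₁ 0<t) 0≤β′) (*-nonNegative (proj₁ 0<s) 0≤β) (K.trans (+-comm _ _) sβ+tβ′≈0))
            in (α , 0≤α , on-ray {x} x≈ β≈0) , (α′ , 0≤α′ , on-ray {y} y≈ β′≈0)
        }
        where
        on-ray : ∀ {x α β} → (∀ i → x i ≈ α * u i + β * v i) → β ≈ 0# → ∀ i → x i ≈ α * u i
        on-ray {x} {α} {β} x≈ β≈0 i = begin
          x i                      ≈⟨ x≈ i ⟩
          α * u i + β * v i        ≈⟨ +-congˡ (K.trans (*-congʳ β≈0) (zeroˡ _)) ⟩
          α * u i + 0#             ≈⟨ +-identityʳ _ ⟩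
          α * u i                  ∎

      ray-isExtremal : ∀ {G} → G ≐ Ray K u → IsExtremalRay K F G
      ray-isExtremal G≐ray = isFace-resp-≐ ray-isFace (≐-sym G≐ray) , u , independent⇒nonzero indep , G≐ray

  module _ {n} {u v : Point K n} {F : Region K n} (F≐cone : F ≐ Cone₂ u v) (indep : Independent u v) where

    private
      F≐swapped : F ≐ Cone₂ v u
      F≐swapped = ≐-trans F≐cone (cone₂-swap , cone₂-swap)

      scaling : ∀ {c x} → 0# ≤ c → x ∈ F → (λ i → c * x i) ∈ F
      scaling 0≤c x∈F = proj₂ F≐cone (cone₂-scaling 0≤c (proj₁ F≐cone x∈F))

    -- Let x = αu + βv span G. If α and β were both nonzero, then αu, being a summand of x, would
    -- lie in G, so αu = cx. Independence gives cβ = 0, hence c = 0, and then α = cα = 0.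
    extremal⇒ray : ∀ {G} → IsExtremalRay K F G → G ≐ Ray K u ⊎ G ≐ Ray K v
    extremal⇒ray {G} (isFace , x , x≉0 , G≐ray) = split (proj₁ F≐cone (IsFace.subset isFace x∈G))
      where
      x∈G : x ∈ G
      x∈G = proj₂ G≐ray (1# , 0≤1 , λ i → K.sym (*-identityˡ (x i)))

      split : x ∈ Cone₂ u v → G ≐ Ray K u ⊎ G ≐ Ray K v
      split (α , β , 0≤α , 0≤β , x≈) = cases (α K.≟ 0#) (β K.≟ 0#)
        where
        drop : ∀ {w w′ : Point K n} {α β} → (∀ i → x i ≈ α * w i + β * w′ i) → β ≈ 0# → ∀ i → x i ≈ α * w i
        drop x≈ β≈0 i = K.trans (x≈ i) (K.trans (+-congˡ (K.trans (*-congʳ β≈0) (zeroˡ _))) (+-identityʳ _))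

        cases : Dec (α ≈ 0#) → Dec (β ≈ 0#) → G ≐ Ray K u ⊎ G ≐ Ray K v
        cases (yes α≈0) (yes β≈0) = contradiction
          (λ i → K.trans (drop x≈ β≈0 i) (K.trans (*-congʳ α≈0) (zeroˡ _))) x≉0
        cases (no α≉0) (yes β≈0) = inj₁ (≐-trans G≐ray (rescaled-ray (0≤α , α≉0 ∘ K.sym) (drop x≈ β≈0)))
        cases (yes α≈0) (no β≉0) = inj₂ (≐-trans G≐ray (rescaled-ray (0≤β , β≉0 ∘ K.sym)
          (drop (λ i → K.trans (x≈ i) (+-comm _ _)) α≈0)))
        cases (no α≉0) (no β≉0) =
          let αu∈F = scaling 0≤α (ray⊆face F≐cone indep (1# , 0≤1 , λ i → K.sym (*-identityˡ (u i))))
              βv∈F = scaling 0≤β (ray⊆face F≐swapped (independent-swap indep) (1# , 0≤1 , λ i → K.sym (*-identityˡ (v i))))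
              c , _ , αu≈cx = proj₁ G≐ray (face-summand isFace scaling αu∈F βv∈F x∈G x≈)
              α-cα≈0 , cβ≈0 = indep (α - c * α) (- (β * c)) λ i → begin
                (α - c * α) * u i + - (β * c) * v i
                  ≈⟨ solve 5 (λ α β c u v → (α :- c :* α) :* u :+ :- (β :* c) :* v :=
                       α :* u :- c :* (α :* u :+ β :* v)) K.refl α β c (u i) (v i) ⟩
                α * u i - c * (α * u i + β * v i)
                  ≈⟨ +-congˡ (-‿cong (*-congˡ (x≈ i))) ⟨
                α * u i - c * x i
                  ≈⟨ +-congʳ (αu≈cx i) ⟩
                c * x i - c * x i
                  ≈⟨ -‿inverseʳ _ ⟩
                0# ∎
              c≈0 = x*y≈0⇒y≈0 β≉0 (K.trans (solve 1 (λ x → x := :- (:- x)) K.refl (β * c))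
                (K.trans (-‿cong cβ≈0) (solve 0 (:- con 0ℤ := con 0ℤ) K.refl)))
          in contradiction (begin
            α                      ≈⟨ solve 2 (λ α c → α := α :- c :* α :+ c :* α) K.refl α c ⟩
            α - c * α + c * α      ≈⟨ +-cong α-cα≈0 (K.trans (*-congʳ c≈0) (zeroˡ α)) ⟩
            0# + 0#                ≈⟨ +-identityˡ 0# ⟩
            0#                     ∎) α≉0

    extremalRays : ∀ G → IsExtremalRay K F G ⇔ (G ≐ Ray K u ⊎ G ≐ Ray K v)
    extremalRays G = mk⇔ extremal⇒ray λ where
      (inj₁ G≐u) → ray-isExtremal F≐cone indep G≐u
      (inj₂ G≐v) → ray-isExtremal F≐swapped (independent-swap indep) G≐v

  -- Since `u i₀` = 1, every point y of the affine hull of the ray is `y i₀` times u. Within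
  -- distance b of bu the coordinate `y i₀` stays positive.
  ray-interior : ∀ {n} {u : Vector ℤ n} {b i₀} → u i₀ ≡ 1ℤ → 0ℤ ℤ.< b →
                 embed K (λ i → b ℤ.* u i) ∈ RelativeInterior K (Ray K (embed K u))
  ray-interior {n} {u} {b} {i₀} ui₀≡1 0<b =
    (fromℤ b , proj₁ (fromℤ-0< 0<b) , λ i → fromℤ-* b (u i)) ,
    fromℤ b , fromℤ-0< 0<b , λ y (p , c , x , x∈ray , _ , y≈) close →
      y i₀ , K.≤-trans (K.≤-reflexive (K.sym (begin
          fromℤ (b ℤ.* u i₀) - fromℤ b    ≡⟨ cong (λ z → fromℤ z - fromℤ b) (trans (cong (b ℤ.*_) ui₀≡1) (ℤ.*-identityʳ b)) ⟩
          fromℤ b - fromℤ b               ≈⟨ -‿inverseʳ _ ⟩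
          0#                              ∎)))
        (proj₁ (proj₁ (close i₀))) , λ i → begin
          y i                                                ≈⟨ y≈ i ⟩
          sum (λ q → c q * x q i)                            ≈⟨ proportional c x (λ q → on-ray (x∈ray q)) i ⟩
          sum (λ q → c q * x q i₀) * fromℤ (u i)             ≈⟨ *-congʳ (y≈ i₀) ⟨
          y i₀ * fromℤ (u i)                                 ∎
    where
    on-ray : ∀ {x} → x ∈ Ray K (embed K u) → ∀ i → x i ≈ x i₀ * fromℤ (u i)
    on-ray {x} (c , _ , x≈) i = begin
      x i                                  ≈⟨ x≈ i ⟩
      c * fromℤ (u i)                      ≈⟨ *-congʳ (*-identityʳ c) ⟨
      c * 1# * fromℤ (u i)                 ≈⟨ *-congʳ (*-congˡ fromℤ-1) ⟨
      c * fromℤ 1ℤ * fromℤ (u i)           ≡⟨ cong (λ z → c * fromℤ z * fromℤ (u i)) ui₀≡1 ⟨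
      c * fromℤ (u i₀) * fromℤ (u i)       ≈⟨ *-congʳ (x≈ i₀) ⟨
      x i₀ * fromℤ (u i)                   ∎
    proportional : ∀ {p} (c : Vector Carrier p) (x : Vector (Point K n) p) →
      (∀ q i → x q i ≈ x q i₀ * fromℤ (u i)) →
      ∀ i → sum (λ q → c q * x q i) ≈ sum (λ q → c q * x q i₀) * fromℤ (u i)
    proportional {zero}  c x x≈ i = K.sym (zeroˡ _)
    proportional {suc p} c x x≈ i = begin
      c zero * x zero i + sum (λ q → c (suc q) * x (suc q) i)
        ≈⟨ +-cong (*-congˡ (x≈ zero i)) (proportional (tail c) (tail x) (x≈ ∘ suc) i) ⟩
      c zero * (x zero i₀ * fromℤ (u i)) + sum (λ q → c (suc q) * x (suc q) i₀) * fromℤ (u i)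
        ≈⟨ solve 4 (λ c x u s → c :* (x :* u) :+ s :* u := (c :* x :+ s) :* u) K.refl
             (c zero) (x zero i₀) (fromℤ (u i)) (sum (λ q → c (suc q) * x (suc q) i₀)) ⟩
      (c zero * x zero i₀ + sum (λ q → c (suc q) * x (suc q) i₀)) * fromℤ (u i) ∎

  -- The face of an extra-generalized arithmetical semigroup is spanned by r and t

  module _ {a k : ℕ} .{{_ : NonZero a}} .{{_ : NonZero k}} {d e : ℤ} (de≡1 : d ℤ.* e ≡ 1ℤ [mod a ])
           {u : Fin (pred a) → ℕ} (isIndex : IsIndex a d u) (1<k : 1 ℕ.< k) (k+2<a : k ℕ.+ 2 ℕ.< a) where
    open IsIndex isIndex

    private
      r t : Vector ℤ (pred a)
      r = rayʳ u
      t = rayᵗ a k u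

      q : ℕ
      q = a ℕ./ k

      k<a : k ℕ.< a
      k<a = ℕ.≤-<-trans (ℕ.m≤m+n k 2) k+2<a

      1<a : 1 ℕ.< a
      1<a = ℕ.<-trans 1<k k<a

      2<a : 2 ℕ.< a
      2<a = ℕ.≤-<-trans 1<k k<a

      0<k : 0 ℕ.< k
      0<k = ℕ.<-trans (s≤s z≤n) 1<k

      at : ℕ → Fin (pred a)
      at j = proj₁ (locate de≡1 isIndex 1<a j)

      u∘at : ∀ {j} → 0 ℕ.< j → j ℕ.< a → u (at j) ≡ j
      u∘at {j} = proj₂ (locate de≡1 isIndex 1<a j)

      at∘u : ∀ i → at (u i) ≡ i
      at∘u i = index-injective de≡1 isIndex (u∘at (positive i) (bounded i))

      sum-at : ∀ {i j l} → 0 ℕ.< i → i ℕ.< a → 0 ℕ.< j → j ℕ.< a → 0 ℕ.< l → l ℕ.< a →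
               + i ℤ.+ + j ≡ + l [mod a ] → ResidueSum a (at i) (at j) (at l)
      sum-at {i} {j} {l} 0<i i<a 0<j j<a 0<l l<a i+j≡l = index-residueSum de≡1 isIndex {at i} {at j} {at l}
        (subst₂ (λ x y → + x ℤ.+ + y ≡ + u (at l) [mod a ]) (sym (u∘at 0<i i<a)) (sym (u∘at 0<j j<a))
          (subst (λ z → + i ℤ.+ + j ≡ + z [mod a ]) (sym (u∘at 0<l l<a)) i+j≡l))

    -- On 1, ..., k the vector t is the line a - qj. Twice the equation at 1 minus the equation at 2
    -- eliminates α and leaves aβ = 0; position 2 lies on this line because 1 < k.
    rays-independent : Independent (embed K r) (embed K t)
    rays-independent α β eq = α≈0 , β≈0
      where
      t-at : ∀ {j} → 0 ℕ.< j → j ℕ.≤ k → t (at j) ≡ + a ℤ.- + q ℤ.* + j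
      t-at {j} 0<j j≤k = trans (cong (λ n → + a ℤ.* + ⌈ n / k ⌉ ℤ.- + q ℤ.* + n) (u∘at 0<j (ℕ.≤-<-trans j≤k k<a)))
        (cong (ℤ._- + q ℤ.* + j) (trans (cong (λ n → + a ℤ.* + n) (⌈n/k⌉≡1 0<j j≤k)) (ℤ.*-identityʳ (+ a))))
      at≈ : ∀ {j} → 0 ℕ.< j → j ℕ.≤ k → α * fromℤ (+ j) + β * fromℤ (+ a ℤ.- + q ℤ.* + j) ≈ 0#
      at≈ {j} 0<j j≤k = K.trans (K.reflexive (cong₂ (λ x y → α * fromℤ x + β * fromℤ y)
        (cong +_ (sym (u∘at 0<j (ℕ.≤-<-trans j≤k k<a)))) (sym (t-at 0<j j≤k)))) (eq (at j))
      βa≈0 : fromℤ (+ a) * β ≈ 0#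
      βa≈0 = begin
        fromℤ (+ a) * β
          ≈⟨ solve 4 (λ α β a q → a :* β :=
               (α :* con (+ 1) :+ β :* (a :- q :* con (+ 1))) :+ (α :* con (+ 1) :+ β :* (a :- q :* con (+ 1)))
                 :- (α :* con (+ 2) :+ β :* (a :- q :* con (+ 2)))) K.refl α β (fromℤ (+ a)) (fromℤ (+ q)) ⟩
        (E 1 + E 1) - E 2
          ≈⟨ +-cong (+-cong (E≈0 (s≤s z≤n) 0<k) (E≈0 (s≤s z≤n) 0<k)) (-‿cong (E≈0 (s≤s z≤n) 1<k)) ⟩
        0# + 0# - 0#
          ≈⟨ solve 0 (con 0ℤ :+ con 0ℤ :- con 0ℤ := con 0ℤ) K.refl ⟩
        0# ∎
        where
        E : ℕ → Carrier
        E j = α * fromℤ (+ j) + β * (fromℤ (+ a) - fromℤ (+ q) * fromℤ (+ j))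
        E≈0 : ∀ {j} → 0 ℕ.< j → j ℕ.≤ k → E j ≈ 0#
        E≈0 {j} 0<j j≤k = K.trans (+-congˡ (*-congˡ (K.sym (K.trans (fromℤ-minus (+ a) (+ q ℤ.* + j))
          (+-congˡ (-‿cong (fromℤ-* (+ q) (+ j)))))))) (at≈ 0<j j≤k)
      β≈0 : β ≈ 0#
      β≈0 = x*y≈0⇒y≈0 (0<x⇒x≉0 (fromℤ-0< (ℤ.+<+ (ℕ.<-trans (s≤s z≤n) 1<a)))) βa≈0
      α≈0 : α ≈ 0#
      α≈0 = begin
        α                                                              ≈⟨ *-identityʳ α ⟨
        α * 1#                                                         ≈⟨ *-congˡ fromℤ-1 ⟨
        α * fromℤ 1ℤ                                                   ≈⟨ +-identityʳ _ ⟨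
        α * fromℤ 1ℤ + 0#                                              ≈⟨ +-congˡ (K.trans (*-congʳ β≈0) (zeroˡ _)) ⟨
        α * fromℤ 1ℤ + β * fromℤ (+ a ℤ.- + q ℤ.* + 1)                 ≈⟨ at≈ (s≤s z≤n) 0<k ⟩
        0#                                                             ∎

    module _ {h N : ℕ} (0<h : 0 ℕ.< h) (0<N : 0 ℕ.< N) where

      private
        w : Vector ℤ (pred a)
        w = facePoint {a} {k} de≡1 isIndex h N

      cone₂⊆minimalFace : Cone₂ (embed K r) (embed K t) ⊆ MinimalFace {a} w
      cone₂⊆minimalFace {x} (α , β , 0≤α , 0≤β , x≈) =
        slack⇒cone (λ {i} {j} {l} i+j≡l → 0≤-resp-≈ (K.sym (slack-linear {a} x≈ i j l)) (0≤x+y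
          (*-nonNegative 0≤α (cone⇒slack {a} (embed-cone {a} {r} (λ {i} {j} {l} → rayʳ-cone de≡1 isIndex {i} {j} {l})) i+j≡l))
          (*-nonNegative 0≤β (cone⇒slack {a} (embed-cone {a} {t} (λ {i} {j} {l} → rayᵗ-cone de≡1 isIndex {i} {j} {l})) i+j≡l)))) ,
        λ {i} {j} {l} i+j≡l tight →
          let r≡0 , t≡0 = facePoint-tight {a} {k} de≡1 isIndex h N 0<h 0<N {i} {j} {l} i+j≡l tight in begin
          slack {a} x i j l
            ≈⟨ slack-linear {a} x≈ i j l ⟩
          α * slack {a} (embed K r) i j l + β * slack {a} (embed K t) i j l
            ≈⟨ +-cong (*-congˡ (K.trans (slack-embed {a} r i j l) (K.reflexive (cong fromℤ r≡0))))
                 (*-congˡ (K.trans (slack-embed {a} t i j l) (K.reflexive (cong fromℤ t≡0)))) ⟩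
          α * 0# + β * 0#
            ≈⟨ solve 2 (λ α β → α :* con 0ℤ :+ β :* con 0ℤ := con 0ℤ) K.refl α β ⟩
          0# ∎

      module _ {x : Point K (pred a)} (x∈ : x ∈ MinimalFace {a} w) where

        private
          X : ℕ → Carrier
          X j = x (at j)

          -- If neither the indices wrap around nor the ceilings drop, then r and t both have slack
          -- 0, so w is tight there and x inherits the equality.
          additive : ∀ {i j} → 0 ℕ.< i → 0 ℕ.< j → i ℕ.+ j ℕ.< a → ⌈ i / k ⌉ ℕ.+ ⌈ j / k ⌉ ≡ ⌈ i ℕ.+ j / k ⌉ →
                     X (i ℕ.+ j) ≈ X i + X j
          additive {i} {j} 0<i 0<j i+j<a ⌈⌉-additive = begin
            X (i ℕ.+ j)                                       ≈⟨ +-identityʳ _ ⟨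
            X (i ℕ.+ j) + 0#                                  ≈⟨ +-congˡ (proj₂ x∈ i+j≡i+j tight) ⟨
            X (i ℕ.+ j) + (X i + X j - X (i ℕ.+ j))           ≈⟨ solve 2 (λ x y → x :+ (y :- x) := y) K.refl (X (i ℕ.+ j)) (X i + X j) ⟩
            X i + X j                                         ∎
            where
            i<a : i ℕ.< a
            i<a = ℕ.≤-<-trans (ℕ.m≤m+n i j) i+j<a
            j<a : j ℕ.< a
            j<a = ℕ.≤-<-trans (ℕ.m≤n+m j i) i+j<a
            0<i+j : 0 ℕ.< i ℕ.+ j
            0<i+j = ℕ.<-≤-trans 0<i (ℕ.m≤m+n i j)
            i+j≡i+j : ResidueSum a (at i) (at j) (at (i ℕ.+ j))
            i+j≡i+j = sum-at 0<i i<a 0<j j<a 0<i+j i+j<a (≡⇒≡mod {a} {+ (i ℕ.+ j)} refl)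
            u-additive : u (at i) ℕ.+ u (at j) ≡ u (at (i ℕ.+ j))
            u-additive = trans (cong₂ ℕ._+_ (u∘at 0<i i<a) (u∘at 0<j j<a)) (sym (u∘at 0<i+j i+j<a))
            ⌈u⌉-additive : ⌈ u (at i) / k ⌉ ℕ.+ ⌈ u (at j) / k ⌉ ≡ ⌈ u (at (i ℕ.+ j)) / k ⌉
            ⌈u⌉-additive = trans (cong₂ (λ m n → ⌈ m / k ⌉ ℕ.+ ⌈ n / k ⌉) (u∘at 0<i i<a) (u∘at 0<j j<a))
              (trans ⌈⌉-additive (cong (λ n → ⌈ n / k ⌉) (sym (u∘at 0<i+j i+j<a))))
            tight : intSlack w (at i) (at j) (at (i ℕ.+ j)) ≡ 0ℤ
            tight = trans (slack-facePoint-pos {a} {k} de≡1 isIndex h N (at i) (at j) (at (i ℕ.+ j)) {0} {0}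
                (slackʳ {a} {k} de≡1 isIndex {at i} {at j} {at (i ℕ.+ j)} 0 (trans u-additive (sym (ℕ.+-identityʳ _))))
                (slackᵗ≡0 de≡1 isIndex {at i} {at j} {at (i ℕ.+ j)} u-additive ⌈u⌉-additive))
              (cong +_ (cong₂ ℕ._+_ (ℕ.*-zeroʳ h) (ℕ.*-zeroʳ N)))

          -- The aim is X j = Dj + A⌈j/k⌉: on the first block D is the common difference and A the
          -- value extrapolated to j = 0.
          A D : Carrier
          A = X 1 + X 1 - X 2
          D = X 2 - X 1

          ⌈⌉-two : ∀ {i j} → 0 ℕ.< i → i ℕ.≤ k → 0 ℕ.< j → j ℕ.≤ k → k ℕ.< i ℕ.+ j →
                   ⌈ i / k ⌉ ℕ.+ ⌈ j / k ⌉ ≡ ⌈ i ℕ.+ j / k ⌉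
          ⌈⌉-two {i} {j} 0<i i≤k 0<j j≤k k<i+j = ℕ.≤-antisym
            (subst (ℕ._≤ ⌈ i ℕ.+ j / k ⌉) (sym (cong₂ ℕ._+_ (⌈n/k⌉≡1 0<i i≤k) (⌈n/k⌉≡1 0<j j≤k)))
              (ℕ.*-cancelʳ-< k 1 _ (subst (ℕ._< ⌈ i ℕ.+ j / k ⌉ ℕ.* k) (sym (ℕ.*-identityˡ k))
                (ℕ.<-≤-trans k<i+j (n≤⌈n/k⌉*k (i ℕ.+ j))))))
            (⌈[m+n]/k⌉≤⌈m/k⌉+⌈n/k⌉ i j)

          small-additive : ∀ {i j n} → 0 ℕ.< i → i ℕ.≤ k → 0 ℕ.< j → j ℕ.≤ k → i ℕ.+ j ≡ n → k ℕ.< n → n ℕ.< a →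
                           X n ≈ X i + X j
          small-additive 0<i i≤k 0<j j≤k refl k<n n<a = additive 0<i 0<j n<a (⌈⌉-two 0<i i≤k 0<j j≤k k<n)

          -- Both pairs (i, k + 1 - i) and (1, k) add up to k + 1, and both (i + 1, k + 1 - i) and (2, k) to k + 2.
          step : ∀ {i} → 0 ℕ.< i → i ℕ.< k → X (suc i) ≈ X i + D
          step {i} 0<i i<k = begin
            X (suc i)
              ≈⟨ solve 2 (λ x y → x := x :+ y :- y) K.refl (X (suc i)) (X j) ⟩
            X (suc i) + X j - X j
              ≈⟨ +-congʳ (K.trans (K.sym (small-additive (s≤s z≤n) i<k 0<j j≤k suc-i+j k<k+2 k+2<a))
                   (small-additive (s≤s z≤n) 1<k 0<k ℕ.≤-refl (ℕ.+-comm 2 k) k<k+2 k+2<a)) ⟩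
            X 2 + X k - X j
              ≈⟨ solve 4 (λ x y z w → y :+ z :- w := x :+ z :- w :+ (y :- x)) K.refl (X 1) (X 2) (X k) (X j) ⟩
            X 1 + X k - X j + D
              ≈⟨ +-congʳ (+-congʳ (K.trans (K.sym (small-additive (s≤s z≤n) 0<k 0<k ℕ.≤-refl (ℕ.+-comm 1 k) k<k+1 k+1<a))
                   (small-additive 0<i (ℕ.<⇒≤ i<k) 0<j j≤k i+j k<k+1 k+1<a))) ⟩
            X i + X j - X j + D
              ≈⟨ solve 3 (λ x y d → x :+ y :- y :+ d := x :+ d) K.refl (X i) (X j) D ⟩
            X i + D ∎
            where
            j = k ℕ.+ 1 ℕ.∸ i
            i≤k+1 : i ℕ.≤ k ℕ.+ 1
            i≤k+1 = ℕ.≤-trans (ℕ.<⇒≤ i<k) (ℕ.m≤m+n k 1)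
            i+j : i ℕ.+ j ≡ k ℕ.+ 1
            i+j = ℕ.m+[n∸m]≡n i≤k+1
            suc-i+j : suc i ℕ.+ j ≡ k ℕ.+ 2
            suc-i+j = trans (cong suc i+j) (sym (ℕ.+-suc k 1))
            0<j : 0 ℕ.< j
            0<j = ℕ.m<n⇒0<n∸m (ℕ.<-≤-trans i<k (ℕ.m≤m+n k 1))
            j≤k : j ℕ.≤ k
            j≤k = ℕ.m≤n+o⇒m∸n≤o (k ℕ.+ 1) i (subst (ℕ._≤ i ℕ.+ k) (ℕ.+-comm 1 k) (ℕ.+-monoˡ-≤ k 0<i))
            k<k+1 : k ℕ.< k ℕ.+ 1
            k<k+1 = ℕ.m<m+n k (s≤s z≤n)
            k<k+2 : k ℕ.< k ℕ.+ 2
            k<k+2 = ℕ.m<m+n k (s≤s z≤n)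
            k+1<a : k ℕ.+ 1 ℕ.< a
            k+1<a = ℕ.≤-<-trans (ℕ.+-monoʳ-≤ k (s≤s z≤n)) k+2<a

          first-block : ∀ {j} → 0 ℕ.< j → j ℕ.≤ k → X j ≈ D * fromℤ (+ j) + A
          first-block {suc zero}    _ _     = begin
            X 1                         ≈⟨ solve 2 (λ x y → x := (y :- x) :* con (+ 1) :+ (x :+ x :- y)) K.refl (X 1) (X 2) ⟩
            D * fromℤ (+ 1) + A         ∎
          first-block {suc (suc j)} _ j+2≤k = begin
            X (suc (suc j))                      ≈⟨ step (s≤s z≤n) j+2≤k ⟩
            X (suc j) + D                        ≈⟨ +-congʳ (first-block (s≤s z≤n) (ℕ.<⇒≤ j+2≤k)) ⟩
            D * fromℤ (+ suc j) + A + D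
              ≈⟨ solve 3 (λ D A j → D :* j :+ A :+ D := D :* (con 1ℤ :+ j) :+ A) K.refl D A (fromℤ (+ suc j)) ⟩
            D * (fromℤ 1ℤ + fromℤ (+ suc j)) + A ≈⟨ +-congʳ (*-congˡ (fromℤ-+ 1ℤ (+ suc j))) ⟨
            D * fromℤ (+ suc (suc j)) + A        ∎

          all-blocks : ∀ v {s} → 0 ℕ.< s → s ℕ.≤ k → s ℕ.+ v ℕ.* k ℕ.< a →
                       X (s ℕ.+ v ℕ.* k) ≈ D * fromℤ (+ (s ℕ.+ v ℕ.* k)) + A * fromℤ (+ ⌈ s ℕ.+ v ℕ.* k / k ⌉)
          all-blocks zero {s} 0<s s≤k _ = subst
            (λ n → X n ≈ D * fromℤ (+ n) + A * fromℤ (+ ⌈ n / k ⌉)) (sym (ℕ.+-identityʳ s)) (begin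
              X s                              ≈⟨ first-block 0<s s≤k ⟩
              D * fromℤ (+ s) + A              ≈⟨ +-congˡ (*-identityʳ A) ⟨
              D * fromℤ (+ s) + A * 1#         ≈⟨ +-congˡ (*-congˡ fromℤ-1) ⟨
              D * fromℤ (+ s) + A * fromℤ 1ℤ   ≡⟨ cong (λ n → D * fromℤ (+ s) + A * fromℤ (+ n)) (⌈n/k⌉≡1 0<s s≤k) ⟨
              D * fromℤ (+ s) + A * fromℤ (+ ⌈ s / k ⌉) ∎)
          all-blocks (suc v) {s} 0<s s≤k bound = subst
            (λ n → X n ≈ D * fromℤ (+ n) + A * fromℤ (+ ⌈ n / k ⌉)) n+k≡ (begin
              X (n ℕ.+ k)
                ≈⟨ additive 0<n 0<k n+k<a (trans (cong (⌈ n / k ⌉ ℕ.+_) (⌈n/k⌉≡1 0<k ℕ.≤-refl)) (sym (⌈[n+k]/k⌉≡⌈n/k⌉+1 n))) ⟩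
              X n + X k
                ≈⟨ +-cong (all-blocks v 0<s s≤k (ℕ.≤-<-trans (ℕ.m≤m+n n k) n+k<a)) (first-block 0<k ℕ.≤-refl) ⟩
              D * fromℤ (+ n) + A * fromℤ (+ ⌈ n / k ⌉) + (D * fromℤ (+ k) + A)
                ≈⟨ solve 5 (λ D A n c k → D :* n :+ A :* c :+ (D :* k :+ A) := D :* (n :+ k) :+ A :* (c :+ con 1ℤ)) K.refl
                     D A (fromℤ (+ n)) (fromℤ (+ ⌈ n / k ⌉)) (fromℤ (+ k)) ⟩
              D * (fromℤ (+ n) + fromℤ (+ k)) + A * (fromℤ (+ ⌈ n / k ⌉) + fromℤ 1ℤ)
                ≈⟨ +-cong (*-congˡ (fromℤ-+ (+ n) (+ k))) (*-congˡ (fromℤ-+ (+ ⌈ n / k ⌉) 1ℤ)) ⟨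
              D * fromℤ (+ (n ℕ.+ k)) + A * fromℤ (+ (⌈ n / k ⌉ ℕ.+ 1))
                ≡⟨ cong (λ c → D * fromℤ (+ (n ℕ.+ k)) + A * fromℤ (+ c)) (⌈[n+k]/k⌉≡⌈n/k⌉+1 n) ⟨
              D * fromℤ (+ (n ℕ.+ k)) + A * fromℤ (+ ⌈ n ℕ.+ k / k ⌉) ∎)
            where
            n = s ℕ.+ v ℕ.* k
            n+k≡ : n ℕ.+ k ≡ s ℕ.+ suc v ℕ.* k
            n+k≡ = trans (ℕ.+-assoc s (v ℕ.* k) k) (cong (s ℕ.+_) (ℕ.+-comm (v ℕ.* k) k))
            n+k<a : n ℕ.+ k ℕ.< a
            n+k<a = subst (ℕ._< a) (sym n+k≡) bound
            0<n : 0 ℕ.< n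
            0<n = ℕ.<-≤-trans 0<s (ℕ.m≤m+n s (v ℕ.* k))

          formula : ∀ {j} → 0 ℕ.< j → j ℕ.< a → X j ≈ D * fromℤ (+ j) + A * fromℤ (+ ⌈ j / k ⌉)
          formula {suc j} _ j<a = subst (λ n → X n ≈ D * fromℤ (+ n) + A * fromℤ (+ ⌈ n / k ⌉)) (sym j≡)
            (all-blocks (j ℕ./ k) (s≤s z≤n) (ℕ.m%n<n j k) (subst (ℕ._< a) j≡ j<a))
            where
            -- The predecessor is divided by k, so that the offset in a block runs over 1, ..., k,
            -- as the ceiling requires.
            j≡ : suc j ≡ suc (j ℕ.% k) ℕ.+ (j ℕ./ k) ℕ.* k
            j≡ = cong suc (ℕ.m≡m%n+[m/n]*n j k)

          0≤A : 0# ≤ A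
          0≤A = cone⇒slack (proj₁ x∈) (sum-at (s≤s z≤n) 1<a (s≤s z≤n) 1<a (s≤s z≤n) 2<a (≡⇒≡mod {a} {+ 2} refl))

          -- The wrap-around inequality x(k) + x(a + 1 - k) ≥ x(1).
          0≤aD+qA : 0# ≤ fromℤ (+ a) * D + fromℤ (+ q) * A
          0≤aD+qA = 0≤-resp-≈ (begin
            -- For j = a + 1 - k the inequality itself gives aD + ⌈j/k⌉A ≥ 0. The added term raises
            -- the coefficient of A to q, which is allowed since ⌈j/k⌉ ≤ q and A ≥ 0.
            X k + X j - X 1 + A * (fromℤ (+ q) - fromℤ (+ ⌈ j / k ⌉))
              ≈⟨ +-congʳ (+-cong (+-cong (first-block 0<k ℕ.≤-refl) (formula 0<j j<a)) (-‿cong (first-block (s≤s z≤n) 0<k))) ⟩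
            D * fromℤ (+ k) + A + (D * fromℤ (+ j) + A * fromℤ (+ ⌈ j / k ⌉)) - (D * fromℤ 1ℤ + A)
              + A * (fromℤ (+ q) - fromℤ (+ ⌈ j / k ⌉))
              ≈⟨ solve 6 (λ D A k j c q → D :* k :+ A :+ (D :* j :+ A :* c) :- (D :* con 1ℤ :+ A) :+ A :* (q :- c) :=
                   (k :+ j :- con 1ℤ) :* D :+ q :* A) K.refl D A (fromℤ (+ k)) (fromℤ (+ j)) (fromℤ (+ ⌈ j / k ⌉)) (fromℤ (+ q)) ⟩
            (fromℤ (+ k) + fromℤ (+ j) - fromℤ 1ℤ) * D + fromℤ (+ q) * A
              ≈⟨ +-congʳ (*-congʳ (+-congʳ (fromℤ-+ (+ k) (+ j)))) ⟨
            (fromℤ (+ (k ℕ.+ j)) - fromℤ 1ℤ) * D + fromℤ (+ q) * A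
              ≡⟨ cong (λ n → (fromℤ (+ n) - fromℤ 1ℤ) * D + fromℤ (+ q) * A) k+j ⟩
            (fromℤ (+ (a ℕ.+ 1)) - fromℤ 1ℤ) * D + fromℤ (+ q) * A
              ≈⟨ +-congʳ (*-congʳ (+-congʳ (fromℤ-+ (+ a) 1ℤ))) ⟩
            (fromℤ (+ a) + fromℤ 1ℤ - fromℤ 1ℤ) * D + fromℤ (+ q) * A
              ≈⟨ +-congʳ (*-congʳ (solve 1 (λ a → a :+ con 1ℤ :- con 1ℤ := a) K.refl (fromℤ (+ a)))) ⟩
            fromℤ (+ a) * D + fromℤ (+ q) * A ∎)
            (0≤x+y
              (cone⇒slack (proj₁ x∈) (sum-at 0<k k<a 0<j j<a (s≤s z≤n) 1<a wrap))
              (*-nonNegative 0≤A (0≤-resp-≈ (fromℤ-minus (+ q) (+ ⌈ j / k ⌉)) (fromℤ-0≤ (ℤ.i≤j⇒0≤j-i (ℤ.+≤+ ⌈j⌉≤q))))))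
            where
            j = a ℕ.+ 1 ℕ.∸ k
            k+j : k ℕ.+ j ≡ a ℕ.+ 1
            k+j = ℕ.m+[n∸m]≡n (ℕ.≤-trans (ℕ.<⇒≤ k<a) (ℕ.m≤m+n a 1))
            0<j : 0 ℕ.< j
            0<j = ℕ.m<n⇒0<n∸m (ℕ.<-≤-trans k<a (ℕ.m≤m+n a 1))
            j<a : j ℕ.< a
            j<a = ℕ.+-cancelˡ-< k j a (subst (ℕ._< k ℕ.+ a) (sym k+j)
              (subst (ℕ._< k ℕ.+ a) (ℕ.+-comm 1 a) (ℕ.+-monoˡ-< a 1<k)))
            wrap : + k ℤ.+ + j ≡ + 1 [mod a ]
            wrap = subst (_≡ + 1 [mod a ]) (trans (cong (λ z → 1ℤ ℤ.+ z) (ℤ.*-identityˡ (+ a)))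
              (cong +_ (trans (ℕ.+-comm 1 a) (sym k+j)))) (mod-+multiple (+ 1) 1ℤ)
            ⌈j⌉≤q : ⌈ j / k ⌉ ℕ.≤ q
            ⌈j⌉≤q = n≤m*k⇒⌈n/k⌉≤m (ℕ.+-cancelˡ-≤ k j (q ℕ.* k) (subst (ℕ._≤ k ℕ.+ q ℕ.* k) (sym k+j)
              (subst (ℕ._≤ suc q ℕ.* k) (ℕ.+-comm 1 a) a<[1+q]k)))
              where
              a<[1+q]k : a ℕ.< suc q ℕ.* k
              a<[1+q]k = subst (ℕ._< suc q ℕ.* k) (sym (ℕ.m≡m%n+[m/n]*n a k)) (ℕ.+-monoˡ-< (q ℕ.* k) (ℕ.m%n<n a k))

        -- Matching Dj + A⌈j/k⌉ with ρj + τ(a⌈j/k⌉ - qj) gives τ = A/a and ρ = (aD + qA)/a.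
        minimalFace⊆cone₂ : x ∈ Cone₂ (embed K r) (embed K t)
        minimalFace⊆cone₂ =
          let γ , 0<γ , aγ≈1 = positive-inverse {fromℤ (+ a)} (fromℤ-0< (ℤ.+<+ (ℕ.<-trans (s≤s z≤n) 1<a)))
          in γ * (fromℤ (+ a) * D + fromℤ (+ q) * A) , γ * A ,
             *-nonNegative (proj₁ 0<γ) 0≤aD+qA , *-nonNegative (proj₁ 0<γ) 0≤A , λ i → begin
               x i
                 ≡⟨ cong x (at∘u i) ⟨
               X (u i)
                 ≈⟨ formula (positive i) (bounded i) ⟩
               D * fromℤ (+ u i) + A * fromℤ (+ ⌈ u i / k ⌉)
                 ≈⟨ *-identityˡ _ ⟨
               1# * (D * fromℤ (+ u i) + A * fromℤ (+ ⌈ u i / k ⌉))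
                 ≈⟨ *-congʳ aγ≈1 ⟨
               fromℤ (+ a) * γ * (D * fromℤ (+ u i) + A * fromℤ (+ ⌈ u i / k ⌉))
                 ≈⟨ solve 7 (λ a γ D A u c q → a :* γ :* (D :* u :+ A :* c) :=
                      γ :* (a :* D :+ q :* A) :* u :+ γ :* A :* (a :* c :- q :* u)) K.refl
                      (fromℤ (+ a)) γ D A (fromℤ (+ u i)) (fromℤ (+ ⌈ u i / k ⌉)) (fromℤ (+ q)) ⟩
               γ * (fromℤ (+ a) * D + fromℤ (+ q) * A) * fromℤ (+ u i)
                 + γ * A * (fromℤ (+ a) * fromℤ (+ ⌈ u i / k ⌉) - fromℤ (+ q) * fromℤ (+ u i))
                 ≈⟨ +-congˡ (*-congˡ (K.trans (fromℤ-minus (+ a ℤ.* + ⌈ u i / k ⌉) (+ q ℤ.* + u i))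
                      (+-cong (fromℤ-* (+ a) (+ ⌈ u i / k ⌉)) (-‿cong (fromℤ-* (+ q) (+ u i)))))) ⟨
               γ * (fromℤ (+ a) * D + fromℤ (+ q) * A) * fromℤ (r i) + γ * A * fromℤ (t i) ∎

      minimalFace≐cone₂ : MinimalFace {a} w ≐ Cone₂ (embed K r) (embed K t)
      minimalFace≐cone₂ = minimalFace⊆cone₂ , cone₂⊆minimalFace

  -- Semigroups contained in a ray

  relativeInterior-resp-≗ : ∀ {n} {G : Region K n} {x y : Vector ℤ n} → x ≗ y → embed K y ∈ G →
                            embed K x ∈ RelativeInterior K G → embed K y ∈ RelativeInterior K G
  relativeInterior-resp-≗ x≗y y∈G (_ , ε , 0<ε , ball) = y∈G , ε , 0<ε , λ z z∈hull close →
    ball z z∈hull (λ i → subst (λ j → fromℤ j - ε < z i × z i < fromℤ j + ε) (sym (x≗y i)) (close i))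

  interior-transfer : ∀ {n} {G C : Region K n} {x y : Vector ℤ n} → IsFace K C G → x ≗ y →
                      embed K x ∈ RelativeInterior K G → embed K y ∈ RelativeInterior K G
  interior-transfer isFace x≗y x∈ = relativeInterior-resp-≗ x≗y
    (face-resp-≋ isFace (proj₁ x∈) (λ i → K.reflexive (cong fromℤ (sym (x≗y i))))) x∈

  module _ {a : ℕ} .{{_ : NonZero a}} (1<a : 1 ℕ.< a) {d e : ℤ} (de≡1 : d ℤ.* e ≡ 1ℤ [mod a ])
           {u : Fin (pred a) → ℕ} (isIndex : IsIndex a d u) {v : Vector ℤ (pred a)} (v≡u : ∀ i → v i ≡ + u i) where

    private
      i₀ : Fin (pred a)
      i₀ = proj₁ (index-surjective de≡1 isIndex (s≤s z≤n) 1<a)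

      ui₀≡1 : u i₀ ≡ 1
      ui₀≡1 = proj₂ (index-surjective de≡1 isIndex (s≤s z≤n) 1<a)

      vi₀≡1 : v i₀ ≡ 1ℤ
      vi₀≡1 = trans (v≡u i₀) (cong +_ ui₀≡1)

    ray-contains : ∀ b → 0ℤ ℤ.< b → b ≡ d [mod a ] → Contains K a (Ray K (embed K v)) ⟨ + a ∷ b ∷ [] ⟩
    ray-contains b 0<b b≡d = (λ i → b ℤ.* v i) ,
      apéry-resp-≗ (twoGenerated-isApéryTuple {a} {d} {e} de≡1 isIndex (ℤ.<⇒≤ 0<b) b≡d) (λ i → cong (b ℤ.*_) (sym (v≡u i))) ,
      ray-interior {u = v} {b} {i₀} vi₀≡1 0<b

    -- At the position `i₀` where v is 1, the scalar c equals the integer `x i₀`. Injectivity of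
    -- `fromℤ` brings the proportionality back to the integers, with b = `x i₀`.
    contained⇒twoGenerated : ∀ T → Contains K a (Ray K (embed K v)) T →
      ∃ λ b → 0ℤ ℤ.< b × b ≡ d [mod a ] × T ≐ ⟨ + a ∷ b ∷ [] ⟩
    contained⇒twoGenerated T (x , tuple , (c , 0≤c , x≈cv) , _) =
      x i₀ , ℤ.≤∧≢⇒< (nonNegative (proj₁ (inApérySet i₀))) xi₀≢0 , xi₀≡d ,
      proportional⇒twoGenerated u i₀ tuple x≡uxi₀ refl
      where
      open IsApéryTuple tuple
      open IsNumericalSemigroup isNumericalSemigroup
      xi₀≢0 : 0ℤ ≢ x i₀
      xi₀≢0 0≡x = residue≢0 {a} {d} {e} de≡1 i₀ (mod-sym 0ℤ (residue i₀) (subst (_≡ residue i₀ [mod a ]) (sym 0≡x) (inClass i₀)))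
      xi₀≡d : x i₀ ≡ d [mod a ]
      xi₀≡d = mod-trans (x i₀) (residue i₀) d (inClass i₀) (mod-sym d (residue i₀)
        (subst (_≡ residue i₀ [mod a ]) (trans (cong (λ n → + n ℤ.* d) ui₀≡1) (ℤ.*-identityˡ d)) (IsIndex.hits isIndex i₀)))
      c≈ : c ≈ fromℤ (x i₀)
      c≈ = begin
        c                     ≈⟨ *-identityʳ c ⟨
        c * 1#                ≈⟨ *-congˡ fromℤ-1 ⟨
        c * fromℤ 1ℤ          ≡⟨ cong (λ j → c * fromℤ j) vi₀≡1 ⟨
        c * fromℤ (v i₀)      ≈⟨ x≈cv i₀ ⟨
        fromℤ (x i₀)          ∎
      x≡uxi₀ : ∀ i → x i ≡ + u i ℤ.* x i₀
      x≡uxi₀ i = fromℤ-injective (begin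
        fromℤ (x i)                     ≈⟨ x≈cv i ⟩
        c * fromℤ (v i)                 ≈⟨ *-cong c≈ (K.reflexive (cong fromℤ (v≡u i))) ⟩
        fromℤ (x i₀) * fromℤ (+ u i)    ≈⟨ *-comm _ _ ⟩
        fromℤ (+ u i) * fromℤ (x i₀)    ≈⟨ fromℤ-* (+ u i) (x i₀) ⟨
        fromℤ (+ u i ℤ.* x i₀)          ∎)

-- Displacements, face and rays of S

module ExtraGeneralizedArithmetical {a h k : ℕ} {d : ℤ} .{{_ : NonZero a}} .{{_ : NonZero h}} .{{_ : NonZero k}}
  (ega : IsExtraGeneralizedArithmetical a h k d) (1<k : 1 ℕ.< k) (k<a∸2 : k ℕ.< a ℕ.∸ 2)
  {e : ℤ} (de≡1 : d ℤ.* e ≡ 1ℤ [mod a ]) {u : Fin (pred a) → ℕ} (isIndex : IsIndex a d u) where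
  open IsExtraGeneralizedArithmetical ega

  S : Pred ℤ 0ℓ
  S = ⟨ egaGenerators a h k d ⟩

  q : ℕ
  q = a ℕ./ k

  1<a : 1 ℕ.< a
  1<a = ℕ.<-trans 1<k k<a

  k+2<a : k ℕ.+ 2 ℕ.< a
  k+2<a = ℕ.m≤o∸n⇒m+n≤o (suc k) 1<a k<a∸2

  r t : Vector ℤ (pred a)
  r = rayʳ u
  t = rayᵗ a k u

  0≤generators : ∀ j → 0ℤ ℤ.≤ egaGenerators a h k d j
  0≤generators j = IsNumericalSemigroup.nonNegative isNumericalSemigroup (generator∈span (egaGenerators a h k d) j)

  0<hq+d : 0ℤ ℤ.< + (h ℕ.* q) ℤ.+ d
  0<hq+d = egaMinimal⇒0<hq+d 1<k ega

  N : ℕ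
  N = ℤ.∣ + (h ℕ.* q) ℤ.+ d ∣

  hq+d≡N : + (h ℕ.* q) ℤ.+ d ≡ + N
  hq+d≡N = sym (ℤ.0≤i⇒+∣i∣≡i (ℤ.<⇒≤ 0<hq+d))

  0<N : 0 ℕ.< N
  0<N = ℤ.drop‿+<+ (subst (0ℤ ℤ.<_) hq+d≡N 0<hq+d)

  0<h : 0 ℕ.< h
  0<h = ℕ.>-nonZero⁻¹ h

  apéryTuple : IsApéryTuple S a (egaApéry a h k d u)
  apéryTuple = ega-isApéryTuple a h k d {e} de≡1 0≤generators hq+d≡N isIndex

  w : Vector ℤ (pred a)
  w = facePoint {a} {k} de≡1 isIndex h N

  egaApéry≗w : egaApéry a h k d u ≗ w
  egaApéry≗w i = begin
    + (a ℕ.* h) ℤ.* + c ℤ.+ + u i ℤ.* d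
      ≡⟨ cong (λ x → x ℤ.* + c ℤ.+ + u i ℤ.* d) (ℤ.pos-* a h) ⟩
    + a ℤ.* + h ℤ.* + c ℤ.+ + u i ℤ.* d
      ≡⟨ identity (+ a) (+ h) (+ c) (+ u i) d (+ q) ⟩
    + h ℤ.* t i ℤ.+ (+ h ℤ.* + q ℤ.+ d) ℤ.* + u i
      ≡⟨ cong (λ x → + h ℤ.* t i ℤ.+ x ℤ.* + u i) (trans (cong (ℤ._+ d) (sym (ℤ.pos-* h q))) hq+d≡N) ⟩
    w i ∎
    where
    open ≡-Reasoning
    c = ⌈ u i / k ⌉
    identity : ∀ a h c u d q → a ℤ.* h ℤ.* c ℤ.+ u ℤ.* d ≡ h ℤ.* (a ℤ.* c ℤ.- q ℤ.* u) ℤ.+ (h ℤ.* q ℤ.+ d) ℤ.* u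
    identity = solve-∀

  displacesʳ : Displaces a r S ⟨ egaGenerators a h k (d ℤ.+ + a) ⟩
  displacesʳ = displaces-shift {h′ = 0} {e = e} {s = 1ℤ} {N} {a} de≡1 isIndex 0≤generators hq+d≡N
    (λ {j} _ → subst (0ℤ ℤ.≤_) (sym (trans (ℤ.+-identityˡ _) (ℤ.*-identityʳ (+ j)))) (ℤ.+≤+ z≤n))
    (trans (ℤ.+-identityˡ _) (ℤ.*-identityʳ (+ a)))
    (ℕ.+-identityʳ h)
    (cong (λ x → d ℤ.+ x) (ℤ.*-identityʳ (+ a)))
    (λ i → trans (ℤ.+-identityˡ _) (ℤ.*-identityʳ (+ u i)))

  displacesᵗ : Displaces a t S ⟨ egaGenerators a (h ℕ.+ a) k (d ℤ.- + (a ℕ.* q)) ⟩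
  displacesᵗ = displaces-shift {h′ = a} {e = e} {s = ℤ.- + q} {N} {0} de≡1 isIndex 0≤generators hq+d≡N
    (λ {j} j≤k → subst (0ℤ ℤ.≤_) (cong (λ x → + a ℤ.+ x) (trans (cong ℤ.-_ (ℤ.pos-* j q)) (ℤ.neg-distribʳ-* (+ j) (+ q))))
      (ℤ.i≤j⇒0≤j-i (ℤ.+≤+ (jq≤a j≤k))))
    (cancel (+ a) (+ q))
    refl
    (cong (λ x → d ℤ.+ x) (trans (sym (ℤ.neg-distribʳ-* (+ a) (+ q))) (cong ℤ.-_ (sym (ℤ.pos-* a q)))))
    (λ i → identity (+ a) (+ ⌈ u i / k ⌉) (+ u i) (+ q))
    where
    -- The generator with coefficient j moves by a(a - jq), which must be nonnegative up to j = k.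
    jq≤a : ∀ {j} → j ℕ.≤ k → j ℕ.* q ℕ.≤ a
    jq≤a {j} j≤k = ℕ.≤-trans (ℕ.*-monoˡ-≤ q j≤k) (subst (ℕ._≤ a) (ℕ.*-comm q k) (ℕ.m/n*n≤m a k))
    cancel : ∀ a q → a ℤ.* q ℤ.+ a ℤ.* ℤ.- q ≡ 0ℤ
    cancel = solve-∀
    identity : ∀ a c u q → a ℤ.* c ℤ.+ u ℤ.* ℤ.- q ≡ a ℤ.* c ℤ.- q ℤ.* u
    identity = solve-∀

  module _ {ℓ : Level} (K : OrderedField ℓ) where
    open Faces K

    private
      w∈cone : IntCone a w
      w∈cone {i} {j} {l} = facePoint-cone {a} {k} de≡1 isIndex h N {i} {j} {l}

    -- This keeps the description of all faces containing S from being vacuous.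
    face-exists : ∃ λ F → IsFace K (GroupCone K a) F × Contains K a F S
    face-exists = MinimalFace {a} w , minimalFace-isFace {a} {w} (λ {i} {j} {l} → w∈cone {i} {j} {l}) ,
      w , apéry-resp-≗ apéryTuple egaApéry≗w , minimalFace-interior {a} {w} (λ {i} {j} {l} → w∈cone {i} {j} {l})

    face-extremalRays : ∀ F → IsFace K (GroupCone K a) F → Contains K a F S →
      ∀ G → IsExtremalRay K F G ⇔ (G ≐ Ray K (embed K r) ⊎ G ≐ Ray K (embed K t))
    face-extremalRays F isFace (x , tuple , x∈) = extremalRays
      (≐-trans
        (face≐minimalFace {a} {w} (λ {i} {j} {l} → w∈cone {i} {j} {l}) isFace
          (interior-transfer isFace (λ i → trans (apéry-unique tuple apéryTuple i) (egaApéry≗w i)) x∈))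
        (minimalFace≐cone₂ de≡1 isIndex 1<k k+2<a 0<h 0<N))
      (rays-independent de≡1 isIndex 1<k k+2<a)

    rayʳ-contains : ∀ b → 0ℤ ℤ.< b → b ≡ d [mod a ] → Contains K a (Ray K (embed K r)) ⟨ + a ∷ b ∷ [] ⟩
    rayʳ-contains = ray-contains 1<a de≡1 isIndex (λ i → refl)

    module _ (k∣a∸1 : k ℕ.∣ a ℕ.∸ 1) where

      private
        a≡qk+1 : a ≡ q ℕ.* k ℕ.+ 1
        a≡qk+1 = k∣a∸1⇒a≡qk+1 1<k k∣a∸1

        kd-invertible : + k ℤ.* d ℤ.* (ℤ.- + q ℤ.* e) ≡ 1ℤ [mod a ]
        kd-invertible = multiple-invertible a≡qk+1 {d} {e} de≡1

        kd-isIndex : IsIndex a (+ k ℤ.* d) (multipleIndex a≡qk+1 {d} {e} u)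
        kd-isIndex = multipleIndex-isIndex a≡qk+1 {d} {e} isIndex

      rayᵗ-contains : ∃ λ T → Contains K a (Ray K (embed K t)) T
      rayᵗ-contains = _ , ray-contains 1<a kd-invertible kd-isIndex (rayᵗ≡multipleIndex a≡qk+1 {d} {e} u)
        -- The witness is b = ah + kd, the last generator of S: it is congruent to kd, and positive
        -- because it exceeds a.
        (+ (a ℕ.* h) ℤ.+ + k ℤ.* d) (ℤ.≤-<-trans (ℤ.+≤+ z≤n) a<ah+kd)
        (subst (λ x → x ≡ + k ℤ.* d [mod a ])
          (trans (ℤ.+-comm (+ k ℤ.* d) _) (cong (ℤ._+ + k ℤ.* d) (trans (ℤ.*-comm (+ h) (+ a)) (sym (ℤ.pos-* a h)))))
          (mod-+multiple (+ k ℤ.* d) (+ h)))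

      rayᵗ-contained : ∀ T → Contains K a (Ray K (embed K t)) T →
        ∃ λ b → 0ℤ ℤ.< b × b ≡ + k ℤ.* d [mod a ] × T ≐ ⟨ + a ∷ b ∷ [] ⟩
      rayᵗ-contained = contained⇒twoGenerated 1<a kd-invertible kd-isIndex (rayᵗ≡multipleIndex a≡qk+1 {d} {e} u)

open import Data.Nat.Base using (_+_; _*_; _∸_; _<_)
open import Data.Nat.DivMod using (_/_)
open import Data.Nat.Divisibility using (_∣_)

theorem4p6 :
  ∀ {ℓ} (K : OrderedField ℓ) (a h k : ℕ) (d : ℤ)
  .{{_ : NonZero a}} .{{_ : NonZero h}} .{{_ : NonZero k}} →
  IsExtraGeneralizedArithmetical a h k d →
  1 < k → k < a ∸ 2 →
  let S  = ⟨ egaGenerators a h k d ⟩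
      Sʳ = ⟨ egaGenerators a h k (d ℤ.+ + a) ⟩
      Sᵗ = ⟨ egaGenerators a (h + a) k (d ℤ.- + (a * (a / k))) ⟩
  in
  ∃₂ λ (r t : Vector ℤ (pred a)) →
    Displaces a r S Sʳ ×
    Displaces a t S Sᵗ ×
    (∃ λ (F : Region K (pred a)) →
      IsFace K (GroupCone K a) F × Contains K a F S) ×
    (∀ (F : Region K (pred a)) →
      IsFace K (GroupCone K a) F → Contains K a F S →
      ∀ (G : Region K (pred a)) →
        IsExtremalRay K F G ⇔
        (G ≐ Ray K (embed K r) ⊎ G ≐ Ray K (embed K t))) ×
    (∀ (b : ℤ) → 0ℤ ℤ.< b → b ≡ d [mod a ] →
      Contains K a (Ray K (embed K r)) ⟨ + a ∷ b ∷ [] ⟩) ×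
    (k ∣ a ∸ 1 →
      (∃ λ (T : Pred ℤ 0ℓ) → Contains K a (Ray K (embed K t)) T) ×
      (∀ (T : Pred ℤ 0ℓ) → Contains K a (Ray K (embed K t)) T →
        ∃ λ (b : ℤ) → 0ℤ ℤ.< b × b ≡ + k ℤ.* d [mod a ] ×
          T ≐ ⟨ + a ∷ b ∷ [] ⟩))
theorem4p6 K a h k d ega 1<k k<a∸2 =
  r , t , displacesʳ , displacesᵗ , face-exists K , face-extremalRays K , rayʳ-contains K ,
  λ k∣a∸1 → rayᵗ-contains K k∣a∸1 , rayᵗ-contained K k∣a∸1
  where
  invertible = coprime⇒invertible {a} {d} (IsExtraGeneralizedArithmetical.coprime ega)
  indexed    = index {a} {d} {proj₁ invertible} (proj₂ invertible)
  open ExtraGeneralizedArithmetical ega 1<k k<a∸2 {proj₁ invertible} (proj₂ invertible) (proj₂ indexed)
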